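{- For every integer $d\geq 2$, one has $e_r^*(d)\leq d-2$.
   Context: All polynomials have integer coefficients. For an integer polynomial $P(x)$ of degree $d\ge 2$, let $\mathrm{H}(P)$ denote its naïve height, i.e. the maximum of the absolute values of its coefficients. If $P$ has at least two distinct complex roots, its root separation is $$\mathrm{sep}(P):=\min_{\substack{P(\alpha)=P(\beta)=0,\\ \alpha\neq\beta}}|\alpha-\beta|,$$ where the minimum is over pairs of distinct complex roots of $P$. The quantity $e(P)$ is defined (when $\mathrm{H}(P)>1$) by $\mathrm{sep}(P)=\mathrm{H}(P)^{ -e(P)}$, that is, $e(P)=-\log \mathrm{sep}(P)/\log \mathrm{H}(P)$. For $d\ge 2$, set $$e_r^*(d):=\limsup_{\deg(P)=d,\ \mathrm{H}(P)\to+\infty} e(P)=\lim_{H\to+\infty}\ \sup\{e(P): \deg P=d,\ \mathrm{H}(P)\ge H\},$$ where $P$ ranges over the monic integer polynomials of degree $d$ that are reducible over $\mathbb{Q}$ and have at least two distinct complex roots (the roots are not required to be simple). -}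

module Defs where

open import Algebra.Bundles.Raw using (RawRing)
open import Data.Integer.Base as ℤ using (ℤ; +_; -[1+_])
open import Data.List.Base using (List; []; _∷_; map; foldr)
open import Data.Nat.Base as ℕ using (ℕ; zero; suc)
import Data.Nat.Properties as ℕₚ
open import Data.Product.Base using (_×_; _,_; ∃-syntax)
open import Data.Rational.Base as ℚ using (ℚ; 0ℚ; 1ℚ; ½; ↥_; ↧ₙ_)
import Data.Rational.Properties as ℚₚ
open import Data.Rational.Solver using (module +-*-Solver)
open import Level using (0ℓ)
open import Relation.Binary.PropositionalEquality
  using (_≡_; refl; sym; trans; cong; subst; subst₂)
open import Relation.Nullary.Negation using (¬_)
open import Relation.Unary using (Pred; _∈_)

------------------------------------------------------------------------
-- Real numbers: Cauchy sequences of rationals, with pointwise operations.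
-- Equality is the setoid equality _≃_.

IsCauchy : Pred (ℕ → ℚ) 0ℓ
IsCauchy x = ∀ ε → 0ℚ ℚ.< ε →
  ∃[ N ] ∀ m n → N ℕ.≤ m → N ℕ.≤ n → ℚ.∣ x m ℚ.- x n ∣ ℚ.< ε

record ℝ : Set where
  constructor mkℝ
  field
    seq    : ℕ → ℚ
    cauchy : IsCauchy seq

open ℝ public

private

  open +-*-Solver using (solve; _:=_; _:+_; _:*_; _:-_; :-_)

  ½+½ : ∀ ε → ε ℚ.* ½ ℚ.+ ε ℚ.* ½ ≡ ε
  ½+½ ε = trans (sym (ℚₚ.*-distribˡ-+ ε ½ ½)) (ℚₚ.*-identityʳ ε)

  *-positive : ∀ p q .{{_ : ℚ.Positive q}} → 0ℚ ℚ.< p → 0ℚ ℚ.< p ℚ.* q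
  *-positive p q 0<p =
    subst (ℚ._< p ℚ.* q) (ℚₚ.*-zeroˡ q) (ℚₚ.*-monoˡ-<-pos q {0ℚ} {p} 0<p)

  ∣+∣-< : ∀ u v δ ε → ℚ.∣ u ∣ ℚ.< δ → ℚ.∣ v ∣ ℚ.< ε → ℚ.∣ u ℚ.+ v ∣ ℚ.< δ ℚ.+ ε
  ∣+∣-< u v δ ε u<δ v<ε = ℚₚ.≤-<-trans (ℚₚ.∣p+q∣≤∣p∣+∣q∣ u v)
    (ℚₚ.+-mono-< {ℚ.∣ u ∣} {δ} {ℚ.∣ v ∣} {ε} u<δ v<ε)

  ∣*∣-< : ∀ u v B δ .{{_ : ℚ.Positive B}} →
    ℚ.∣ u ∣ ℚ.≤ B → ℚ.∣ v ∣ ℚ.< δ → ℚ.∣ u ℚ.* v ∣ ℚ.< B ℚ.* δ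
  ∣*∣-< u v B δ u≤B v<δ =
    subst (ℚ._< B ℚ.* δ) (sym (ℚₚ.∣p*q∣≡∣p∣*∣q∣ u v))
      (ℚₚ.≤-<-trans
        (ℚₚ.*-monoʳ-≤-nonNeg ℚ.∣ v ∣ {{ℚₚ.∣-∣-nonNeg v}} {ℚ.∣ u ∣} {B} u≤B)
        (ℚₚ.*-monoʳ-<-pos B {ℚ.∣ v ∣} {δ} v<δ))

  close-+ : ∀ a b c d ε →
    ℚ.∣ a ℚ.- c ∣ ℚ.< ε ℚ.* ½ → ℚ.∣ b ℚ.- d ∣ ℚ.< ε ℚ.* ½ →
    ℚ.∣ (a ℚ.+ b) ℚ.- (c ℚ.+ d) ∣ ℚ.< ε
  close-+ a b c d ε p q = subst₂ ℚ._<_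
    (cong ℚ.∣_∣ (solve 4 (λ a b c d →
      (a :- c) :+ (b :- d) := (a :+ b) :- (c :+ d)) refl a b c d))
    (½+½ ε)
    (∣+∣-< (a ℚ.- c) (b ℚ.- d) (ε ℚ.* ½) (ε ℚ.* ½) p q)

  close-neg : ∀ a b → ℚ.∣ a ℚ.- b ∣ ≡ ℚ.∣ (ℚ.- a) ℚ.- (ℚ.- b) ∣
  close-neg a b = trans (sym (ℚₚ.∣-p∣≡∣p∣ (a ℚ.- b)))
    (cong ℚ.∣_∣ (solve 2 (λ a b → :- (a :- b) := (:- a) :- (:- b)) refl a b))

  close-* : ∀ a b c d B C δ .{{_ : ℚ.Positive B}} .{{_ : ℚ.Positive C}} →
    ℚ.∣ a ∣ ℚ.≤ B → ℚ.∣ d ∣ ℚ.≤ C →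
    ℚ.∣ a ℚ.- c ∣ ℚ.< δ → ℚ.∣ b ℚ.- d ∣ ℚ.< δ →
    ℚ.∣ a ℚ.* b ℚ.- c ℚ.* d ∣ ℚ.< B ℚ.* δ ℚ.+ C ℚ.* δ
  close-* a b c d B C δ a≤B d≤C p q = subst (ℚ._< B ℚ.* δ ℚ.+ C ℚ.* δ)
    (cong ℚ.∣_∣ (solve 4 (λ a b c d →
      a :* (b :- d) :+ d :* (a :- c) := a :* b :- c :* d) refl a b c d))
    (∣+∣-< (a ℚ.* (b ℚ.- d)) (d ℚ.* (a ℚ.- c)) (B ℚ.* δ) (C ℚ.* δ)
      (∣*∣-< a (b ℚ.- d) B δ a≤B q) (∣*∣-< d (a ℚ.- c) C δ d≤C p))

  bounded-step : ∀ a b → ℚ.∣ a ℚ.- b ∣ ℚ.< 1ℚ → ℚ.∣ a ∣ ℚ.≤ 1ℚ ℚ.+ ℚ.∣ b ∣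
  bounded-step a b p = subst (ℚ._≤ 1ℚ ℚ.+ ℚ.∣ b ∣)
    (cong ℚ.∣_∣ (solve 2 (λ a b → (a :- b) :+ b := a) refl a b))
    (ℚₚ.≤-trans (ℚₚ.∣p+q∣≤∣p∣+∣q∣ (a ℚ.- b) b)
      (ℚₚ.+-monoˡ-≤ ℚ.∣ b ∣ {ℚ.∣ a ℚ.- b ∣} {1ℚ} (ℚₚ.<⇒≤ p)))

  split : ∀ B C ε .{{_ : ℚ.Positive B}} .{{_ : ℚ.Positive C}} → 0ℚ ℚ.< ε →
    ∃[ δ ] 0ℚ ℚ.< δ × B ℚ.* δ ℚ.+ C ℚ.* δ ≡ ε
  split B C ε 0<ε = scale (B ℚ.+ C) {{ℚₚ.pos+pos⇒pos B C}} refl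
    where
    scale : ∀ S .{{_ : ℚ.Positive S}} → S ≡ B ℚ.+ C →
      ∃[ δ ] 0ℚ ℚ.< δ × B ℚ.* δ ℚ.+ C ℚ.* δ ≡ ε
    scale S S≡ = δ , *-positive ε (ℚ.1/ S) {{ℚₚ.1/pos⇒pos S}} 0<ε ,
      trans (sym (ℚₚ.*-distribʳ-+ δ B C))
        (trans (cong (ℚ._* δ) (sym S≡))
          (trans (rotate S ε (ℚ.1/ S))
            (trans (cong (ε ℚ.*_) (ℚₚ.*-inverseʳ S)) (ℚₚ.*-identityʳ ε))))
      where
      instance
        S≢0 : ℚ.NonZero S
        S≢0 = ℚₚ.pos⇒nonZero S
      δ : ℚ
      δ = ε ℚ.* ℚ.1/ S
      rotate : ∀ s e i → s ℚ.* (e ℚ.* i) ≡ e ℚ.* (s ℚ.* i)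
      rotate = solve 3 (λ s e i → s :* (e :* i) := e :* (s :* i)) refl

  abstract

    const-cauchy : ∀ q → IsCauchy (λ _ → q)
    const-cauchy q ε 0<ε = 0 , λ _ _ _ _ →
      subst (ℚ._< ε) (sym (cong ℚ.∣_∣ (ℚₚ.+-inverseʳ q))) 0<ε

    +-cauchy : ∀ {x y} → IsCauchy x → IsCauchy y → IsCauchy (λ n → x n ℚ.+ y n)
    +-cauchy {x} {y} cx cy ε 0<ε
      with cx (ε ℚ.* ½) (*-positive ε ½ 0<ε) | cy (ε ℚ.* ½) (*-positive ε ½ 0<ε)
    ... | M , hx | N , hy = M ℕ.⊔ N , λ m n p q →
      close-+ (x m) (y m) (x n) (y n) ε
        (hx m n (ℕₚ.m⊔n≤o⇒m≤o M N p) (ℕₚ.m⊔n≤o⇒m≤o M N q))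
        (hy m n (ℕₚ.m⊔n≤o⇒n≤o M N p) (ℕₚ.m⊔n≤o⇒n≤o M N q))

    neg-cauchy : ∀ {x} → IsCauchy x → IsCauchy (λ n → ℚ.- x n)
    neg-cauchy {x} cx ε 0<ε with cx ε 0<ε
    ... | N , h = N , λ m n p q →
      subst (ℚ._< ε) (close-neg (x m) (x n)) (h m n p q)

    eventually-bounded : ∀ {x} → IsCauchy x →
      ∃[ B ] ℚ.Positive B × ∃[ N ] ∀ n → N ℕ.≤ n → ℚ.∣ x n ∣ ℚ.≤ B
    eventually-bounded {x} cx with cx 1ℚ (ℚₚ.positive⁻¹ 1ℚ)
    ... | N , h = 1ℚ ℚ.+ ℚ.∣ x N ∣
      , ℚₚ.pos+nonNeg⇒pos 1ℚ ℚ.∣ x N ∣ {{ℚₚ.∣-∣-nonNeg (x N)}}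
      , N , λ n p → bounded-step (x n) (x N) (h n N p ℕₚ.≤-refl)

    *-cauchy : ∀ {x y} → IsCauchy x → IsCauchy y → IsCauchy (λ n → x n ℚ.* y n)
    *-cauchy {x} {y} cx cy ε 0<ε =
      let B , B>0 , K , bx = eventually-bounded {x} cx
          C , C>0 , L , by = eventually-bounded {y} cy
          δ , 0<δ , eq     = split B C ε {{B>0}} {{C>0}} 0<ε
          M , hx           = cx δ 0<δ
          N , hy           = cy δ 0<δ
      in (K ℕ.⊔ L) ℕ.⊔ (M ℕ.⊔ N) , λ m n p q →
      let p₁ = ℕₚ.m⊔n≤o⇒m≤o (K ℕ.⊔ L) (M ℕ.⊔ N) p
          q₁ = ℕₚ.m⊔n≤o⇒m≤o (K ℕ.⊔ L) (M ℕ.⊔ N) q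
          p₂ = ℕₚ.m⊔n≤o⇒n≤o (K ℕ.⊔ L) (M ℕ.⊔ N) p
          q₂ = ℕₚ.m⊔n≤o⇒n≤o (K ℕ.⊔ L) (M ℕ.⊔ N) q
      in subst (ℚ.∣ x m ℚ.* y m ℚ.- x n ℚ.* y n ∣ ℚ.<_) eq
        (close-* (x m) (y m) (x n) (y n) B C δ {{B>0}} {{C>0}}
          (bx m (ℕₚ.m⊔n≤o⇒m≤o K L p₁))
          (by n (ℕₚ.m⊔n≤o⇒n≤o K L q₁))
          (hx m n (ℕₚ.m⊔n≤o⇒m≤o M N p₂) (ℕₚ.m⊔n≤o⇒m≤o M N q₂))
          (hy m n (ℕₚ.m⊔n≤o⇒n≤o M N p₂) (ℕₚ.m⊔n≤o⇒n≤o M N q₂)))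

infix  4 _≤ᴿ_ _≃ᴿ_
infix  8 -ᴿ_
infixl 6 _+ᴿ_ _-ᴿ_
infixl 7 _*ᴿ_
infixr 8 _^ᴿ_

fromℚ : ℚ → ℝ
fromℚ q = mkℝ (λ _ → q) (const-cauchy q)

_+ᴿ_ : ℝ → ℝ → ℝ
mkℝ x cx +ᴿ mkℝ y cy = mkℝ (λ n → x n ℚ.+ y n) (+-cauchy {x} {y} cx cy)

-ᴿ_ : ℝ → ℝ
-ᴿ mkℝ x cx = mkℝ (λ n → ℚ.- x n) (neg-cauchy {x} cx)

_-ᴿ_ : ℝ → ℝ → ℝ
x -ᴿ y = x +ᴿ (-ᴿ y)

_*ᴿ_ : ℝ → ℝ → ℝ
mkℝ x cx *ᴿ mkℝ y cy = mkℝ (λ n → x n ℚ.* y n) (*-cauchy {x} {y} cx cy)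

_^ᴿ_ : ℝ → ℕ → ℝ
x ^ᴿ zero  = fromℚ 1ℚ
x ^ᴿ suc n = x *ᴿ x ^ᴿ n

_≤ᴿ_ : ℝ → ℝ → Set
x ≤ᴿ y = ∀ ε → 0ℚ ℚ.< ε → ∃[ N ] ∀ n → N ℕ.≤ n → seq x n ℚ.≤ seq y n ℚ.+ ε

_≃ᴿ_ : ℝ → ℝ → Set
x ≃ᴿ y = x ≤ᴿ y × y ≤ᴿ x

IsMinimum : Pred ℝ 0ℓ → ℝ → Set
IsMinimum S s = s ∈ S × (∀ t → t ∈ S → s ≤ᴿ t)

------------------------------------------------------------------------
-- Real powers of an integer b > 1

_^ℤ_ : (b : ℕ) .{{_ : ℕ.NonZero b}} → ℤ → ℚ
b ^ℤ (+ n)    = + (b ℕ.^ n) ℚ./ 1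
b ^ℤ -[1+ n ] = (+ 1 ℚ./ (b ℕ.^ suc n)) {{ℕₚ.m^n≢0 b (suc n)}}

-- IsPower b x y means y = bˣ, where bˣ is determined by its comparison with
-- the powers b^(p/q) for rationals p/q on either side of x; the inequality
-- between b^(p/q) and y is raised to the q-th power.

record IsPower (b : ℕ) .{{_ : ℕ.NonTrivial b}} (x y : ℝ) : Set where
  private instance
    b≢0 : ℕ.NonZero b
    b≢0 = ℕ.nonTrivial⇒nonZero b
  field
    positive : ∃[ δ ] 0ℚ ℚ.< δ × fromℚ δ ≤ᴿ y
    lower    : ∀ r → fromℚ r ≤ᴿ x → fromℚ (b ^ℤ (↥ r)) ≤ᴿ y ^ᴿ (↧ₙ r)
    upper    : ∀ r → x ≤ᴿ fromℚ r → y ^ᴿ (↧ₙ r) ≤ᴿ fromℚ (b ^ℤ (↥ r))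

------------------------------------------------------------------------
-- Complex numbers

record ℂ : Set where
  constructor _+i_
  field
    re : ℝ
    im : ℝ

open ℂ public

infix  4 _≃ᶜ_
infixl 6 _+ᶜ_ _-ᶜ_
infixl 7 _*ᶜ_

fromℤ : ℤ → ℂ
fromℤ a = fromℚ (a ℚ./ 1) +i fromℚ 0ℚ

_+ᶜ_ : ℂ → ℂ → ℂ
(a +i b) +ᶜ (c +i d) = (a +ᴿ c) +i (b +ᴿ d)

_-ᶜ_ : ℂ → ℂ → ℂ
(a +i b) -ᶜ (c +i d) = (a -ᴿ c) +i (b -ᴿ d)

_*ᶜ_ : ℂ → ℂ → ℂ
(a +i b) *ᶜ (c +i d) = (a *ᴿ c -ᴿ b *ᴿ d) +i (a *ᴿ d +ᴿ b *ᴿ c)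

_≃ᶜ_ : ℂ → ℂ → Set
z ≃ᶜ w = re z ≃ᴿ re w × im z ≃ᴿ im w

-- t = |z|
IsModulus : ℂ → ℝ → Set
IsModulus z t = fromℚ 0ℚ ≤ᴿ t × t ^ᴿ 2 ≃ᴿ re z ^ᴿ 2 +ᴿ im z ^ᴿ 2

------------------------------------------------------------------------
-- Polynomials as coefficient lists, constant term first; trailing zeros
-- are allowed

module Polynomial (R : RawRing 0ℓ 0ℓ) where
  open RawRing R

  Poly : Set
  Poly = List Carrier

  coeff : Poly → ℕ → Carrier
  coeff []      _       = 0#
  coeff (a ∷ p) zero    = a
  coeff (a ∷ p) (suc n) = coeff p n

  infix  4 _≈ₚ_
  infixl 6 _+ₚ_
  infixl 7 _*ₚ_

  _≈ₚ_ : Poly → Poly → Set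
  p ≈ₚ q = ∀ n → coeff p n ≈ coeff q n

  _+ₚ_ : Poly → Poly → Poly
  []      +ₚ q       = q
  (a ∷ p) +ₚ []      = a ∷ p
  (a ∷ p) +ₚ (b ∷ q) = (a + b) ∷ (p +ₚ q)

  _*ₚ_ : Poly → Poly → Poly
  []      *ₚ q = []
  (a ∷ p) *ₚ q = map (a *_) q +ₚ (0# ∷ (p *ₚ q))

  HasDegree : Poly → ℕ → Set
  HasDegree p n = ¬ (coeff p n ≈ 0#) × (∀ m → n ℕ.< m → coeff p m ≈ 0#)

  Monic : Poly → ℕ → Set
  Monic p n = HasDegree p n × coeff p n ≈ 1#

module ℤ[x] = Polynomial ℤ.+-*-rawRing
module ℚ[x] = Polynomial ℚ.+-*-rawRing

toℚ[x] : ℤ[x].Poly → ℚ[x].Poly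
toℚ[x] = map (ℚ._/ 1)

height : ℤ[x].Poly → ℕ
height p = foldr ℕ._⊔_ 0 (map ℤ.∣_∣ p)

Reducible : ℚ[x].Poly → Set
Reducible p = ∃[ f ] ∃[ g ] ∃[ m ] ∃[ n ]
  1 ℕ.≤ m × 1 ℕ.≤ n × ℚ[x].HasDegree f m × ℚ[x].HasDegree g n ×
  p ℚ[x].≈ₚ f ℚ[x].*ₚ g

eval : ℤ[x].Poly → ℂ → ℂ
eval []      z = fromℤ (+ 0)
eval (a ∷ p) z = fromℤ a +ᶜ z *ᶜ eval p z

IsRoot : ℤ[x].Poly → ℂ → Set
IsRoot p z = eval p z ≃ᶜ fromℤ (+ 0)

------------------------------------------------------------------------
-- Root separation

DistinctRoots : ℤ[x].Poly → ℂ → ℂ → Set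
DistinctRoots p α β = IsRoot p α × IsRoot p β × ¬ (α ≃ᶜ β)

RootDistance : ℤ[x].Poly → Pred ℝ 0ℓ
RootDistance p t = ∃[ α ] ∃[ β ] DistinctRoots p α β × IsModulus (α -ᶜ β) t

-- s = sep p
IsSep : ℤ[x].Poly → ℝ → Set
IsSep p = IsMinimum (RootDistance p)

-- e = e(p), that is, height p > 1 and sep p = (height p)⁻ᵉ
record IsExponent (p : ℤ[x].Poly) (e : ℝ) : Set where
  field
    1<height : ℕ.NonTrivial (height p)
    sep      : ℝ
    isSep    : IsSep p sep
    isPower  : IsPower (height p) {{1<height}} (-ᴿ e) sep

------------------------------------------------------------------------
-- Upper reals: elements of [-∞, +∞] given by their rational upper bounds.
-- Suprema and infima of sets of reals need not exist constructively as
-- Cauchy reals, but they do as upper reals.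

UpperReal : Set₁
UpperReal = Pred ℚ 0ℓ

⨆ : Pred ℝ 0ℓ → UpperReal
⨆ S r = ∀ x → x ∈ S → x ≤ᴿ fromℚ r

⨅ : (ℕ → UpperReal) → UpperReal
⨅ U r = ∃[ n ] r ∈ U n

infix 4 _≤ᵁ_

-- Whether the bounds in U are strict is immaterial here.
_≤ᵁ_ : UpperReal → ℚ → Set
U ≤ᵁ c = ∀ r → c ℚ.< r → r ∈ U

------------------------------------------------------------------------
-- The quantity e*ᵣ(d)

record Admissible (d : ℕ) (p : ℤ[x].Poly) : Set where
  field
    monic     : ℤ[x].Monic p d
    reducible : Reducible (toℚ[x] p)
    twoRoots  : ∃[ α ] ∃[ β ] DistinctRoots p α β

Exponents≥ : ℕ → ℕ → Pred ℝ 0ℓ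
Exponents≥ d H e = ∃[ p ] Admissible d p × H ℕ.≤ height p × IsExponent p e

-- The suprema decrease as H grows, so their limit is their infimum.
e*ᵣ : ℕ → UpperReal
e*ᵣ d = ⨅ λ H → ⨆ (Exponents≥ d H)

{-# OPTIONS --safe #-}
module Submission where

-- Let P be monic, reducible, of degree d and height H, and let α ≠ β be roots of
-- P with integer minimal polynomials f and g of degrees m and n.  By Gauss's lemma
-- these are factors of P, and the heights of factors multiply up to constants:
-- f and g are comparable to their heights at all but m + n of the points 0, …, d.
--
-- If f ≠ g, a pigeonhole argument on (U, V) with deg U < n, deg V < m in place of
-- the resultant gives U f + V g = k xʲ with k ≠ 0 and U, V of size
-- ≪ H(f)ⁿ⁻¹ H(g)ᵐ and ≪ H(f)ⁿ H(g)ᵐ⁻¹.  At x = α the left side is V(α) g(α) with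
-- g(α) = g(α) − g(β), and |α − β| ≫ H(f)⁻ⁿ H(g)⁻ᵐ follows; this is enough unless
-- m or n is 1, when the linear factor has an integer root b and |f(b)| ≥ 1.
--
-- If f = g, then m < d since P is reducible.  The polynomials f′ and m f − x f′, of
-- degree m − 1, are both ≪ H(f) |α − β|² at the midpoint of α and β, so the same
-- pigeonhole argument gives |α − β|² ≫ H(f)^(−2(m − 1)).
--
-- All estimates are made in ℚ(i), at rational approximations of α and β.  The
-- classical choices are harmless as the conclusion e ≤ r is a negative statement.

open import Defs
open import Algebra.Bundles using (CommutativeRing)
open import Algebra.Structures using (IsCommutativeRing)
open import Data.Empty using (⊥; ⊥-elim)
open import Data.Integer.Base as ℤ using (ℤ; +_; -[1+_])
import Data.Integer.Properties as ℤₚ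
open import Data.List.Base using (List; []; _∷_; map; length)
open import Data.Nat.Base as ℕ using (ℕ; zero; suc; z≤n; s≤s)
import Data.Nat.Properties as ℕₚ
open import Data.Product.Base using (_×_; _,_; ∃-syntax; proj₁; proj₂)
import Data.Rational.Base as ℚ
open import Data.Sum.Base as Sum using (_⊎_; inj₁; inj₂)
open import Function.Base using (_∘_)
open import Relation.Binary.PropositionalEquality
open import Relation.Nullary using (¬_; Dec; yes; no; contradiction)

-- The roots may be as large as the height, so an estimate that loses powers of |α| would spoil the
-- exponent. Hence all bounds are homogeneous: with μ = max(1, |γ|), a polynomial of degree m and
-- height F is measured against F μ^m at γ. The index j of the surviving monomial is left free for
-- the same reason. It is 0 when |γ| ≤ 1 and the top index m + n - 1 otherwise; in both cases k γ^j
-- is at least of order μ^(m + n - 1), and the powers of μ cancel. For two roots of one polynomial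
-- q, the pair (q, q′) would give too large an exponent. The two partial derivatives of the binary
-- form of q both have degree one less than q, and at the midpoint, by symmetry, both are of second
-- order in the distance; at a root, q′ is only of first order. Two kinds of constants occur. Those
-- in front of |α - β| depend on d and a power of the height and decide the exponent. Those in front
-- of the approximation error may depend on the polynomials in any way, because the precision is
-- chosen after them.

-- Coefficient lists over a commutative ring.

module PolyTheory {A : Set} {_+_ _*_ : A → A → A} { -_ : A → A} {0# 1# : A}
  (isCommutativeRing : IsCommutativeRing _≡_ _+_ _*_ -_ 0# 1#) where

  import Algebra.Solver.Ring.NaturalCoefficients.Default as NaturalSolver

  bundle : CommutativeRing _ _
  bundle = record { isCommutativeRing = isCommutativeRing }

  open CommutativeRing bundle using (rawRing; commutativeSemiring; +-identityʳ; +-identityˡ; zeroˡ;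
      zeroʳ; *-comm)
  open Polynomial rawRing

  open NaturalSolver commutativeSemiring using (solve; _:=_; _:+_; _:*_)

  coeff-length : ∀ p {i} → length p ℕ.≤ i → coeff p i ≡ 0#
  coeff-length []      _         = refl
  coeff-length (a ∷ p) (s≤s p≤i) = coeff-length p p≤i

  coeff-+ : ∀ p q i → coeff (p +ₚ q) i ≡ coeff p i + coeff q i
  coeff-+ []      q       i       = sym (+-identityˡ _)
  coeff-+ (a ∷ p) []      i       = sym (+-identityʳ _)
  coeff-+ (a ∷ p) (b ∷ q) zero    = refl
  coeff-+ (a ∷ p) (b ∷ q) (suc i) = coeff-+ p q i

  coeff-map : ∀ a p i → coeff (map (a *_) p) i ≡ a * coeff p i
  coeff-map a []      i       = sym (zeroʳ a)
  coeff-map a (b ∷ p) zero    = refl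
  coeff-map a (b ∷ p) (suc i) = coeff-map a p i

  coeff-∷*-zero : ∀ a p q → coeff ((a ∷ p) *ₚ q) 0 ≡ a * coeff q 0
  coeff-∷*-zero a p q = trans (coeff-+ (map (a *_) q) _ 0)
    (trans (+-identityʳ _) (coeff-map a q 0))

  coeff-∷*-suc : ∀ a p q i →
    coeff ((a ∷ p) *ₚ q) (suc i) ≡ (a * coeff q (suc i)) + coeff (p *ₚ q) i
  coeff-∷*-suc a p q i = trans (coeff-+ (map (a *_) q) _ (suc i))
    (cong (_+ coeff (p *ₚ q) i) (coeff-map a q (suc i)))

  private
    swap-+ : ∀ x y z → x + (y + z) ≡ y + (x + z)
    swap-+ = solve 3 (λ x y z → (x :+ (y :+ z)) := (y :+ (x :+ z))) refl

    factor : ∀ a b x y → (a * (b * x)) + (b * y) ≡ b * ((a * x) + y)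
    factor = solve 4 (λ a b x y → ((a :* (b :* x)) :+ (b :* y)) := (b :* ((a :* x) :+ y))) refl

  coeff-*∷-zero : ∀ p b q → coeff (p *ₚ (b ∷ q)) 0 ≡ b * coeff p 0
  coeff-*∷-zero []      b q = sym (zeroʳ b)
  coeff-*∷-zero (a ∷ p) b q = trans (coeff-∷*-zero a p (b ∷ q)) (*-comm a b)

  -- Multiplication recurses on its left factor. This mirror recursion on the right factor lets the
  -- induction in `prime-divides-product` remove a constant coefficient from either side.
  coeff-*∷-suc : ∀ p b q i →
    coeff (p *ₚ (b ∷ q)) (suc i) ≡ (b * coeff p (suc i)) + coeff (p *ₚ q) i
  coeff-*∷-suc []      b q i = sym (trans (+-identityʳ _) (zeroʳ b))
  coeff-*∷-suc (a ∷ p) b q zero = trans (coeff-∷*-suc a p (b ∷ q) 0)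
    (trans (cong (_+_ (a * coeff q 0)) (coeff-*∷-zero p b q))
      (trans (CommutativeRing.+-comm bundle _ _)
        (cong (_+_ (b * coeff p 0)) (sym (coeff-∷*-zero a p q)))))
  coeff-*∷-suc (a ∷ p) b q (suc i) = trans (coeff-∷*-suc a p (b ∷ q) (suc i))
    (trans (cong (_+_ (a * coeff q (suc i))) (coeff-*∷-suc p b q i))
      (trans (swap-+ _ _ _)
        (cong (_+_ (b * coeff p (suc i))) (sym (coeff-∷*-suc a p q i)))))

  *ₚ-zeroˡ : ∀ {p} q → p ≈ₚ [] → p *ₚ q ≈ₚ []
  *ₚ-zeroˡ {[]}    q p≈0 i = refl
  *ₚ-zeroˡ {a ∷ p} q p≈0 zero =
    trans (coeff-∷*-zero a p q) (trans (cong (_* coeff q 0) (p≈0 0)) (zeroˡ _))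
  *ₚ-zeroˡ {a ∷ p} q p≈0 (suc i) = trans (coeff-∷*-suc a p q i)
    (trans (cong₂ _+_ (trans (cong (_* coeff q (suc i)) (p≈0 0)) (zeroˡ _))
                      (*ₚ-zeroˡ {p} q (λ j → p≈0 (suc j)) i))
      (+-identityʳ _))

  *ₚ-congˡ : ∀ {p p′} q → p ≈ₚ p′ → p *ₚ q ≈ₚ p′ *ₚ q
  *ₚ-congˡ {[]}    {p′}     q p≈ i = sym (*ₚ-zeroˡ {p′} q (λ j → sym (p≈ j)) i)
  *ₚ-congˡ {a ∷ p} {[]}     q p≈ i = *ₚ-zeroˡ {a ∷ p} q p≈ i
  *ₚ-congˡ {a ∷ p} {b ∷ p′} q p≈ zero = trans (coeff-∷*-zero a p q)
    (trans (cong (_* coeff q 0) (p≈ 0)) (sym (coeff-∷*-zero b p′ q)))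
  *ₚ-congˡ {a ∷ p} {b ∷ p′} q p≈ (suc i) = trans (coeff-∷*-suc a p q i)
    (trans (cong₂ _+_ (cong (_* coeff q (suc i)) (p≈ 0)) (*ₚ-congˡ {p} {p′} q (λ j → p≈ (suc j)) i))
      (sym (coeff-∷*-suc b p′ q i)))

  *ₚ-scaleˡ : ∀ b p q i → coeff (map (b *_) p *ₚ q) i ≡ b * coeff (p *ₚ q) i
  *ₚ-scaleˡ b []      q i = sym (zeroʳ b)
  *ₚ-scaleˡ b (a ∷ p) q zero = trans (coeff-∷*-zero (b * a) (map (b *_) p) q)
    (trans (CommutativeRing.*-assoc bundle b a _) (cong (b *_) (sym (coeff-∷*-zero a p q))))
  *ₚ-scaleˡ b (a ∷ p) q (suc i) = trans (coeff-∷*-suc (b * a) (map (b *_) p) q i)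
    (trans (cong (_+_ ((b * a) * coeff q (suc i))) (*ₚ-scaleˡ b p q i))
      (trans (distrib b a _ _) (cong (b *_) (sym (coeff-∷*-suc a p q i)))))
    where
    distrib : ∀ b a x y → ((b * a) * x) + (b * y) ≡ b * ((a * x) + y)
    distrib = solve 4 (λ b a x y → (((b :* a) :* x) :+ (b :* y)) := (b :* ((a :* x) :+ y))) refl

  *ₚ-scaleʳ : ∀ b p q i → coeff (p *ₚ map (b *_) q) i ≡ b * coeff (p *ₚ q) i
  *ₚ-scaleʳ b []      q i = sym (zeroʳ b)
  *ₚ-scaleʳ b (a ∷ p) q zero = trans (coeff-∷*-zero a p (map (b *_) q))
    (trans (cong (a *_) (coeff-map b q 0))
      (trans (swap-* a b _) (cong (b *_) (sym (coeff-∷*-zero a p q)))))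
    where
    swap-* : ∀ a b x → a * (b * x) ≡ b * (a * x)
    swap-* = solve 3 (λ a b x → (a :* (b :* x)) := (b :* (a :* x))) refl
  *ₚ-scaleʳ b (a ∷ p) q (suc i) = trans (coeff-∷*-suc a p (map (b *_) q) i)
    (trans (cong₂ _+_ (cong (a *_) (coeff-map b q (suc i))) (*ₚ-scaleʳ b p q i))
      (trans (factor a b _ _) (cong (b *_) (sym (coeff-∷*-suc a p q i)))))

  Below : Poly → ℕ → Set
  Below p n = ∀ i → n ℕ.≤ i → coeff p i ≡ 0#

  *ₚ-above : ∀ p q {m n} → Below p (suc m) → Below q (suc n) → Below (p *ₚ q) (suc (m ℕ.+ n))
  *ₚ-top   : ∀ p q {m n} → Below p (suc m) → Below q (suc n) →
    coeff (p *ₚ q) (m ℕ.+ n) ≡ coeff p m * coeff q n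

  *ₚ-above [] q p≤ q≤ i _ = refl
  *ₚ-above (a ∷ p) q {zero} {n} p≤ q≤ (suc i) (s≤s n≤i) = trans (coeff-∷*-suc a p q i)
    (trans (cong₂ _+_ (trans (cong (a *_) (q≤ (suc i) (s≤s n≤i))) (zeroʳ a))
                      (*ₚ-zeroˡ {p} q (λ j → p≤ (suc j) (s≤s z≤n)) i))
      (+-identityʳ _))
  *ₚ-above (a ∷ p) q {suc m} {n} p≤ q≤ (suc i) (s≤s m+n<i) = trans (coeff-∷*-suc a p q i)
    (trans (cong₂ _+_
        (trans (cong (a *_) (q≤ (suc i) (s≤s (ℕₚ.≤-trans (ℕₚ.m≤n+m n (suc m)) m+n<i)))) (zeroʳ a))
        (*ₚ-above p q (λ j m<j → p≤ (suc j) (s≤s m<j)) q≤ i m+n<i))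
      (+-identityʳ _))

  *ₚ-top [] q p≤ q≤ = sym (zeroˡ _)
  *ₚ-top (a ∷ p) q {zero} {zero} p≤ q≤ = coeff-∷*-zero a p q
  *ₚ-top (a ∷ p) q {zero} {suc n} p≤ q≤ = trans (coeff-∷*-suc a p q n)
    (trans (cong (_+_ (a * coeff q (suc n))) (*ₚ-zeroˡ {p} q (λ j → p≤ (suc j) (s≤s z≤n)) n))
      (+-identityʳ _))
  *ₚ-top (a ∷ p) q {suc m} {n} p≤ q≤ = trans (coeff-∷*-suc a p q (m ℕ.+ n))
    (trans (cong₂ _+_
        (trans (cong (a *_) (q≤ (suc (m ℕ.+ n)) (s≤s (ℕₚ.m≤n+m n m)))) (zeroʳ a))
        (*ₚ-top p q (λ j m<j → p≤ (suc j) (s≤s m<j)) q≤))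
      (+-identityˡ _))

  -- Pads as well as cuts, so that the list has exactly the prescribed length, from which `Degree`
  -- and `short-vanishing` read off the degree.
  truncate : ℕ → Poly → Poly
  truncate zero    p       = []
  truncate (suc n) []      = 0# ∷ truncate n []
  truncate (suc n) (a ∷ p) = a ∷ truncate n p

  length-truncate : ∀ n p → length (truncate n p) ≡ n
  length-truncate zero    p       = refl
  length-truncate (suc n) []      = cong suc (length-truncate n [])
  length-truncate (suc n) (a ∷ p) = cong suc (length-truncate n p)

  coeff-truncate : ∀ n p {i} → i ℕ.< n → coeff (truncate n p) i ≡ coeff p i
  coeff-truncate (suc n) []      {zero}  _         = refl
  coeff-truncate (suc n) (a ∷ p) {zero}  _         = refl
  coeff-truncate (suc n) []      {suc i} (s≤s i<n) = coeff-truncate n [] i<n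
  coeff-truncate (suc n) (a ∷ p) {suc i} (s≤s i<n) = coeff-truncate n p i<n

  truncate-≈ : ∀ n p → Below p n → truncate n p ≈ₚ p
  truncate-≈ n p p< i with i ℕₚ.<? n
  ... | yes i<n = coeff-truncate n p i<n
  ... | no  i≮n = trans
    (coeff-length (truncate n p) (subst (ℕ._≤ i) (sym (length-truncate n p)) (ℕₚ.≮⇒≥ i≮n)))
    (sym (p< i (ℕₚ.≮⇒≥ i≮n)))

  -- Unlike `HasDegree` this excludes trailing zeros: the analytic bounds are inductions over the
  -- list, and the exponents in them are its length.
  record Degree (k : ℕ) (p : Poly) : Set where
    constructor degree
    field
      len : length p ≡ suc k
      top : coeff p k ≢ 0#

    below : Below p (suc k)
    below i k<i = coeff-length p (subst (ℕ._≤ i) (sym len) k<i)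

  open Degree public

  trim : (∀ a → Dec (a ≡ 0#)) → ∀ p →
    p ≈ₚ [] ⊎ (∃[ k ] ∃[ q ] k ℕ.< length p × Degree k q × q ≈ₚ p)
  trim _≟0 [] = inj₁ (λ _ → refl)
  trim _≟0 (a ∷ p) with trim _≟0 p
  ... | inj₂ (k , q , k< , deg , q≈p) = inj₂ (suc k , a ∷ q , s≤s k< ,
        degree (cong suc (len deg)) (top deg) ,
        λ { zero → refl ; (suc i) → q≈p i })
  ... | inj₁ p≈0 with a ≟0
  ...   | yes a≡0 = inj₁ (λ { zero → a≡0 ; (suc i) → p≈0 i })
  ...   | no  a≢0 = inj₂ (0 , a ∷ [] , s≤s z≤n , degree refl a≢0 ,
          λ { zero → refl ; (suc i) → sym (p≈0 i) })

-- Evaluation along a ring homomorphism, divided differences, Taylor expansion.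

module Evaluation
  {A : Set} {_+_ _*_ : A → A → A} { -_ : A → A} {0# 1# : A}
  (isCommutativeRing : IsCommutativeRing _≡_ _+_ _*_ -_ 0# 1#)
  {R : Set} {_⊕_ _⊗_ : R → R → R} {⊖_ : R → R} {0ᴿ 1ᴿ : R}
  (isCommutativeRingᴿ : IsCommutativeRing _≡_ _⊕_ _⊗_ ⊖_ 0ᴿ 1ᴿ)
  (ι : A → R) (ι-0 : ι 0# ≡ 0ᴿ)
  (ι-+ : ∀ a b → ι (a + b) ≡ ι a ⊕ ι b)
  (ι-* : ∀ a b → ι (a * b) ≡ ι a ⊗ ι b) where

  import Algebra.Solver.Ring.NaturalCoefficients.Default as NaturalSolver
  open PolyTheory isCommutativeRing

  bundleᴿ : CommutativeRing _ _
  bundleᴿ = record { isCommutativeRing = isCommutativeRingᴿ }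

  open CommutativeRing bundle using (rawRing)
  open CommutativeRing bundleᴿ using (commutativeSemiring; zeroˡ; zeroʳ; +-identityˡ; +-identityʳ)
  open Polynomial rawRing

  open NaturalSolver commutativeSemiring using (solve; _:=_; _:+_; _:*_)

  ev : Poly → R → R
  ev []      x = 0ᴿ
  ev (a ∷ p) x = ι a ⊕ (x ⊗ ev p x)

  ev-+ : ∀ p q x → ev (p +ₚ q) x ≡ ev p x ⊕ ev q x
  ev-+ []      q       x = sym (+-identityˡ _)
  ev-+ (a ∷ p) []      x = sym (+-identityʳ _)
  ev-+ (a ∷ p) (b ∷ q) x = trans
    (cong₂ (λ c e → c ⊕ (x ⊗ e)) (ι-+ a b) (ev-+ p q x))
    (solve 5 (λ a b x p q → (a :+ b) :+ x :* (p :+ q) := (a :+ x :* p) :+ (b :+ x :* q))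
      refl (ι a) (ι b) x (ev p x) (ev q x))

  ev-map : ∀ a p x → ev (map (a *_) p) x ≡ ι a ⊗ ev p x
  ev-map a []      x = sym (zeroʳ _)
  ev-map a (b ∷ p) x = trans
    (cong₂ (λ c e → c ⊕ (x ⊗ e)) (ι-* a b) (ev-map a p x))
    (solve 4 (λ a b x p → (a :* b) :+ x :* (a :* p) := a :* (b :+ x :* p))
      refl (ι a) (ι b) x (ev p x))

  ev-0∷ : ∀ p x → ev (0# ∷ p) x ≡ x ⊗ ev p x
  ev-0∷ p x = trans (cong (_⊕ (x ⊗ ev p x)) ι-0) (+-identityˡ _)

  ev-* : ∀ p q x → ev (p *ₚ q) x ≡ ev p x ⊗ ev q x
  ev-* []      q x = sym (zeroˡ _)
  ev-* (a ∷ p) q x = trans (ev-+ (map (a *_) q) (0# ∷ (p *ₚ q)) x) (trans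
    (cong₂ _⊕_ (ev-map a q x) (trans (ev-0∷ (p *ₚ q) x) (cong (x ⊗_) (ev-* p q x))))
    (solve 4 (λ a x p q → a :* q :+ x :* (p :* q) := (a :+ x :* p) :* q)
      refl (ι a) x (ev p x) (ev q x)))

  ev-zero : ∀ p x → p ≈ₚ [] → ev p x ≡ 0ᴿ
  ev-zero []      x p≈0 = refl
  ev-zero (a ∷ p) x p≈0 = trans
    (cong₂ (λ c e → c ⊕ (x ⊗ e)) (trans (cong ι (p≈0 0)) ι-0) (ev-zero p x (λ i → p≈0 (suc i))))
    (trans (+-identityˡ _) (zeroʳ x))

  ev-≈ : ∀ p q x → p ≈ₚ q → ev p x ≡ ev q x
  ev-≈ []      q       x p≈q = sym (ev-zero q x (λ i → sym (p≈q i)))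
  ev-≈ (a ∷ p) []      x p≈q = ev-zero (a ∷ p) x p≈q
  ev-≈ (a ∷ p) (b ∷ q) x p≈q =
    cong₂ (λ c e → c ⊕ (x ⊗ e)) (cong ι (p≈q 0)) (ev-≈ p q x (λ i → p≈q (suc i)))

  -- The divided difference (p(y) − p(x)) / (y − x).
  quot : Poly → R → R → R
  quot []      x y = 0ᴿ
  quot (a ∷ p) x y = ev p x ⊕ (y ⊗ quot p x y)

  ev-quot : ∀ p x u → ev p (x ⊕ u) ≡ ev p x ⊕ (u ⊗ quot p x (x ⊕ u))
  ev-quot []      x u = sym (trans (+-identityˡ _) (zeroʳ u))
  ev-quot (a ∷ p) x u = trans
    (cong (λ e → ι a ⊕ ((x ⊕ u) ⊗ e)) (ev-quot p x u))
    (solve 5 (λ a x u e q → a :+ (x :+ u) :* (e :+ u :* q)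
        := (a :+ x :* e) :+ u :* (e :+ (x :+ u) :* q))
      refl (ι a) x u (ev p x) (quot p x (x ⊕ u)))

  -- Taylor expansion to third order:
  -- p(x + u) = p(x) + u D¹ p x + u² D² p x + u³ D³ p x u.
  D¹ D² : Poly → R → R
  D¹ []      x = 0ᴿ
  D¹ (a ∷ p) x = ev p x ⊕ (x ⊗ D¹ p x)
  D² []      x = 0ᴿ
  D² (a ∷ p) x = D¹ p x ⊕ (x ⊗ D² p x)

  D³ : Poly → R → R → R
  D³ []      x u = 0ᴿ
  D³ (a ∷ p) x u = D² p x ⊕ ((x ⊕ u) ⊗ D³ p x u)

  taylor : ∀ p x u → ev p (x ⊕ u) ≡
    ev p x ⊕ (u ⊗ (D¹ p x ⊕ (u ⊗ (D² p x ⊕ (u ⊗ D³ p x u)))))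
  taylor []      x u = sym (trans (+-identityˡ _)
    (trans (cong (u ⊗_) (trans (+-identityˡ _)
      (trans (cong (u ⊗_) (trans (+-identityˡ _) (zeroʳ u))) (zeroʳ u)))) (zeroʳ u)))
  taylor (a ∷ p) x u = trans
    (cong (λ e → ι a ⊕ ((x ⊕ u) ⊗ e)) (taylor p x u))
    (solve 7 (λ a x u e d d′ d″ →
        a :+ (x :+ u) :* (e :+ u :* (d :+ u :* (d′ :+ u :* d″)))
        := (a :+ x :* e) :+ u :* ((e :+ x :* d)
             :+ u :* ((d :+ x :* d′) :+ u :* (d′ :+ (x :+ u) :* d″))))
      refl (ι a) x u (ev p x) (D¹ p x) (D² p x) (D³ p x u))

  deriv : Poly → Poly
  deriv []      = []
  deriv (a ∷ p) = p +ₚ (0# ∷ deriv p)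

  ev-deriv : ∀ p x → ev (deriv p) x ≡ D¹ p x
  ev-deriv []      x = refl
  ev-deriv (a ∷ p) x = trans (ev-+ p (0# ∷ deriv p) x)
    (cong (ev p x ⊕_) (trans (ev-0∷ (deriv p) x) (cong (x ⊗_) (ev-deriv p x))))

-- Embedded integers, inequalities and powers in the rationals.

module Rationals where

  open import Data.Rational.Base
  open import Data.Rational.Properties
  open import Data.Rational.Solver using (module +-*-Solver)
  import Data.Rational.Unnormalised.Base as ℚᵘ
  import Data.Rational.Unnormalised.Properties as ℚᵘₚ

  open +-*-Solver

  abstract
    cast : ℤ → ℚ
    cast a = a / 1

    cast≡ : ∀ a → cast a ≡ a / 1
    cast≡ a = refl

    toℚᵘ-cast : ∀ a → toℚᵘ (cast a) ℚᵘ.≃ ℚᵘ.mkℚᵘ a 0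
    toℚᵘ-cast a = toℚᵘ-fromℚᵘ (ℚᵘ.mkℚᵘ a 0)

  ⟨_⟩ : ℕ → ℚ
  ⟨ n ⟩ = cast (+ n)

  ⟨0⟩ : ⟨ 0 ⟩ ≡ 0ℚ
  ⟨0⟩ = cast≡ (+ 0)

  ⟨1⟩ : ⟨ 1 ⟩ ≡ 1ℚ
  ⟨1⟩ = cast≡ (+ 1)

  cast-+ : ∀ a b → cast (a ℤ.+ b) ≡ cast a + cast b
  cast-+ a b = toℚᵘ-injective (ℚᵘₚ.≃-trans (toℚᵘ-cast (a ℤ.+ b))
    (ℚᵘₚ.≃-sym (ℚᵘₚ.≃-trans (toℚᵘ-homo-+ (cast a) (cast b))
      (ℚᵘₚ.≃-trans (ℚᵘₚ.+-cong (toℚᵘ-cast a) (toℚᵘ-cast b))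
        (ℚᵘ.*≡* (cong (ℤ._* + 1) (cong₂ ℤ._+_ (ℤₚ.*-identityʳ a) (ℤₚ.*-identityʳ b))))))))

  cast-* : ∀ a b → cast (a ℤ.* b) ≡ cast a * cast b
  cast-* a b = toℚᵘ-injective (ℚᵘₚ.≃-trans (toℚᵘ-cast (a ℤ.* b))
    (ℚᵘₚ.≃-sym (ℚᵘₚ.≃-trans (toℚᵘ-homo-* (cast a) (cast b))
      (ℚᵘₚ.*-cong (toℚᵘ-cast a) (toℚᵘ-cast b)))))

  cast-injective : ∀ {a b} → cast a ≡ cast b → a ≡ b
  cast-injective {a} {b} eq with ℚᵘₚ.≃-trans (ℚᵘₚ.≃-sym (toℚᵘ-cast a))
                        (ℚᵘₚ.≃-trans (toℚᵘ-cong eq) (toℚᵘ-cast b))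
  ... | ℚᵘ.*≡* e = trans (sym (ℤₚ.*-identityʳ a)) (trans e (ℤₚ.*-identityʳ b))

  cast-mono-≤ : ∀ {a b} → a ℤ.≤ b → cast a ≤ cast b
  cast-mono-≤ {a} {b} a≤b = toℚᵘ-cancel-≤ (ℚᵘₚ.≤-trans (ℚᵘₚ.≤-reflexive (toℚᵘ-cast a))
    (ℚᵘₚ.≤-trans (ℚᵘ.*≤* (ℤₚ.*-monoʳ-≤-nonNeg (+ 1) a≤b)) (ℚᵘₚ.≤-reflexive (ℚᵘₚ.≃-sym (toℚᵘ-cast b)))))

  cast-neg : ∀ a → cast (ℤ.- a) ≡ - cast a
  cast-neg a = toℚᵘ-injective (ℚᵘₚ.≃-trans (toℚᵘ-cast (ℤ.- a))
    (ℚᵘₚ.≃-sym (ℚᵘₚ.≃-trans (toℚᵘ-homo‿- (cast a)) (ℚᵘₚ.-‿cong (toℚᵘ-cast a)))))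

  ⟨⟩-mono : ∀ {m n} → m ℕ.≤ n → ⟨ m ⟩ ≤ ⟨ n ⟩
  ⟨⟩-mono m≤n = cast-mono-≤ (ℤ.+≤+ m≤n)

  ⟨⟩-+ : ∀ m n → ⟨ m ℕ.+ n ⟩ ≡ ⟨ m ⟩ + ⟨ n ⟩
  ⟨⟩-+ m n = cast-+ (+ m) (+ n)

  ⟨⟩-* : ∀ m n → ⟨ m ℕ.* n ⟩ ≡ ⟨ m ⟩ * ⟨ n ⟩
  ⟨⟩-* m n = trans (cong cast (ℤₚ.pos-* m n)) (cast-* (+ m) (+ n))

  0≤⟨⟩ : ∀ n → 0ℚ ≤ ⟨ n ⟩
  0≤⟨⟩ n = subst (_≤ ⟨ n ⟩) ⟨0⟩ (⟨⟩-mono {0} {n} ℕ.z≤n)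

  ∣cast∣ : ∀ a → ∣ cast a ∣ ≡ ⟨ ℤ.∣ a ∣ ⟩
  ∣cast∣ (+ n)    = 0≤p⇒∣p∣≡p (0≤⟨⟩ n)
  ∣cast∣ -[1+ n ] = trans (cong ∣_∣ (cast-neg (+ suc n)))
    (trans (∣-p∣≡∣p∣ ⟨ suc n ⟩) (0≤p⇒∣p∣≡p (0≤⟨⟩ (suc n))))

  0≤1 : 0ℚ ≤ 1ℚ
  0≤1 = nonNegative⁻¹ 1ℚ

  0<1 : 0ℚ < 1ℚ
  0<1 = positive⁻¹ 1ℚ

  0<½ : 0ℚ < ½
  0<½ = positive⁻¹ ½

  *-mono₀ : ∀ {a b c d} → 0ℚ ≤ a → a ≤ b → 0ℚ ≤ c → c ≤ d → a * c ≤ b * d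
  *-mono₀ {a} {b} {c} {d} 0≤a a≤b 0≤c c≤d = ≤-trans
    (*-monoʳ-≤-nonNeg c {{nonNegative 0≤c}} a≤b)
    (*-monoˡ-≤-nonNeg b {{nonNegative (≤-trans 0≤a a≤b)}} c≤d)

  *-monoˡ₀ : ∀ {c} → 0ℚ ≤ c → ∀ {a b} → a ≤ b → c * a ≤ c * b
  *-monoˡ₀ {c} 0≤c = *-monoˡ-≤-nonNeg c {{nonNegative 0≤c}}

  *-monoʳ₀ : ∀ {c} → 0ℚ ≤ c → ∀ {a b} → a ≤ b → a * c ≤ b * c
  *-monoʳ₀ {c} 0≤c = *-monoʳ-≤-nonNeg c {{nonNegative 0≤c}}

  0≤* : ∀ {a b} → 0ℚ ≤ a → 0ℚ ≤ b → 0ℚ ≤ a * b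
  0≤* {a} {b} 0≤a 0≤b = subst (_≤ a * b) (*-zeroʳ a) (*-monoˡ₀ 0≤a 0≤b)

  0<* : ∀ {a b} → 0ℚ < a → 0ℚ < b → 0ℚ < a * b
  0<* {a} {b} 0<a 0<b = subst (_< a * b) (*-zeroʳ a) (*-monoʳ-<-pos a {{positive 0<a}} 0<b)

  0≤+ : ∀ {a b} → 0ℚ ≤ a → 0ℚ ≤ b → 0ℚ ≤ a + b
  0≤+ {a} {b} 0≤a 0≤b = subst (_≤ a + b) (+-identityʳ 0ℚ) (+-mono-≤ 0≤a 0≤b)

  ≤-by : ∀ {a b} r → 0ℚ ≤ r → b ≡ a + r → a ≤ b
  ≤-by {a} {b} r 0≤r b≡ = subst₂ _≤_ (+-identityʳ a) (sym b≡) (+-monoʳ-≤ a 0≤r)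

  p≤p+q : ∀ p {q} → 0ℚ ≤ q → p ≤ p + q
  p≤p+q p {q} 0≤q = ≤-by {p} {p + q} q 0≤q refl

  *-cancelˡ₀ : ∀ {c a b} → 0ℚ < c → c * a ≤ c * b → a ≤ b
  *-cancelˡ₀ {c} 0<c = *-cancelˡ-≤-pos c {{positive 0<c}}

  *-cancelʳ₀ : ∀ {c a b} → 0ℚ < c → a * c ≤ b * c → a ≤ b
  *-cancelʳ₀ {c} 0<c = *-cancelʳ-≤-pos c {{positive 0<c}}

  p≤∣p∣ : ∀ p → p ≤ ∣ p ∣
  p≤∣p∣ p with ≤-total 0ℚ p
  ... | inj₁ 0≤p = ≤-reflexive (sym (0≤p⇒∣p∣≡p 0≤p))
  ... | inj₂ p≤0 = ≤-trans p≤0 (0≤∣p∣ p)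

  ∣p∣²≡p² : ∀ p → ∣ p ∣ * ∣ p ∣ ≡ p * p
  ∣p∣²≡p² p with ∣p∣≡p∨∣p∣≡-p p
  ... | inj₁ eq = cong₂ _*_ eq eq
  ... | inj₂ eq = trans (cong₂ _*_ eq eq) (solve 1 (λ p → (:- p) :* (:- p) := p :* p) refl p)

  0≤p² : ∀ p → 0ℚ ≤ p * p
  0≤p² p = subst (0ℚ ≤_) (∣p∣²≡p² p) (0≤* (0≤∣p∣ p) (0≤∣p∣ p))

  square-cancel : ∀ {a b} → 0ℚ ≤ b → a * a ≤ b * b → a ≤ b
  square-cancel {a} {b} 0≤b a²≤b² with a ≤? b
  ... | yes a≤b = a≤b
  ... | no  a≰b = contradiction
    (<-≤-trans (*-monoʳ-<-pos a {{positive 0<a}} b<a) (≤-trans a²≤b² (*-monoʳ₀ 0≤b (<⇒≤ b<a))))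
    (<-irrefl refl)
    where
    b<a : b < a
    b<a = ≰⇒> a≰b
    0<a : 0ℚ < a
    0<a = ≤-<-trans 0≤b b<a

  infixr 8 _↑_
  _↑_ : ℚ → ℕ → ℚ
  x ↑ zero  = 1ℚ
  x ↑ suc n = x * x ↑ n

  ⟨⟩-^ : ∀ m n → ⟨ m ℕ.^ n ⟩ ≡ ⟨ m ⟩ ↑ n
  ⟨⟩-^ m zero    = ⟨1⟩
  ⟨⟩-^ m (suc n) = trans (⟨⟩-* m (m ℕ.^ n)) (cong (⟨ m ⟩ *_) (⟨⟩-^ m n))

  0≤↑ : ∀ {x} → 0ℚ ≤ x → ∀ n → 0ℚ ≤ x ↑ n
  0≤↑ 0≤x zero    = 0≤1
  0≤↑ 0≤x (suc n) = 0≤* 0≤x (0≤↑ 0≤x n)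

  0<↑ : ∀ {x} → 0ℚ < x → ∀ n → 0ℚ < x ↑ n
  0<↑ 0<x zero    = 0<1
  0<↑ 0<x (suc n) = 0<* 0<x (0<↑ 0<x n)

  1≤↑ : ∀ {x} → 1ℚ ≤ x → ∀ n → 1ℚ ≤ x ↑ n
  1≤↑ 1≤x zero    = ≤-refl
  1≤↑ {x} 1≤x (suc n) = subst (_≤ x * x ↑ n) (*-identityˡ 1ℚ)
    (*-mono₀ 0≤1 1≤x 0≤1 (1≤↑ 1≤x n))

  ↑-+ : ∀ x m n → x ↑ (m ℕ.+ n) ≡ x ↑ m * x ↑ n
  ↑-+ x zero    n = sym (*-identityˡ _)
  ↑-+ x (suc m) n = trans (cong (x *_) (↑-+ x m n)) (sym (*-assoc x _ _))

  ↑-* : ∀ x y n → (x * y) ↑ n ≡ x ↑ n * y ↑ n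
  ↑-* x y zero    = sym (*-identityˡ 1ℚ)
  ↑-* x y (suc n) = trans (cong ((x * y) *_) (↑-* x y n))
    (solve 4 (λ x y p q → (x :* y) :* (p :* q) := (x :* p) :* (y :* q)) refl x y (x ↑ n) (y ↑ n))

  1↑ : ∀ n → 1ℚ ↑ n ≡ 1ℚ
  1↑ zero    = refl
  1↑ (suc n) = trans (*-identityˡ _) (1↑ n)

-- The field of Gaussian rationals with a rational norm.

module Gaussian where

  open Rationals
  open import Data.Rational.Base
  open import Data.Rational.Properties
  open import Data.Rational.Solver using (module +-*-Solver)

  open +-*-Solver

  infix 5 _+𝕚_

  data K : Set where
    _+𝕚_ : ℚ → ℚ → K

  infixl 6 _⊕_
  infixl 7 _⊗_
  infix 8 ⊖_
  real : ℚ → K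
  real q = q +𝕚 0ℚ

  0ᴷ 1ᴷ : K
  0ᴷ = real 0ℚ
  1ᴷ = real 1ℚ

  abstract

    _⊕_ _⊗_ : K → K → K
    (a +𝕚 b) ⊕ (c +𝕚 d) = a + c +𝕚 b + d
    (a +𝕚 b) ⊗ (c +𝕚 d) = a * c - b * d +𝕚 a * d + b * c

    ⊖_ : K → K
    ⊖ (a +𝕚 b) = - a +𝕚 - b

    ⊕≡ : ∀ a b c d → (a +𝕚 b) ⊕ (c +𝕚 d) ≡ a + c +𝕚 b + d
    ⊕≡ a b c d = refl

    ⊗≡ : ∀ a b c d → (a +𝕚 b) ⊗ (c +𝕚 d) ≡ a * c - b * d +𝕚 a * d + b * c
    ⊗≡ a b c d = refl

    ⊖≡ : ∀ a b c d → (a +𝕚 b) ⊕ (⊖ (c +𝕚 d)) ≡ a - c +𝕚 b - d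
    ⊖≡ a b c d = refl

    real-+ : ∀ a b → real (a + b) ≡ real a ⊕ real b
    real-+ a b = refl

    real-* : ∀ a b → real (a * b) ≡ real a ⊗ real b
    real-* a b = cong₂ _+𝕚_
      (solve 2 (λ a b → a :* b := a :* b :- con 0ℚ :* con 0ℚ) refl a b)
      (solve 2 (λ a b → con 0ℚ := a :* con 0ℚ :+ con 0ℚ :* b) refl a b)

    isCommutativeRingᴷ : IsCommutativeRing _≡_ _⊕_ _⊗_ ⊖_ 0ᴷ 1ᴷ
    isCommutativeRingᴷ = record
      { isRing = record
        { +-isAbelianGroup = record
          { isGroup = record
            { isMonoid = record
              { isSemigroup = record
                { isMagma = record { isEquivalence = isEquivalence ; ∙-cong = cong₂ _⊕_ }
                ; assoc   = λ { (a +𝕚 b) (c +𝕚 d) (e +𝕚 f) → cong₂ _+𝕚_ (+-assoc a c e) (+-assoc b d f) }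
                }
              ; identity = (λ { (a +𝕚 b) → cong₂ _+𝕚_ (+-identityˡ a) (+-identityˡ b) })
                         , (λ { (a +𝕚 b) → cong₂ _+𝕚_ (+-identityʳ a) (+-identityʳ b) })
              }
            ; inverse = (λ { (a +𝕚 b) → cong₂ _+𝕚_ (+-inverseˡ a) (+-inverseˡ b) })
                      , (λ { (a +𝕚 b) → cong₂ _+𝕚_ (+-inverseʳ a) (+-inverseʳ b) })
            ; ⁻¹-cong = cong ⊖_
            }
          ; comm = λ { (a +𝕚 b) (c +𝕚 d) → cong₂ _+𝕚_ (+-comm a c) (+-comm b d) }
          }
        ; *-cong     = cong₂ _⊗_
        ; *-assoc    = λ { (a +𝕚 b) (c +𝕚 d) (e +𝕚 f) → cong₂ _+𝕚_
            (solve 6 (λ a b c d e f → (a :* c :- b :* d) :* e :- (a :* d :+ b :* c) :* f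
               := a :* (c :* e :- d :* f) :- b :* (c :* f :+ d :* e)) refl a b c d e f)
            (solve 6 (λ a b c d e f → (a :* c :- b :* d) :* f :+ (a :* d :+ b :* c) :* e
               := a :* (c :* f :+ d :* e) :+ b :* (c :* e :- d :* f)) refl a b c d e f) }
        ; *-identity = (λ { (a +𝕚 b) → cong₂ _+𝕚_
              (solve 2 (λ a b → con 1ℚ :* a :- con 0ℚ :* b := a) refl a b)
              (solve 2 (λ a b → con 1ℚ :* b :+ con 0ℚ :* a := b) refl a b) })
          , (λ { (a +𝕚 b) → cong₂ _+𝕚_
              (solve 2 (λ a b → a :* con 1ℚ :- b :* con 0ℚ := a) refl a b)
              (solve 2 (λ a b → a :* con 0ℚ :+ b :* con 1ℚ := b) refl a b) })
        ; distrib = (λ { (a +𝕚 b) (c +𝕚 d) (e +𝕚 f) → cong₂ _+𝕚_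
              (solve 6 (λ a b c d e f → a :* (c :+ e) :- b :* (d :+ f)
                 := (a :* c :- b :* d) :+ (a :* e :- b :* f)) refl a b c d e f)
              (solve 6 (λ a b c d e f → a :* (d :+ f) :+ b :* (c :+ e)
                 := (a :* d :+ b :* c) :+ (a :* f :+ b :* e)) refl a b c d e f) })
          , (λ { (a +𝕚 b) (c +𝕚 d) (e +𝕚 f) → cong₂ _+𝕚_
              (solve 6 (λ a b c d e f → (c :+ e) :* a :- (d :+ f) :* b
                 := (c :* a :- d :* b) :+ (e :* a :- f :* b)) refl a b c d e f)
              (solve 6 (λ a b c d e f → (c :+ e) :* b :+ (d :+ f) :* a
                 := (c :* b :+ d :* a) :+ (e :* b :+ f :* a)) refl a b c d e f) })
        }
      ; *-comm = λ { (a +𝕚 b) (c +𝕚 d) → cong₂ _+𝕚_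
          (solve 4 (λ a b c d → a :* c :- b :* d := c :* a :- d :* b) refl a b c d)
          (solve 4 (λ a b c d → a :* d :+ b :* c := c :* b :+ d :* a) refl a b c d) }
      }

    -- The sum norm stays in ℚ, where order is decidable, and is submultiplicative. It exceeds the
    -- modulus by a factor of at most √2, so lower bounds for products cost a constant only.
    ‖_‖ : K → ℚ
    ‖ a +𝕚 b ‖ = ∣ a ∣ + ∣ b ∣

    ∣_∣² : K → ℚ
    ∣ a +𝕚 b ∣² = a * a + b * b

    0≤‖‖ : ∀ x → 0ℚ ≤ ‖ x ‖
    0≤‖‖ (a +𝕚 b) = 0≤+ (0≤∣p∣ a) (0≤∣p∣ b)

    ‖⊕‖ : ∀ x y → ‖ x ⊕ y ‖ ≤ ‖ x ‖ + ‖ y ‖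
    ‖⊕‖ (a +𝕚 b) (c +𝕚 d) = ≤-trans (+-mono-≤ (∣p+q∣≤∣p∣+∣q∣ a c) (∣p+q∣≤∣p∣+∣q∣ b d))
      (≤-reflexive (solve 4 (λ a b c d → (a :+ c) :+ (b :+ d) := (a :+ b) :+ (c :+ d))
        refl (∣ a ∣) (∣ b ∣) (∣ c ∣) (∣ d ∣)))

    ‖x⊕x‖ : ∀ x → ‖ x ⊕ x ‖ ≡ ‖ x ‖ + ‖ x ‖
    ‖x⊕x‖ (a +𝕚 b) = trans (cong₂ _+_ (double a) (double b))
      (solve 2 (λ a b → (a :+ a) :+ (b :+ b) := (a :+ b) :+ (a :+ b)) refl (∣ a ∣) (∣ b ∣))
      where
      double : ∀ p → ∣ p + p ∣ ≡ ∣ p ∣ + ∣ p ∣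
      double p = trans (cong ∣_∣ (solve 1 (λ p → p :+ p := (con 1ℚ :+ con 1ℚ) :* p) refl p))
        (trans (∣p*q∣≡∣p∣*∣q∣ (1ℚ + 1ℚ) p)
          (solve 1 (λ p → (con 1ℚ :+ con 1ℚ) :* p := p :+ p) refl (∣ p ∣)))

    real-neg : ∀ a → real (- a) ≡ ⊖ real a
    real-neg a = refl

    ‖⊖‖ : ∀ x → ‖ ⊖ x ‖ ≡ ‖ x ‖
    ‖⊖‖ (a +𝕚 b) = cong₂ _+_ (∣-p∣≡∣p∣ a) (∣-p∣≡∣p∣ b)

    ‖real‖ : ∀ q → ‖ real q ‖ ≡ ∣ q ∣
    ‖real‖ q = +-identityʳ ∣ q ∣

    ‖⊗‖ : ∀ x y → ‖ x ⊗ y ‖ ≤ ‖ x ‖ * ‖ y ‖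
    ‖⊗‖ (a +𝕚 b) (c +𝕚 d) = ≤-trans
      (+-mono-≤ (∣p-q∣≤∣p∣+∣q∣ (a * c) (b * d)) (∣p+q∣≤∣p∣+∣q∣ (a * d) (b * c)))
      (≤-reflexive (trans
        (cong₂ _+_ (cong₂ _+_ (∣p*q∣≡∣p∣*∣q∣ a c) (∣p*q∣≡∣p∣*∣q∣ b d))
                   (cong₂ _+_ (∣p*q∣≡∣p∣*∣q∣ a d) (∣p*q∣≡∣p∣*∣q∣ b c)))
        (solve 4 (λ a b c d → (a :* c :+ b :* d) :+ (a :* d :+ b :* c) := (a :+ b) :* (c :+ d))
          refl (∣ a ∣) (∣ b ∣) (∣ c ∣) (∣ d ∣))))

    ∣⊗∣² : ∀ x y → ∣ x ⊗ y ∣² ≡ ∣ x ∣² * ∣ y ∣²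
    ∣⊗∣² (a +𝕚 b) (c +𝕚 d) = solve 4 (λ a b c d →
      (a :* c :- b :* d) :* (a :* c :- b :* d) :+ (a :* d :+ b :* c) :* (a :* d :+ b :* c)
      := (a :* a :+ b :* b) :* (c :* c :+ d :* d)) refl a b c d

    ‖‖≡ : ∀ a b → ‖ a +𝕚 b ‖ ≡ ∣ a ∣ + ∣ b ∣
    ‖‖≡ a b = refl

    ∣∣²≡ : ∀ a b → ∣ a +𝕚 b ∣² ≡ a * a + b * b
    ∣∣²≡ a b = refl

    ∣∣²≤‖‖² : ∀ x → ∣ x ∣² ≤ ‖ x ‖ * ‖ x ‖
    ∣∣²≤‖‖² (a +𝕚 b) = ≤-by (∣ a ∣ * ∣ b ∣ + ∣ a ∣ * ∣ b ∣)
      (0≤+ (0≤* (0≤∣p∣ a) (0≤∣p∣ b)) (0≤* (0≤∣p∣ a) (0≤∣p∣ b)))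
      (trans (solve 2 (λ a b → (a :+ b) :* (a :+ b) := (a :* a :+ b :* b) :+ (a :* b :+ a :* b))
          refl (∣ a ∣) (∣ b ∣))
        (cong (_+ (∣ a ∣ * ∣ b ∣ + ∣ a ∣ * ∣ b ∣)) (cong₂ _+_ (∣p∣²≡p² a) (∣p∣²≡p² b))))

    ‖‖²≤2∣∣² : ∀ x → ‖ x ‖ * ‖ x ‖ ≤ ∣ x ∣² + ∣ x ∣²
    ‖‖²≤2∣∣² (a +𝕚 b) = ≤-by ((∣ a ∣ - ∣ b ∣) * (∣ a ∣ - ∣ b ∣)) (0≤p² (∣ a ∣ - ∣ b ∣))
      (trans (cong₂ _+_ eq eq)
        (solve 2 (λ a b → (a :* a :+ b :* b) :+ (a :* a :+ b :* b)
           := (a :+ b) :* (a :+ b) :+ (a :- b) :* (a :- b)) refl (∣ a ∣) (∣ b ∣)))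
      where
      eq : a * a + b * b ≡ ∣ a ∣ * ∣ a ∣ + ∣ b ∣ * ∣ b ∣
      eq = sym (cong₂ _+_ (∣p∣²≡p² a) (∣p∣²≡p² b))

  -- The squared modulus is multiplicative and lies between ‖z‖²/2 and ‖z‖². Comparing squares loses
  -- a factor 4, hence the 2 here.
  ‖⊗‖-lower : ∀ x y → ‖ x ‖ * ‖ y ‖ ≤ ‖ x ⊗ y ‖ + ‖ x ⊗ y ‖
  ‖⊗‖-lower x y = square-cancel (0≤+ (0≤‖‖ (x ⊗ y)) (0≤‖‖ (x ⊗ y))) (begin
    (X * Y) * (X * Y) ≡⟨ solve 2 (λ X Y → (X :* Y) :* (X :* Y) := (X :* X) :* (Y :* Y)) refl X Y ⟩
    (X * X) * (Y * Y) ≤⟨ *-mono₀ (0≤p² X) (‖‖²≤2∣∣² x) (0≤p² Y) (‖‖²≤2∣∣² y) ⟩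
    (M + M) * (N + N)
      ≡⟨ solve 2 (λ M N → (M :+ M) :* (N :+ N) := M :* N :+ M :* N :+ (M :* N :+ M :* N)) refl M N ⟩
    M * N + M * N + (M * N + M * N) ≡⟨ cong (λ z → z + z + (z + z)) (sym (∣⊗∣² x y)) ⟩
    Q + Q + (Q + Q) ≤⟨ +-mono-≤ (+-mono-≤ le le) (+-mono-≤ le le) ⟩
    Z * Z + Z * Z + (Z * Z + Z * Z)
      ≡⟨ solve 1 (λ Z → Z :* Z :+ Z :* Z :+ (Z :* Z :+ Z :* Z) := (Z :+ Z) :* (Z :+ Z)) refl Z ⟩
    (Z + Z) * (Z + Z) ∎)
    where
    open ≤-Reasoning
    X = ‖ x ‖ ; Y = ‖ y ‖ ; Z = ‖ x ⊗ y ‖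
    M = ∣ x ∣² ; N = ∣ y ∣² ; Q = ∣ x ⊗ y ∣²
    le : Q ≤ Z * Z
    le = ∣∣²≤‖‖² (x ⊗ y)

-- Gauss's lemma and division of integer polynomials.

module IntPoly where

  open import Data.Integer.Base using (∣_∣; _+_; _*_; -_; _-_)
  open import Data.Integer.Divisibility.Signed using (divides; ∣ᵤ⇒∣; ∣⇒∣ᵤ; ∣m+n∣m⇒∣n; ∣m⇒∣m*n)
    renaming (_∣_ to _∣ℤ_)
  open import Data.Integer.Solver using (module +-*-Solver)
  open import Data.Nat.ListAction using (product)
  open import Data.List.Relation.Unary.All using (All; []; _∷_)
  open import Data.Nat.Primality using (Prime; euclidsLemma; ¬prime[0])
  open import Data.Nat.Primality.Factorisation using (factorise; module PrimeFactorisation)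

  open PolyTheory ℤₚ.+-*-isCommutativeRing public
  open ℤ[x]

  coeff≤height : ∀ p i → ∣ coeff p i ∣ ℕ.≤ height p
  coeff≤height []      i       = z≤n
  coeff≤height (a ∷ p) zero    = ℕₚ.m≤m⊔n _ _
  coeff≤height (a ∷ p) (suc i) = ℕₚ.≤-trans (coeff≤height p i) (ℕₚ.m≤n⊔m ∣ a ∣ _)

  height≤ : ∀ p {B} → (∀ i → ∣ coeff p i ∣ ℕ.≤ B) → height p ℕ.≤ B
  height≤ []      p≤B = z≤n
  height≤ (a ∷ p) p≤B = ℕₚ.⊔-lub (p≤B 0) (height≤ p (λ i → p≤B (suc i)))

  1≤∣_∣ : ∀ {a} → a ≢ + 0 → 1 ℕ.≤ ∣ a ∣
  1≤∣_∣ {+ zero}   a≢0 = contradiction refl a≢0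
  1≤∣_∣ {+ suc n}  a≢0 = s≤s z≤n
  1≤∣_∣ { -[1+ n ]} a≢0 = s≤s z≤n

  1≤height : ∀ {k} p → Degree k p → 1 ℕ.≤ height p
  1≤height {k} p deg = ℕₚ.≤-trans (1≤∣_∣ (top deg)) (coeff≤height p k)

  *-nonzero : ∀ {a b} → a ≢ + 0 → b ≢ + 0 → a * b ≢ + 0
  *-nonzero {a} a≢0 b≢0 ab≡0 with ℤₚ.i*j≡0⇒i≡0∨j≡0 a ab≡0
  ... | inj₁ a≡0 = a≢0 a≡0
  ... | inj₂ b≡0 = b≢0 b≡0

  DividesAll : ℕ → Poly → Set
  DividesAll π p = ∀ i → + π ∣ℤ coeff p i

  ∣0 : ∀ π → π ∣ℤ + 0
  ∣0 π = divides (+ 0) refl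

  euclid : ∀ {π} a b → Prime π → + π ∣ℤ a * b → + π ∣ℤ a ⊎ + π ∣ℤ b
  euclid {π} a b isPrime d = Sum.map ∣ᵤ⇒∣ ∣ᵤ⇒∣
    (euclidsLemma ∣ a ∣ ∣ b ∣ isPrime (subst (π ℕ∣_) (ℤₚ.abs-* a b) (∣⇒∣ᵤ d)))
    where open import Data.Nat.Divisibility using () renaming (_∣_ to _ℕ∣_)

  -- Gauss's lemma by induction on both lists. By Euclid's lemma π divides one of the two constant
  -- coefficients; the products with that coefficient can be subtracted, so π still divides the
  -- product in which it is dropped.
  prime-divides-product : ∀ {π} → Prime π → ∀ h q →
    DividesAll π (h *ₚ q) → DividesAll π h ⊎ DividesAll π q
  prime-divides-product {π} isPrime []      q       D = inj₁ (λ i → ∣0 (+ π))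
  prime-divides-product {π} isPrime (a ∷ h) []      D = inj₂ (λ i → ∣0 (+ π))
  prime-divides-product {π} isPrime p@(a ∷ h) q@(b ∷ q′) D = Sum.[
      (λ π∣a → Sum.map₁ (λ π∣h → λ { zero → π∣a ; (suc i) → π∣h i })
        (prime-divides-product isPrime h q λ i → ∣m+n∣m⇒∣n
          (subst (+ π ∣ℤ_) (coeff-∷*-suc a h q i) (D (suc i)))
          (∣m⇒∣m*n (coeff q (suc i)) π∣a)))
    , (λ π∣b → Sum.map₂ (λ π∣q′ → λ { zero → π∣b ; (suc i) → π∣q′ i })
        (prime-divides-product isPrime p q′ λ i → ∣m+n∣m⇒∣n
          (subst (+ π ∣ℤ_) (coeff-*∷-suc p b q′ i) (D (suc i)))
          (∣m⇒∣m*n (coeff p (suc i)) π∣b)))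
    ]′ (euclid a b isPrime (subst (+ π ∣ℤ_) (coeff-∷*-zero a h q) (D 0)))

  divideAll : ∀ π p → DividesAll π p → ∃[ p′ ] length p′ ≡ length p × p ≡ map (+ π *_) p′
  divideAll π []      D = [] , refl , refl
  divideAll π (a ∷ p) D with D 0 | divideAll π p (λ i → D (suc i))
  ... | divides b a≡ | p′ , len≡ , p≡ =
    b ∷ p′ , cong suc len≡ , cong₂ _∷_ (trans a≡ (ℤₚ.*-comm b (+ π))) p≡

  -- The factor q is only changed by a scalar, so that its zeros are kept.
  Reduct : Poly → Poly → Set
  Reduct P q = ∃[ s ] ∃[ h ] ∃[ q′ ] s ≢ + 0 × length q′ ≡ length q ×
    (∀ i → coeff q i ≡ s * coeff q′ i) × P ≈ₚ h *ₚ q′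

  private
    cancel-prime : ∀ π n x y → + suc π * y ≡ + (suc π ℕ.* n) * x → + n * x ≡ y
    cancel-prime π n x y eq = ℤₚ.*-cancelˡ-≡ (+ suc π) (+ n * x) y
      (trans (trans (sym (ℤₚ.*-assoc (+ suc π) (+ n) x))
        (cong (_* x) (sym (ℤₚ.pos-* (suc π) n)))) (sym eq))

    prime≢0 : ∀ {π} → Prime π → ∃[ n ] π ≡ suc n
    prime≢0 {suc π} _ = π , refl
    prime≢0 {zero}  π-prime = contradiction π-prime ¬prime[0]

  -- The scalar is removed one prime at a time: by Gauss's lemma each prime divides `h` or `q`, and
  -- it is cancelled there. The primes taken out of `q` accumulate in the scalar of `Reduct`.
  reduce-product : ∀ πs → All Prime πs → ∀ P h q →
    (∀ i → + product πs * coeff P i ≡ coeff (h *ₚ q) i) → Reduct P q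
  reduce-product [] [] P h q eq = + 1 , h , q , (λ ()) , refl ,
    (λ i → sym (ℤₚ.*-identityˡ _)) , λ i → trans (sym (ℤₚ.*-identityˡ _)) (eq i)
  reduce-product (π ∷ πs) (π-prime ∷ πs-prime) P h q eq
    with prime≢0 π-prime
  ... | n , refl
    with prime-divides-product π-prime h q
      (λ i → divides (+ product πs * coeff P i)
        (trans (sym (eq i)) (trans (cong (_* coeff P i) (ℤₚ.pos-* π (product πs)))
          (rearrange (+ π) (+ product πs) (coeff P i)))))
    where
    open +-*-Solver
    rearrange : ∀ a b c → a * b * c ≡ b * c * a
    rearrange = solve 3 (λ a b c → a :* b :* c := b :* c :* a) refl
  ... | inj₁ π∣h with divideAll π h π∣h
  ...   | h′ , _ , refl = reduce-product πs πs-prime P h′ q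
    (λ i → cancel-prime n (product πs) (coeff P i) _
      (trans (sym (*ₚ-scaleˡ (+ π) h′ q i)) (sym (eq i))))
  reduce-product (π ∷ πs) (π-prime ∷ πs-prime) P h q eq
      | n , refl | inj₂ π∣q with divideAll π q π∣q
  ... | q′ , len≡ , refl with reduce-product πs πs-prime P h q′
    (λ i → cancel-prime n (product πs) (coeff P i) _
      (trans (sym (*ₚ-scaleʳ (+ π) h q′ i)) (sym (eq i))))
  ...   | s , h″ , q″ , s≢0 , len≡′ , q≡ , P≈ =
    + π * s , h″ , q″ , *-nonzero {+ π} {s} (λ ()) s≢0 , trans len≡′ len≡ ,
    (λ i → trans (coeff-map (+ π) q′ i)
      (trans (cong (+ π *_) (q≡ i)) (sym (ℤₚ.*-assoc (+ π) s _)))) , P≈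

  reduce-scalar : ∀ c → c ≢ + 0 → ∀ P h q →
    (∀ i → c * coeff P i ≡ coeff (h *ₚ q) i) → Reduct P q
  reduce-scalar (+ zero) c≢0 P h q eq = contradiction refl c≢0
  reduce-scalar (+ suc n) c≢0 P h q eq = reduce-product factors factorsPrime P h q
    (λ i → trans (cong (λ c → + c * coeff P i) (sym isFactorisation)) (eq i))
    where open PrimeFactorisation (factorise (suc n))
  reduce-scalar -[1+ n ] c≢0 P h q eq = reduce-scalar (+ suc n) (λ ()) P (map (- (+ 1) *_) h) q
    (λ i → trans (trans (sym (ℤₚ.neg-distribˡ-* -[1+ n ] (coeff P i)))
       (trans (cong -_ (eq i)) (sym (ℤₚ.-1*i≡-i _)))) (sym (*ₚ-scaleˡ (- (+ 1)) h q i)))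

  -- Division without fractions, by Horner's scheme on the dividend: prepending a coefficient makes
  -- the remainder one entry too long. Multiplying by the leading coefficient a of `q` and
  -- subtracting t q, with t the excess coefficient, shortens it again; the scalar c becomes a c.
  pseudoDivision : ∀ {k} q → Degree k q → ∀ p → ∃[ c ] ∃[ h ] ∃[ r ]
    c ≢ + 0 × length r ≡ k × (∀ i → c * coeff p i ≡ coeff (h *ₚ q) i + coeff r i)
  pseudoDivision {k} q deg [] = + 1 , [] , truncate k [] , (λ ()) , length-truncate k [] ,
    λ i → sym (trans (ℤₚ.+-identityˡ _) (truncate-≈ k [] (λ _ _ → refl) i))
  pseudoDivision {k} q deg (b ∷ p) with pseudoDivision q deg p
  ... | c , h , r , c≢0 , len≡ , eq =
    a * c , t ∷ map (a *_) h , truncate k rest , *-nonzero (top deg) c≢0 , length-truncate k rest ,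
    λ { zero → trans (split₀ a c b t (coeff q 0))
          (cong₂ _+_ (sym (coeff-∷*-zero t (map (a *_) h) q))
            (sym (trans (truncate-≈ k rest rest< 0) (coeff-rest 0))))
      ; (suc i) → trans (trans (ℤₚ.*-assoc a c _) (cong (a *_) (eq i)))
          (trans (split₊ a (coeff (h *ₚ q) i) (coeff r i) t (coeff q (suc i)))
          (cong₂ _+_
            (trans (cong (_+_ (t * coeff q (suc i))) (sym (*ₚ-scaleˡ a h q i)))
              (sym (coeff-∷*-suc t (map (a *_) h) q i)))
            (sym (trans (truncate-≈ k rest rest< (suc i)) (coeff-rest (suc i)))))) }
    where
    open +-*-Solver
    a t : ℤ
    s rest : Poly
    a = coeff q k
    s = c * b ∷ r
    t = coeff s k
    rest = map (a *_) s +ₚ map ((- t) *_) q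

    split₀ : ∀ a c b t x → a * c * b ≡ t * x + (a * (c * b) + (- t) * x)
    split₀ = solve 5 (λ a c b t x → a :* c :* b := t :* x :+ (a :* (c :* b) :+ (:- t) :* x)) refl

    split₊ : ∀ a x y t z → a * (x + y) ≡ (t * z + a * x) + (a * y + (- t) * z)
    split₊ = solve 5 (λ a x y t z →
      a :* (x :+ y) := (t :* z :+ a :* x) :+ (a :* y :+ (:- t) :* z)) refl

    coeff-rest : ∀ i → coeff rest i ≡ a * coeff s i + (- t) * coeff q i
    coeff-rest i = trans (coeff-+ (map (a *_) s) (map ((- t) *_) q) i)
      (cong₂ _+_ (coeff-map a s i) (coeff-map (- t) q i))

    cancel-top : ∀ a t → a * t + (- t) * a ≡ + 0
    cancel-top = solve 2 (λ a t → a :* t :+ (:- t) :* a := con (+ 0)) refl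

    rest< : Below rest k
    rest< i k≤i with ℕₚ.m≤n⇒m<n∨m≡n k≤i
    ... | inj₂ refl = trans (coeff-rest k) (cancel-top a t)
    ... | inj₁ k<i  = trans (coeff-rest i) (cong₂ _+_
      (trans (cong (a *_) (coeff-length s (subst (ℕ._≤ i) (sym (cong suc len≡)) k<i))) (ℤₚ.*-zeroʳ a))
      (trans (cong ((- t) *_) (below deg i k<i)) (ℤₚ.*-zeroʳ (- t))))

-- Heights of factors, by interpolation at small integers.

module Gelfond where

  open IntPoly
  open import Data.Integer.Base using (∣_∣; _+_; _*_; -_; _-_)
  open import Data.Integer.Solver using (module +-*-Solver)
  open import Data.List.Base using (upTo; filter)
  import Data.List.Properties as Listₚ
  open import Data.List.Relation.Unary.All as All using (All; []; _∷_)
  import Data.List.Relation.Unary.All.Properties as Allₚ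
  open import Data.List.Relation.Unary.Unique.Propositional using (Unique; []; _∷_)
  import Data.List.Relation.Unary.Unique.Propositional.Properties as Uniqueₚ
  import Data.Nat.Solver as ℕ-Solver
  open import Function.Base using (id)
  open import Level using (0ℓ)
  open import Relation.Unary using (Pred; Decidable)

  open ℤ[x]
  open Evaluation ℤₚ.+-*-isCommutativeRing ℤₚ.+-*-isCommutativeRing id refl
    (λ _ _ → refl) (λ _ _ → refl) public
    using () renaming (ev to evℤ; ev-* to evℤ-*; ev-≈ to evℤ-≈; ev-map to evℤ-map;
      quot to quotℤ; ev-quot to evℤ-quot)

  -- Synthetic division by X - x: the divided difference as a polynomial in its second argument, one
  -- entry shorter than the dividend.
  synth : ℤ → Poly → Poly
  synth x []          = []
  synth x (a ∷ [])    = []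
  synth x (a ∷ b ∷ p) = evℤ (b ∷ p) x ∷ synth x (b ∷ p)

  length-synth : ∀ x p {l} → length p ℕ.≤ suc l → length (synth x p) ℕ.≤ l
  length-synth x []          _           = z≤n
  length-synth x (a ∷ [])    _           = z≤n
  length-synth x (a ∷ b ∷ p) {suc l} (s≤s le) = s≤s (length-synth x (b ∷ p) le)

  ev-synth : ∀ x p y → evℤ (synth x p) y ≡ quotℤ p x y
  ev-synth x []          y = refl
  ev-synth x (a ∷ [])    y = sym (trans (ℤₚ.+-identityˡ _) (ℤₚ.*-zeroʳ y))
  ev-synth x (a ∷ b ∷ p) y = cong (λ e → evℤ (b ∷ p) x + y * e) (ev-synth x (b ∷ p) y)

  coeff-synth-zero : ∀ x p → evℤ p x ≡ coeff p 0 + x * coeff (synth x p) 0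
  coeff-synth-zero x []          = sym (trans (ℤₚ.+-identityˡ _) (ℤₚ.*-zeroʳ x))
  coeff-synth-zero x (a ∷ [])    = refl
  coeff-synth-zero x (a ∷ b ∷ p) = refl

  coeff-synth-suc : ∀ x p i →
    coeff (synth x p) i ≡ coeff p (suc i) + x * coeff (synth x p) (suc i)
  coeff-synth-suc x []          i       = sym (trans (ℤₚ.+-identityˡ _) (ℤₚ.*-zeroʳ x))
  coeff-synth-suc x (a ∷ [])    i       = sym (trans (ℤₚ.+-identityˡ _) (ℤₚ.*-zeroʳ x))
  coeff-synth-suc x (a ∷ b ∷ p) zero    = coeff-synth-zero x (b ∷ p)
  coeff-synth-suc x (a ∷ b ∷ p) (suc i) = coeff-synth-suc x (b ∷ p) i

  ∣m∣≤ : ∀ a b c → a ≡ b + c → ∣ b ∣ ℕ.≤ ∣ a ∣ ℕ.+ ∣ c ∣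
  ∣m∣≤ a b c refl = subst (λ z → ∣ z ∣ ℕ.≤ ∣ a ∣ ℕ.+ ∣ c ∣)
    (solve 2 (λ b c → (b :+ c) :- c := b) refl b c) (ℤₚ.∣i-j∣≤∣i∣+∣j∣ (b + c) c)
    where open +-*-Solver

  interp : ℕ → ℕ → ℕ
  interp d zero    = 0
  interp d (suc l) = 1 ℕ.+ (1 ℕ.+ d) ℕ.* (interp d l ℕ.* 2)

  -- Newton's scheme in place of Lagrange's formula, which has denominators. At the other points the
  -- quotient g = (p - p(x))/(X - x) has values at most 2B, because distinct integers differ by at
  -- least 1, and g has one coefficient fewer. Recovering `p` from g and p(x) multiplies by at most
  -- 1 + d and adds B.
  interpolation : ∀ d l p xs {B} → length p ℕ.≤ l → l ℕ.≤ length xs → Unique xs →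
    All (ℕ._≤ d) xs → All (λ x → ∣ evℤ p (+ x) ∣ ℕ.≤ B) xs →
    ∀ i → ∣ coeff p i ∣ ℕ.≤ interp d l ℕ.* B
  interpolation d zero [] xs _ _ _ _ _ i = z≤n
  interpolation d (suc l) p (x ∷ xs) {B} p≤l (s≤s l≤xs) (x∉xs ∷ unique) (x≤d ∷ xs≤d)
    (px≤B ∷ ps≤B) = bound
    where
    g : Poly
    g = synth (+ x) p

    I : ℕ
    I = interp d l

    gs≤2B : ∀ {ys} → All (x ≢_) ys → All (λ y → ∣ evℤ p (+ y) ∣ ℕ.≤ B) ys →
      All (λ y → ∣ evℤ g (+ y) ∣ ℕ.≤ 2 ℕ.* B) ys
    gs≤2B [] [] = []
    gs≤2B {y ∷ ys} (x≢y ∷ x≢ys) (py≤B ∷ pys≤B) = step ∷ gs≤2B x≢ys pys≤B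
      where
      open +-*-Solver
      u : ℤ
      u = + y - + x
      x+u≡y : + x + u ≡ + y
      x+u≡y = solve 2 (λ x y → x :+ (y :- x) := y) refl (+ x) (+ y)
      eq : evℤ p (+ y) ≡ u * evℤ g (+ y) + evℤ p (+ x)
      eq = trans (subst (λ z → evℤ p z ≡ evℤ p (+ x) + u * quotℤ p (+ x) z) x+u≡y (evℤ-quot p (+ x) u))
        (trans (ℤₚ.+-comm (evℤ p (+ x)) _)
          (cong (λ e → u * e + evℤ p (+ x)) (sym (ev-synth (+ x) p (+ y)))))
      u≢0 : u ≢ + 0
      u≢0 u≡0 = x≢y (sym (ℤₚ.+-injective (ℤₚ.i-j≡0⇒i≡j (+ y) (+ x) u≡0)))
      step : ∣ evℤ g (+ y) ∣ ℕ.≤ 2 ℕ.* B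
      step = begin
        ∣ evℤ g (+ y) ∣ ≤⟨ ℕₚ.m≤n*m _ ∣ u ∣ {{ℕ.>-nonZero 1≤∣ u≢0 ∣}} ⟩
        ∣ u ∣ ℕ.* ∣ evℤ g (+ y) ∣             ≡⟨ ℤₚ.abs-* u (evℤ g (+ y)) ⟨
        ∣ u * evℤ g (+ y) ∣ ≤⟨ ∣m∣≤ (evℤ p (+ y)) (u * evℤ g (+ y)) (evℤ p (+ x)) eq ⟩
        ∣ evℤ p (+ y) ∣ ℕ.+ ∣ evℤ p (+ x) ∣ ≤⟨ ℕₚ.+-mono-≤ py≤B px≤B ⟩
        B ℕ.+ B                               ≡⟨ cong (B ℕ.+_) (ℕₚ.+-identityʳ B) ⟨
        2 ℕ.* B ∎
        where open ℕₚ.≤-Reasoning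

    g≤ : ∀ i → ∣ coeff g i ∣ ℕ.≤ I ℕ.* (2 ℕ.* B)
    g≤ = interpolation d l g xs (length-synth (+ x) p p≤l) l≤xs unique xs≤d (gs≤2B x∉xs ps≤B)

    xg≤ : ∀ i → ∣ + x * coeff g i ∣ ℕ.≤ d ℕ.* (I ℕ.* (2 ℕ.* B))
    xg≤ i = subst (ℕ._≤ d ℕ.* (I ℕ.* (2 ℕ.* B))) (sym (ℤₚ.abs-* (+ x) (coeff g i)))
      (ℕₚ.*-mono-≤ x≤d (g≤ i))

    bound : ∀ i → ∣ coeff p i ∣ ℕ.≤ interp d (suc l) ℕ.* B
    bound zero = begin
      ∣ coeff p 0 ∣ ≤⟨ ∣m∣≤ (evℤ p (+ x)) (coeff p 0) (+ x * coeff g 0) (coeff-synth-zero (+ x) p) ⟩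
      ∣ evℤ p (+ x) ∣ ℕ.+ ∣ + x * coeff g 0 ∣ ≤⟨ ℕₚ.+-mono-≤ px≤B (xg≤ 0) ⟩
      B ℕ.+ d ℕ.* (I ℕ.* (2 ℕ.* B)) ≤⟨ ℕₚ.m≤m+n _ _ ⟩
      B ℕ.+ d ℕ.* (I ℕ.* (2 ℕ.* B)) ℕ.+ I ℕ.* (2 ℕ.* B)
        ≡⟨ solve 3 (λ B d I → B :+ d :* (I :* (con 2 :* B)) :+ I :* (con 2 :* B)
             := (con 1 :+ (con 1 :+ d) :* (I :* con 2)) :* B) refl B d I ⟩
      interp d (suc l) ℕ.* B ∎
      where open ℕₚ.≤-Reasoning
            open ℕ-Solver.+-*-Solver
    bound (suc i) = begin
      ∣ coeff p (suc i) ∣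
        ≤⟨ ∣m∣≤ (coeff g i) (coeff p (suc i)) (+ x * coeff g (suc i)) (coeff-synth-suc (+ x) p i) ⟩
      ∣ coeff g i ∣ ℕ.+ ∣ + x * coeff g (suc i) ∣ ≤⟨ ℕₚ.+-mono-≤ (g≤ i) (xg≤ (suc i)) ⟩
      I ℕ.* (2 ℕ.* B) ℕ.+ d ℕ.* (I ℕ.* (2 ℕ.* B)) ≤⟨ ℕₚ.m≤m+n _ _ ⟩
      I ℕ.* (2 ℕ.* B) ℕ.+ d ℕ.* (I ℕ.* (2 ℕ.* B)) ℕ.+ B
        ≡⟨ solve 3 (λ B d I → I :* (con 2 :* B) :+ d :* (I :* (con 2 :* B)) :+ B
             := (con 1 :+ (con 1 :+ d) :* (I :* con 2)) :* B) refl B d I ⟩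
      interp d (suc l) ℕ.* B ∎
      where open ℕₚ.≤-Reasoning
            open ℕ-Solver.+-*-Solver

  not-small-beyond-degree : ∀ d m p xs → Degree m p → m ℕ.< length xs → Unique xs →
    All (ℕ._≤ d) xs →
    ¬ All (λ x → interp d (suc m) ℕ.* ∣ evℤ p (+ x) ∣ ℕ.< height p) xs
  not-small-beyond-degree d m p xs deg m<xs unique xs≤d small = ℕₚ.<-irrefl refl
    (ℕₚ.<-≤-trans (ℕₚ.∸-monoʳ-< {o = 0} (s≤s z≤n) 1≤H) (height≤ p bound))
    where
    I : ℕ
    I = interp d (suc m)
    1≤H : 1 ℕ.≤ height p
    1≤H = 1≤height p deg
    -- Interpolating I p instead of p turns the strict hypothesis into the integer bound
    -- `height p ∸ 1`, which survives the cancellation of I.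
    Ip : Poly
    Ip = map (+ I *_) p
    small′ : All (λ x → ∣ evℤ Ip (+ x) ∣ ℕ.≤ height p ℕ.∸ 1) xs
    small′ = All.map (λ {x} lt → subst (ℕ._≤ height p ℕ.∸ 1)
      (sym (trans (cong ∣_∣ (evℤ-map (+ I) p (+ x))) (ℤₚ.abs-* (+ I) (evℤ p (+ x)))))
      (ℕₚ.m+n≤o⇒m≤o∸n (I ℕ.* ∣ evℤ p (+ x) ∣) {1} {height p}
        (subst (ℕ._≤ height p) (ℕₚ.+-comm 1 (I ℕ.* ∣ evℤ p (+ x) ∣)) lt))) small
    bound : ∀ i → ∣ coeff p i ∣ ℕ.≤ height p ℕ.∸ 1
    bound i = ℕₚ.*-cancelˡ-≤ I (subst (ℕ._≤ I ℕ.* (height p ℕ.∸ 1))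
      (trans (cong ∣_∣ (coeff-map (+ I) p i)) (ℤₚ.abs-* (+ I) (coeff p i)))
      (interpolation d (suc m) Ip xs
        (ℕₚ.≤-reflexive (trans (Listₚ.length-map _ p) (len deg))) m<xs unique xs≤d small′ i))

  module _ {P Q R : Pred ℕ 0ℓ} (P? : Decidable P) (Q? : Decidable Q) where

    find-neither : ∀ xs → All R xs → (∃[ x ] R x × (¬ P x) × (¬ Q x)) ⊎
      length xs ℕ.≤ length (filter P? xs) ℕ.+ length (filter Q? xs)
    find-neither [] [] = inj₂ z≤n
    find-neither (x ∷ xs) (rx ∷ rxs) with find-neither xs rxs
    ... | inj₁ found = inj₁ found
    ... | inj₂ le with P? x | Q? x
    ...   | no ¬p | no ¬q = inj₁ (x , rx , ¬p , ¬q)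
    ...   | no _  | yes _ = inj₂ (subst (suc (length xs) ℕ.≤_) (sym (ℕₚ.+-suc _ _)) (s≤s le))
    ...   | yes _ | no _  = inj₂ (s≤s le)
    ...   | yes _ | yes _ = inj₂ (s≤s (ℕₚ.≤-trans le (ℕₚ.+-monoʳ-≤ _ (ℕₚ.n≤1+n _))))

  evalBound : ℕ → ℕ → ℕ
  evalBound d zero    = 0
  evalBound d (suc l) = 1 ℕ.+ d ℕ.* evalBound d l

  ev-≤ : ∀ d p {l B} x → length p ℕ.≤ l → x ℕ.≤ d → (∀ i → ∣ coeff p i ∣ ℕ.≤ B) →
    ∣ evℤ p (+ x) ∣ ℕ.≤ evalBound d l ℕ.* B
  ev-≤ d []      x _ _ _ = z≤n
  ev-≤ d (a ∷ p) {suc l} {B} x (s≤s p≤l) x≤d p≤B = begin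
    ∣ a + + x * evℤ p (+ x) ∣ ≤⟨ ℤₚ.∣i+j∣≤∣i∣+∣j∣ a _ ⟩
    ∣ a ∣ ℕ.+ ∣ + x * evℤ p (+ x) ∣ ≡⟨ cong (∣ a ∣ ℕ.+_) (ℤₚ.abs-* (+ x) _) ⟩
    ∣ a ∣ ℕ.+ x ℕ.* ∣ evℤ p (+ x) ∣
      ≤⟨ ℕₚ.+-mono-≤ (p≤B 0) (ℕₚ.*-mono-≤ x≤d (ev-≤ d p x p≤l x≤d (λ i → p≤B (suc i)))) ⟩
    B ℕ.+ d ℕ.* (evalBound d l ℕ.* B)  ≡⟨ cong (B ℕ.+_) (ℕₚ.*-assoc d _ B) ⟨
    evalBound d (suc l) ℕ.* B ∎
    where open ℕₚ.≤-Reasoning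

  interp-mono : ∀ d {l l′} → l ℕ.≤ l′ → interp d l ℕ.≤ interp d l′
  interp-mono d z≤n        = z≤n
  interp-mono d (s≤s l≤l′) =
    ℕₚ.+-monoʳ-≤ 1 (ℕₚ.*-monoʳ-≤ (1 ℕ.+ d) (ℕₚ.*-monoˡ-≤ 2 (interp-mono d l≤l′)))

  abstract

    -- One interpolation constant for each factor and one constant for evaluating their product at a
    -- point up to `d`.
    gelfondConstant : ℕ → ℕ
    gelfondConstant d =
      interp d (suc d) ℕ.* interp d (suc d) ℕ.* evalBound d (suc d)

    -- At most m of the d + 1 points are bad for `f` and at most n for `g`, so a point good for both
    -- remains. There each height is bounded by a constant times the value of its factor, and the
    -- product of the values is a value of f g.
    gelfond : ∀ d m n f g {B} → Degree m f → Degree n g → m ℕ.+ n ℕ.≤ d →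
      (∀ i → ∣ coeff (f *ₚ g) i ∣ ℕ.≤ B) →
      height f ℕ.* height g ℕ.≤ gelfondConstant d ℕ.* B
    gelfond d m n f g {B} deg-f deg-g m+n≤d fg≤B = conclude (find-neither {R = ℕ._≤ d} smallF? smallG?
        points points≤d)
      where
      I I′ E : ℕ
      I  = interp d (suc m)
      I′ = interp d (suc n)
      E  = evalBound d (suc d)
      SmallF SmallG : ℕ → Set
      SmallF x = I ℕ.* ∣ evℤ f (+ x) ∣ ℕ.< height f
      SmallG x = I′ ℕ.* ∣ evℤ g (+ x) ∣ ℕ.< height g
      smallF? : Decidable SmallF
      smallF? x = I ℕ.* ∣ evℤ f (+ x) ∣ ℕₚ.<? height f
      smallG? : Decidable SmallG
      smallG? x = I′ ℕ.* ∣ evℤ g (+ x) ∣ ℕₚ.<? height g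
      points : List ℕ
      points = upTo (suc d)
      points≤d : All (ℕ._≤ d) points
      points≤d = Allₚ.applyUpTo⁺₁ id (suc d) (λ { (s≤s i≤d) → i≤d })
      unique : Unique points
      unique = Uniqueₚ.upTo⁺ (suc d)

      filterF≤m : length (filter smallF? points) ℕ.≤ m
      filterF≤m = ℕₚ.≮⇒≥ λ m< → not-small-beyond-degree d m f (filter smallF? points) deg-f m<
        (Uniqueₚ.filter⁺ smallF? unique) (Allₚ.filter⁺ smallF? points≤d) (Allₚ.all-filter smallF? points)
      filterG≤n : length (filter smallG? points) ℕ.≤ n
      filterG≤n = ℕₚ.≮⇒≥ λ n< → not-small-beyond-degree d n g (filter smallG? points) deg-g n<
        (Uniqueₚ.filter⁺ smallG? unique) (Allₚ.filter⁺ smallG? points≤d) (Allₚ.all-filter smallG? points)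

      fg : Poly
      fg = truncate (suc d) (f *ₚ g)
      fg≈ : fg ≈ₚ f *ₚ g
      fg≈ = truncate-≈ (suc d) (f *ₚ g) (λ i d<i →
        *ₚ-above f g (below deg-f) (below deg-g) i (ℕₚ.≤-trans (s≤s m+n≤d) d<i))

      conclude : (∃[ x ] x ℕ.≤ d × (¬ SmallF x) × (¬ SmallG x)) ⊎
        length points ℕ.≤ length (filter smallF? points) ℕ.+ length (filter smallG? points) →
        height f ℕ.* height g ℕ.≤ gelfondConstant d ℕ.* B
      conclude (inj₂ le) = contradiction
        (ℕₚ.≤-trans (subst (ℕ._≤ length (filter smallF? points) ℕ.+ length (filter smallG? points))
          (Listₚ.length-upTo (suc d)) le)
          (ℕₚ.≤-trans (ℕₚ.+-mono-≤ filterF≤m filterG≤n) m+n≤d)) (ℕₚ.<-irrefl refl)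
      conclude (inj₁ (x , x≤d , ¬smallF , ¬smallG)) = begin
        height f ℕ.* height g ≤⟨ ℕₚ.*-mono-≤ (ℕₚ.≮⇒≥ ¬smallF) (ℕₚ.≮⇒≥ ¬smallG) ⟩
        (I ℕ.* ∣ fx ∣) ℕ.* (I′ ℕ.* ∣ gx ∣)
          ≡⟨ solve 4 (λ a b c e → (a :* b) :* (c :* e) := (a :* c) :* (b :* e)) refl I (∣ fx ∣) I′ (∣ gx ∣) ⟩
        (I ℕ.* I′) ℕ.* (∣ fx ∣ ℕ.* ∣ gx ∣) ≤⟨ ℕₚ.*-mono-≤
          (ℕₚ.*-mono-≤ (interp-mono d (s≤s (ℕₚ.≤-trans (ℕₚ.m≤m+n m n) m+n≤d)))
                       (interp-mono d (s≤s (ℕₚ.≤-trans (ℕₚ.m≤n+m n m) m+n≤d)))) fgx≤ ⟩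
        (interp d (suc d) ℕ.* interp d (suc d)) ℕ.* (E ℕ.* B)
          ≡⟨ ℕₚ.*-assoc (interp d (suc d) ℕ.* interp d (suc d)) E B ⟨
        gelfondConstant d ℕ.* B ∎
        where
        open ℕₚ.≤-Reasoning
        open ℕ-Solver.+-*-Solver
        fx gx : ℤ
        fx = evℤ f (+ x)
        gx = evℤ g (+ x)
        fgx≤ : ∣ fx ∣ ℕ.* ∣ gx ∣ ℕ.≤ E ℕ.* B
        fgx≤ = subst (ℕ._≤ E ℕ.* B)
          (trans (cong ∣_∣ (trans (evℤ-≈ fg (f *ₚ g) (+ x) fg≈) (evℤ-* f g (+ x)))) (ℤₚ.abs-* fx gx))
          (ev-≤ d fg x (ℕₚ.≤-reflexive (length-truncate (suc d) (f *ₚ g))) x≤d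
            (λ i → subst (λ a → ∣ a ∣ ℕ.≤ B) (sym (fg≈ i)) (fg≤B i)))

-- A form of Siegel's lemma, by the pigeonhole principle.

module Siegel where

  open IntPoly
  open import Data.Fin.Base as Fin using (Fin; zero; suc; toℕ; fromℕ<; punchIn; punchOut; remQuot; combine; finToFun; funToFin)
  import Data.Fin.Properties as Finₚ
  open import Data.Integer.Base using (∣_∣; _+_; _*_; -_; _-_)
  open import Data.Integer.Solver using (module +-*-Solver)
  open import Data.List.Base using (tabulate)
  import Data.List.Properties as Listₚ
  open import Data.Nat.Base using (_^_)
  import Data.Nat.Solver as ℕ-Solver

  open ℤ[x]

  coeff-*-≤ : ∀ p q {A B} → (∀ i → ∣ coeff p i ∣ ℕ.≤ A) → (∀ i → ∣ coeff q i ∣ ℕ.≤ B) →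
    ∀ i → ∣ coeff (p *ₚ q) i ∣ ℕ.≤ length p ℕ.* (A ℕ.* B)
  coeff-*-≤ []      q p≤A q≤B i = z≤n
  coeff-*-≤ (a ∷ p) q {A} {B} p≤A q≤B i = bound i
    where
    open ℕₚ.≤-Reasoning
    aq≤ : ∀ i → ∣ a * coeff q i ∣ ℕ.≤ A ℕ.* B
    aq≤ i = subst (ℕ._≤ A ℕ.* B) (sym (ℤₚ.abs-* a (coeff q i))) (ℕₚ.*-mono-≤ (p≤A 0) (q≤B i))
    bound : ∀ i → ∣ coeff ((a ∷ p) *ₚ q) i ∣ ℕ.≤ suc (length p) ℕ.* (A ℕ.* B)
    bound zero = begin
      ∣ coeff ((a ∷ p) *ₚ q) 0 ∣ ≡⟨ cong ∣_∣ (coeff-∷*-zero a p q) ⟩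
      ∣ a * coeff q 0 ∣ ≤⟨ aq≤ 0 ⟩
      A ℕ.* B ≤⟨ ℕₚ.m≤m+n _ _ ⟩
      suc (length p) ℕ.* (A ℕ.* B) ∎
    bound (suc i) = begin
      ∣ coeff ((a ∷ p) *ₚ q) (suc i) ∣ ≡⟨ cong ∣_∣ (coeff-∷*-suc a p q i) ⟩
      ∣ a * coeff q (suc i) + coeff (p *ₚ q) i ∣
        ≤⟨ ℤₚ.∣i+j∣≤∣i∣+∣j∣ (a * coeff q (suc i)) (coeff (p *ₚ q) i) ⟩
      ∣ a * coeff q (suc i) ∣ ℕ.+ ∣ coeff (p *ₚ q) i ∣
        ≤⟨ ℕₚ.+-mono-≤ (aq≤ (suc i)) (coeff-*-≤ p q (λ j → p≤A (suc j)) q≤B i) ⟩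
      suc (length p) ℕ.* (A ℕ.* B) ∎

  coeff-tabulate : ∀ {n} (u : Fin n → ℤ) k → coeff (tabulate u) (toℕ k) ≡ u k
  coeff-tabulate u zero    = refl
  coeff-tabulate u (suc k) = coeff-tabulate (u ∘ suc) k

  coeff-tabulate-≤ : ∀ {n} (u : Fin n → ℤ) {A} → (∀ k → ∣ u k ∣ ℕ.≤ A) →
    ∀ i → ∣ coeff (tabulate u) i ∣ ℕ.≤ A
  coeff-tabulate-≤ {zero}  u u≤A i       = z≤n
  coeff-tabulate-≤ {suc n} u u≤A zero    = u≤A zero
  coeff-tabulate-≤ {suc n} u u≤A (suc i) = coeff-tabulate-≤ (u ∘ suc) (u≤A ∘ suc) i

  tabulate-*-difference : ∀ {n} (u v : Fin n → ℤ) q i →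
    coeff (tabulate (λ k → u k - v k) *ₚ q) i ≡
    coeff (tabulate u *ₚ q) i - coeff (tabulate v *ₚ q) i
  tabulate-*-difference {zero}  u v q i = refl
  tabulate-*-difference {suc n} u v q zero = trans (coeff-∷*-zero (u zero - v zero)
      (tabulate (λ k → u (suc k) - v (suc k))) q)
    (trans (solve 3 (λ a b x → (a :- b) :* x := a :* x :- b :* x) refl (u zero) (v zero) (coeff q 0))
      (cong₂ _-_ (sym (coeff-∷*-zero (u zero) (tabulate (u ∘ suc)) q))
                 (sym (coeff-∷*-zero (v zero) (tabulate (v ∘ suc)) q))))
    where open +-*-Solver
  tabulate-*-difference {suc n} u v q (suc i) =
    trans (coeff-∷*-suc (u zero - v zero) (tabulate (λ k → u (suc k) - v (suc k))) q i)
    (trans (cong (_+_ ((u zero - v zero) * coeff q (suc i))) (tabulate-*-difference (u ∘ suc) (v ∘ suc) q i))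
    (trans (solve 5 (λ a b x y z → (a :- b) :* x :+ (y :- z) := (a :* x :+ y) :- (b :* x :+ z))
        refl (u zero) (v zero) (coeff q (suc i)) (coeff (tabulate (u ∘ suc) *ₚ q) i)
            (coeff (tabulate (v ∘ suc) *ₚ q) i))
      (cong₂ _-_ (sym (coeff-∷*-suc (u zero) (tabulate (u ∘ suc)) q i))
                 (sym (coeff-∷*-suc (v zero) (tabulate (v ∘ suc)) q i)))))
    where open +-*-Solver

  nonNeg-shift : ∀ {B} c → ∣ c ∣ ℕ.≤ B → + ∣ c + + B ∣ ≡ c + + B
  nonNeg-shift {B} c c≤B = ℤₚ.0≤i⇒+∣i∣≡i (subst (ℤ._≤ c + + B) (ℤₚ.+-inverseˡ (+ B))
    (ℤₚ.+-monoˡ-≤ (+ B) (ℤₚ.≤-trans (ℤₚ.neg-mono-≤ (ℤ.+≤+ c≤B))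
      (subst (- (+ ∣ c ∣) ℤ.≤_) (ℤₚ.neg-involutive c) (ℤₚ.neg-mono-≤
        (subst (λ k → - c ℤ.≤ + k) (ℤₚ.∣-i∣≡∣i∣ c) (i≤+∣i∣ (- c))))))))
    where
    i≤+∣i∣ : ∀ i → i ℤ.≤ + ∣ i ∣
    i≤+∣i∣ (+ n)    = ℤₚ.≤-refl
    i≤+∣i∣ -[1+ n ] = ℤ.-≤+

  -- Shifting by B codes the integers from -B to B as 2B + 1 digits, so that a vector of
  -- coefficients becomes a single element of a `Fin`.
  digit : ∀ B c → ∣ c ∣ ℕ.≤ B → Fin (suc (B ℕ.+ B))
  digit B c c≤B = fromℕ< (s≤s (ℕₚ.≤-trans (ℤₚ.∣i+j∣≤∣i∣+∣j∣ c (+ B)) (ℕₚ.+-monoˡ-≤ B c≤B)))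

  digit-injective : ∀ B c c′ c≤B c′≤B → digit B c c≤B ≡ digit B c′ c′≤B → c ≡ c′
  digit-injective B c c′ c≤B c′≤B eq = trans (unshift c) (trans (cong (_- + B)
    (trans (sym (nonNeg-shift c c≤B)) (trans (cong +_ ∣∣≡) (nonNeg-shift c′ c′≤B)))) (sym (unshift c′)))
    where
    ∣∣≡ : ∣ c + + B ∣ ≡ ∣ c′ + + B ∣
    ∣∣≡ = trans (sym (Finₚ.toℕ-fromℕ< _)) (trans (cong toℕ eq) (Finₚ.toℕ-fromℕ< _))
    open +-*-Solver
    unshift : ∀ x → x ≡ x + + B - + B
    unshift x = solve 2 (λ x b → x := x :+ b :- b) refl x (+ B)

  funToFin-cong : ∀ {m n} {f g : Fin m → Fin n} → (∀ i → f i ≡ g i) → funToFin f ≡ funToFin g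
  funToFin-cong {zero}  f≗g = refl
  funToFin-cong {suc m} f≗g = cong₂ combine (f≗g zero) (funToFin-cong (f≗g ∘ suc))

  finToFun-injective : ∀ {m n} {i j : Fin (m ^ n)} →
    (∀ k → finToFun {m} {n} i k ≡ finToFun j k) → i ≡ j
  finToFun-injective {m} {n} {i} {j} eq = trans (sym (Finₚ.funToFin-finToFin {n} {m} i))
    (trans (funToFin-cong eq) (Finₚ.funToFin-finToFin {n} {m} j))

  *-^ : ∀ a b e → (a ℕ.* b) ^ e ≡ a ^ e ℕ.* b ^ e
  *-^ a b zero    = refl
  *-^ a b (suc e) = trans (cong (a ℕ.* b ℕ.*_) (*-^ a b e))
    (solve 4 (λ a b x y → (a :* b) :* (x :* y) := (a :* x) :* (b :* y)) refl a b (a ^ e) (b ^ e))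
    where open ℕ-Solver.+-*-Solver

  1≤^ : ∀ {a} e → 1 ℕ.≤ a → 1 ℕ.≤ a ^ e
  1≤^ {suc a} e _ = ℕₚ.m^n>0 (suc a) e

  abstract
    -- Chosen to make the count close. Coefficients of U f + V g are at most B = N t F G, so N - 1
    -- of them take at most (3B)^(N - 1) values, while there are t^N Gⁿ Fᵐ pairs (U, V). For t =
    -- (3N)^N F^(n - 1) G^(m - 1) the second number is at least 3N times the first.
    siegelConstant : ℕ → ℕ
    siegelConstant N = (3 ℕ.* N) ^ N

    siegelConstant≡ : ∀ N → siegelConstant N ≡ (3 ℕ.* N) ^ N
    siegelConstant≡ N = refl

    -- For deg f ≤ suc m′, deg g ≤ suc n′ of heights F, G: the coefficients of U and V
    -- in siegel range up to siegelScale * G and siegelScale * F.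
    siegelScale : ℕ → ℕ → ℕ → ℕ → ℕ
    siegelScale m′ n′ F G = siegelConstant (suc m′ ℕ.+ suc n′) ℕ.* (F ^ n′ ℕ.* G ^ m′)

    siegelScale≡ : ∀ m′ n′ F G →
      siegelScale m′ n′ F G ≡ siegelConstant (suc m′ ℕ.+ suc n′) ℕ.* (F ^ n′ ℕ.* G ^ m′)
    siegelScale≡ m′ n′ F G = refl

    1≤siegelScale : ∀ m′ n′ {F G} → 1 ℕ.≤ F → 1 ℕ.≤ G → 1 ℕ.≤ siegelScale m′ n′ F G
    1≤siegelScale m′ n′ 1≤F 1≤G = ℕₚ.*-mono-≤ (1≤^ (suc m′ ℕ.+ suc n′) (s≤s z≤n))
      (ℕₚ.*-mono-≤ (1≤^ n′ 1≤F) (1≤^ m′ 1≤G))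

  module _ (m′ n′ F G : ℕ) (1≤F : 1 ℕ.≤ F) (1≤G : 1 ℕ.≤ G) where

    private
      e N t c B X : ℕ
      e = m′ ℕ.+ suc n′
      N = suc e
      t = siegelScale m′ n′ F G
      c = 3 ℕ.* N
      B = N ℕ.* (t ℕ.* (F ℕ.* G))
      X = c ^ e ℕ.* (F ^ e ℕ.* G ^ e) ℕ.* t ^ e

      1≤t : 1 ℕ.≤ t
      1≤t = 1≤siegelScale m′ n′ 1≤F 1≤G
      1≤B : 1 ℕ.≤ B
      1≤B = ℕₚ.*-mono-≤ {1} {N} (s≤s z≤n) (ℕₚ.*-mono-≤ 1≤t (ℕₚ.*-mono-≤ 1≤F 1≤G))
      1≤c : 1 ℕ.≤ c
      1≤c = s≤s z≤n
      1≤X : 1 ℕ.≤ X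
      1≤X = ℕₚ.*-mono-≤ (ℕₚ.*-mono-≤ (1≤^ e 1≤c) (ℕₚ.*-mono-≤ (1≤^ e 1≤F) (1≤^ e 1≤G))) (1≤^ e 1≤t)

      boxes≤X : suc (B ℕ.+ B) ^ e ℕ.≤ X
      boxes≤X = begin
        suc (B ℕ.+ B) ^ e ≤⟨ ℕₚ.^-monoˡ-≤ e (ℕₚ.+-monoˡ-≤ (B ℕ.+ B) 1≤B) ⟩
        (B ℕ.+ (B ℕ.+ B)) ^ e                   ≡⟨ cong (_^ e) (solve 4 (λ N t F G →
            N :* (t :* (F :* G)) :+ (N :* (t :* (F :* G)) :+ N :* (t :* (F :* G)))
            := con 3 :* N :* (F :* G) :* t) refl N t F G) ⟩
        (c ℕ.* (F ℕ.* G) ℕ.* t) ^ e ≡⟨ *-^ (c ℕ.* (F ℕ.* G)) t e ⟩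
        (c ℕ.* (F ℕ.* G)) ^ e ℕ.* t ^ e ≡⟨ cong (ℕ._* t ^ e) (*-^ c (F ℕ.* G) e) ⟩
        c ^ e ℕ.* (F ℕ.* G) ^ e ℕ.* t ^ e ≡⟨ cong (λ z → c ^ e ℕ.* z ℕ.* t ^ e) (*-^ F G e) ⟩
        X ∎
        where open ℕₚ.≤-Reasoning
              open ℕ-Solver.+-*-Solver

      tuples≡cX : (t ℕ.* G) ^ suc n′ ℕ.* (t ℕ.* F) ^ suc m′ ≡ c ℕ.* X
      tuples≡cX = begin
        (t ℕ.* G) ^ suc n′ ℕ.* (t ℕ.* F) ^ suc m′
          ≡⟨ cong₂ ℕ._*_ (*-^ t G (suc n′)) (*-^ t F (suc m′)) ⟩
        (t ℕ.* tⁿ ℕ.* (G ℕ.* Gⁿ)) ℕ.* (t ℕ.* tᵐ ℕ.* (F ℕ.* Fᵐ))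
          ≡⟨ solve 8 (λ t tⁿ tᵐ G Gⁿ F Fᵐ w → (t :* tⁿ :* (G :* Gⁿ)) :* (t :* tᵐ :* (F :* Fᵐ))
               := t :* (tᵐ :* (t :* tⁿ)) :* ((G :* Gⁿ) :* (F :* Fᵐ))) refl t tⁿ tᵐ G Gⁿ F Fᵐ 0 ⟩
        t ℕ.* (tᵐ ℕ.* (t ℕ.* tⁿ)) ℕ.* ((G ℕ.* Gⁿ) ℕ.* (F ℕ.* Fᵐ))
          ≡⟨ cong (λ z → t ℕ.* z ℕ.* ((G ℕ.* Gⁿ) ℕ.* (F ℕ.* Fᵐ))) (sym (ℕₚ.^-distribˡ-+-* t m′ (suc n′))) ⟩
        t ℕ.* t ^ e ℕ.* ((G ℕ.* Gⁿ) ℕ.* (F ℕ.* Fᵐ))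
          ≡⟨ cong (λ z → z ℕ.* t ^ e ℕ.* ((G ℕ.* Gⁿ) ℕ.* (F ℕ.* Fᵐ)))
               (trans (siegelScale≡ m′ n′ F G) (cong (ℕ._* (Fⁿ ℕ.* Gᵐ)) (siegelConstant≡ N))) ⟩
        c ^ N ℕ.* (Fⁿ ℕ.* Gᵐ) ℕ.* t ^ e ℕ.* ((G ℕ.* Gⁿ) ℕ.* (F ℕ.* Fᵐ))
          ≡⟨ solve 9 (λ c cᵉ Fⁿ Gᵐ tᵉ G Gⁿ F Fᵐ →
               c :* cᵉ :* (Fⁿ :* Gᵐ) :* tᵉ :* ((G :* Gⁿ) :* (F :* Fᵐ))
               := c :* (cᵉ :* ((Fᵐ :* (F :* Fⁿ)) :* (Gᵐ :* (G :* Gⁿ))) :* tᵉ))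
               refl c (c ^ e) Fⁿ Gᵐ (t ^ e) G Gⁿ F Fᵐ ⟩
        c ℕ.* (c ^ e ℕ.* ((Fᵐ ℕ.* (F ℕ.* Fⁿ)) ℕ.* (Gᵐ ℕ.* (G ℕ.* Gⁿ))) ℕ.* t ^ e)
          ≡⟨ cong₂ (λ y z → c ℕ.* (c ^ e ℕ.* (y ℕ.* z) ℕ.* t ^ e))
               (sym (ℕₚ.^-distribˡ-+-* F m′ (suc n′))) (sym (ℕₚ.^-distribˡ-+-* G m′ (suc n′))) ⟩
        c ℕ.* X ∎
        where
        open ≡-Reasoning
        open ℕ-Solver.+-*-Solver
        tⁿ tᵐ Fⁿ Fᵐ Gⁿ Gᵐ : ℕ
        tⁿ = t ^ n′ ; tᵐ = t ^ m′ ; Fⁿ = F ^ n′ ; Fᵐ = F ^ m′ ; Gⁿ = G ^ n′ ; Gᵐ = G ^ m′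

      more-tuples : suc (B ℕ.+ B) ^ e ℕ.< (t ℕ.* G) ^ suc n′ ℕ.* (t ℕ.* F) ^ suc m′
      more-tuples = subst (suc (B ℕ.+ B) ^ e ℕ.<_) (sym (trans tuples≡cX (ℕₚ.*-comm c X)))
        (ℕₚ.≤-<-trans boxes≤X (ℕₚ.m<m*n X c {{ℕ.>-nonZero 1≤X}} 1<c))
        where
        1<c : 1 ℕ.< c
        1<c = ℕₚ.≤-trans (s≤s (s≤s z≤n)) (ℕₚ.*-monoʳ-≤ 3 {1} {N} (s≤s z≤n))

    private
     module Tuples (f g : Poly) (f≤F : ∀ i → ∣ coeff f i ∣ ℕ.≤ F) (g≤G : ∀ i → ∣ coeff g i ∣ ℕ.≤ G)
       (j : Fin (suc m′ ℕ.+ suc n′)) where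

      Tuple : Set
      Tuple = Fin ((t ℕ.* G) ^ suc n′ ℕ.* (t ℕ.* F) ^ suc m′)

      split : Tuple → Fin ((t ℕ.* G) ^ suc n′) × Fin ((t ℕ.* F) ^ suc m′)
      split = remQuot ((t ℕ.* F) ^ suc m′)

      uᶠ : Tuple → Fin (suc n′) → Fin (t ℕ.* G)
      uᶠ x = finToFun (proj₁ (split x))
      vᶠ : Tuple → Fin (suc m′) → Fin (t ℕ.* F)
      vᶠ x = finToFun (proj₂ (split x))

      u : Tuple → Fin (suc n′) → ℤ
      u x k = + toℕ (uᶠ x k)
      v : Tuple → Fin (suc m′) → ℤ
      v x k = + toℕ (vᶠ x k)

      value : Tuple → ℕ → ℤ
      value x i = coeff (tabulate (u x) *ₚ f) i + coeff (tabulate (v x) *ₚ g) i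

      value≤B : ∀ x i → ∣ value x i ∣ ℕ.≤ B
      value≤B x i = begin
        ∣ value x i ∣
          ≤⟨ ℤₚ.∣i+j∣≤∣i∣+∣j∣ (coeff (tabulate (u x) *ₚ f) i) (coeff (tabulate (v x) *ₚ g) i) ⟩
        ∣ coeff (tabulate (u x) *ₚ f) i ∣ ℕ.+ ∣ coeff (tabulate (v x) *ₚ g) i ∣
          ≤⟨ ℕₚ.+-mono-≤
               (coeff-*-≤ (tabulate (u x)) f (coeff-tabulate-≤ (u x)
                   (λ k → ℕₚ.<⇒≤ (Finₚ.toℕ<n (uᶠ x k)))) f≤F i)
               (coeff-*-≤ (tabulate (v x)) g (coeff-tabulate-≤ (v x)
                   (λ k → ℕₚ.<⇒≤ (Finₚ.toℕ<n (vᶠ x k)))) g≤G i) ⟩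
        length (tabulate (u x)) ℕ.* (t ℕ.* G ℕ.* F) ℕ.+ length (tabulate (v x)) ℕ.* (t ℕ.* F ℕ.* G)
          ≡⟨ cong₂ (λ a b → a ℕ.* (t ℕ.* G ℕ.* F) ℕ.+ b ℕ.* (t ℕ.* F ℕ.* G))
               (Listₚ.length-tabulate (u x)) (Listₚ.length-tabulate (v x)) ⟩
        suc n′ ℕ.* (t ℕ.* G ℕ.* F) ℕ.+ suc m′ ℕ.* (t ℕ.* F ℕ.* G)
          ≡⟨ solve 5 (λ n m t F G → n :* (t :* G :* F) :+ m :* (t :* F :* G)
               := (m :+ n) :* (t :* (F :* G))) refl (suc n′) (suc m′) t F G ⟩
        B ∎
        where open ℕₚ.≤-Reasoning
              open ℕ-Solver.+-*-Solver

      code : Tuple → Fin (suc (B ℕ.+ B) ^ e)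
      -- `punchIn j` skips the coefficient j. This leaves N - 1 conditions on N unknowns; coding all
      -- N coefficients would leave no surplus of pairs.
      code x = funToFin {e} (λ i → digit B (value x (toℕ (punchIn j i))) (value≤B x _))

      collision : ∃[ x ] ∃[ y ] x Fin.< y × code x ≡ code y
      collision = Finₚ.pigeonhole more-tuples code

      x y : Tuple
      x = proj₁ collision
      y = proj₁ (proj₂ collision)

      x≢y : x ≢ y
      x≢y = Finₚ.<⇒≢ (proj₁ (proj₂ (proj₂ collision)))

      same : ∀ i → value x (toℕ (punchIn j i)) ≡ value y (toℕ (punchIn j i))
      same i = digit-injective B (value x (toℕ (punchIn j i))) (value y (toℕ (punchIn j i)))
        (value≤B x _) (value≤B y _) (trans (sym (Finₚ.finToFun-funToFin {e} _ i))
        (trans (cong (λ z → finToFun {suc (B ℕ.+ B)} {e} z i) (proj₂ (proj₂ (proj₂ collision))))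
          (Finₚ.finToFun-funToFin {e} _ i)))

      U V : Poly
      U = tabulate (λ k → u x k - u y k)
      V = tabulate (λ k → v x k - v y k)

      difference≤ : ∀ {a} (i j : Fin a) → ∣ + toℕ i - + toℕ j ∣ ℕ.≤ a
      difference≤ i j = subst (ℕ._≤ _) (sym (cong ∣_∣ (ℤₚ.m-n≡m⊖n (toℕ i) (toℕ j))))
        (ℕₚ.≤-trans (ℤₚ.∣m⊝n∣≤m⊔n (toℕ i) (toℕ j))
        (ℕₚ.⊔-lub (ℕₚ.<⇒≤ (Finₚ.toℕ<n i)) (ℕₚ.<⇒≤ (Finₚ.toℕ<n j))))

      nonzero : ¬ (U ≈ₚ [] × V ≈ₚ [])
      nonzero (U≈0 , V≈0) = x≢y (trans (sym (Finₚ.combine-remQuot {(t ℕ.* G) ^ suc n′} ((t ℕ.* F) ^ suc m′) x))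
        (trans (cong₂ combine
          (finToFun-injective {t ℕ.* G} {suc n′} (λ k → equal (uᶠ x k) (uᶠ y k)
            (trans (sym (coeff-tabulate (λ k → u x k - u y k) k)) (U≈0 (toℕ k)))))
          (finToFun-injective {t ℕ.* F} {suc m′} (λ k → equal (vᶠ x k) (vᶠ y k)
            (trans (sym (coeff-tabulate (λ k → v x k - v y k) k)) (V≈0 (toℕ k))))))
          (Finₚ.combine-remQuot {(t ℕ.* G) ^ suc n′} ((t ℕ.* F) ^ suc m′) y)))
        where
        equal : ∀ {a} (i j : Fin a) → + toℕ i - + toℕ j ≡ + 0 → i ≡ j
        equal i j eq = Finₚ.toℕ-injective (ℤₚ.+-injective (ℤₚ.i-j≡0⇒i≡j (+ toℕ i) (+ toℕ j) eq))

      vanish : ∀ i → i ≢ j → coeff (U *ₚ f) (toℕ i) + coeff (V *ₚ g) (toℕ i) ≡ + 0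
      vanish i i≢j = trans
        (cong₂ _+_ (tabulate-*-difference (u x) (u y) f (toℕ i)) (tabulate-*-difference (v x) (v y) g (toℕ i)))
        (trans (rearrange (coeff (tabulate (u x) *ₚ f) (toℕ i)) (coeff (tabulate (u y) *ₚ f) (toℕ i))
            (coeff (tabulate (v x) *ₚ g) (toℕ i)) (coeff (tabulate (v y) *ₚ g) (toℕ i)))
          (ℤₚ.i≡j⇒i-j≡0 (subst (λ k → value x (toℕ k) ≡ value y (toℕ k))
            (Finₚ.punchIn-punchOut (i≢j ∘ sym)) (same (punchOut (i≢j ∘ sym))))))
        where
        open +-*-Solver
        rearrange : ∀ a b c d → (a - b) + (c - d) ≡ (a + c) - (b + d)
        rearrange = solve 4 (λ a b c d → (a :- b) :+ (c :- d) := (a :+ c) :- (b :+ d)) refl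

    -- `U` and `V` are differences of two colliding pairs. The uncontrolled index `j` is a
    -- parameter, since `combination-lower` uses it at the bottom or at the top according to the
    -- size of the point.
    siegel : ∀ f g → (∀ i → ∣ coeff f i ∣ ℕ.≤ F) → (∀ i → ∣ coeff g i ∣ ℕ.≤ G) →
      (j : Fin (suc m′ ℕ.+ suc n′)) → ∃[ U ] ∃[ V ] length U ≡ suc n′ × length V ≡ suc m′ ×
      (∀ i → ∣ coeff U i ∣ ℕ.≤ siegelScale m′ n′ F G ℕ.* G) ×
      (∀ i → ∣ coeff V i ∣ ℕ.≤ siegelScale m′ n′ F G ℕ.* F) ×
      (¬ (U ≈ₚ [] × V ≈ₚ [])) ×
      (∀ i → i ≢ j → coeff (U *ₚ f) (toℕ i) + coeff (V *ₚ g) (toℕ i) ≡ + 0)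
    siegel f g f≤F g≤G j = U , V , Listₚ.length-tabulate (λ k → u x k - u y k) , Listₚ.length-tabulate
        (λ k → v x k - v y k) ,
      coeff-tabulate-≤ (λ k → u x k - u y k) (λ k → difference≤ (uᶠ x k) (uᶠ y k)) ,
      coeff-tabulate-≤ (λ k → v x k - v y k) (λ k → difference≤ (vᶠ x k) (vᶠ y k)) ,
      nonzero , vanish
      where open Tuples f g f≤F g≤G j

-- Homogeneous upper bounds, and the substitute for the resultant.

module Resultant where

  open IntPoly
  open Siegel
  open Rationals
  open Gaussian
  open import Data.Fin.Base using (toℕ; fromℕ<)
  import Data.Fin.Properties as Finₚ
  open import Data.Rational.Base
  open import Data.Rational.Properties
  open import Data.Rational.Solver using (module +-*-Solver)

  import Data.Nat.Solver
  private module ℕS = Data.Nat.Solver.+-*-Solver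

  open ℤ[x]
  open +-*-Solver

  ιᴷ : ℤ → K
  ιᴷ a = real (cast a)

  ιᴷ-+ : ∀ a b → ιᴷ (a ℤ.+ b) ≡ ιᴷ a ⊕ ιᴷ b
  ιᴷ-+ a b = trans (cong real (cast-+ a b)) (real-+ (cast a) (cast b))

  ιᴷ-* : ∀ a b → ιᴷ (a ℤ.* b) ≡ ιᴷ a ⊗ ιᴷ b
  ιᴷ-* a b = trans (cong real (cast-* a b)) (real-* (cast a) (cast b))

  ‖ιᴷ‖ : ∀ a → ‖ ιᴷ a ‖ ≡ ⟨ ℤ.∣ a ∣ ⟩
  ‖ιᴷ‖ a = trans (‖real‖ (cast a)) (∣cast∣ a)

  open Evaluation ℤₚ.+-*-isCommutativeRing isCommutativeRingᴷ ιᴷ (cong real ⟨0⟩) ιᴷ-+ ιᴷ-* public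

  horner-step : ∀ e y q {s ρ W} {A B C : ℕ} → 0ℚ ≤ s → 0ℚ ≤ ρ → 0ℚ ≤ W → ‖ y ‖ ≤ ρ →
    ‖ e ‖ * s ≤ ⟨ A ⟩ * (W * ρ) → ‖ q ‖ * s ≤ ⟨ B ⟩ * W → A ℕ.+ B ℕ.≤ C →
    ‖ e ⊕ (y ⊗ q) ‖ * s ≤ ⟨ C ⟩ * (W * ρ)
  horner-step e y q {s} {ρ} {W} {A} {B} {C} 0≤s 0≤ρ 0≤W y≤ρ e≤ q≤ A+B≤C = begin
    ‖ e ⊕ (y ⊗ q) ‖ * s ≤⟨ *-monoʳ₀ 0≤s (≤-trans (‖⊕‖ e (y ⊗ q)) (+-monoʳ-≤ ‖ e ‖ (‖⊗‖ y q))) ⟩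
    (‖ e ‖ + ‖ y ‖ * ‖ q ‖) * s
      ≡⟨ solve 4 (λ e y q s → (e :+ y :* q) :* s := e :* s :+ y :* (q :* s)) refl (‖ e ‖) (‖ y ‖) (‖ q ‖) s ⟩
    ‖ e ‖ * s + ‖ y ‖ * (‖ q ‖ * s) ≤⟨ +-mono-≤ e≤ (*-mono₀ (0≤‖‖ y) y≤ρ (0≤* (0≤‖‖ q) 0≤s) q≤) ⟩
    ⟨ A ⟩ * (W * ρ) + ρ * (⟨ B ⟩ * W)
      ≡⟨ solve 4 (λ a w r b → a :* (w :* r) :+ r :* (b :* w) := (a :+ b) :* (w :* r)) refl (⟨ A ⟩) W ρ (⟨ B ⟩) ⟩
    (⟨ A ⟩ + ⟨ B ⟩) * (W * ρ) ≡⟨ cong (_* (W * ρ)) (sym (⟨⟩-+ A B)) ⟩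
    ⟨ A ℕ.+ B ⟩ * (W * ρ) ≤⟨ *-monoʳ₀ (0≤* 0≤W 0≤ρ) (⟨⟩-mono A+B≤C) ⟩
    ⟨ C ⟩ * (W * ρ) ∎
    where open ≤-Reasoning

  -- The recurrence behind all the bounds below: for a list of length l the constant is a power of
  -- l, with exponent 1 for the value, 2 for the first difference or derivative, and one more for
  -- each further derivative.
  power-sum : ∀ l k → l ℕ.^ k ℕ.+ l ℕ.^ suc k ℕ.≤ suc l ℕ.^ suc k
  power-sum l k = ℕₚ.*-monoʳ-≤ (suc l) (ℕₚ.^-monoˡ-≤ k (ℕₚ.n≤1+n l))

  module Bounds {ρ : ℚ} (1≤ρ : 1ℚ ≤ ρ) (H : ℕ) where

    0≤ρ : 0ℚ ≤ ρ
    0≤ρ = ≤-trans 0≤1 1≤ρ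

    0<ρ : 0ℚ < ρ
    0<ρ = <-≤-trans 0<1 1≤ρ

    W : ℕ → ℚ
    W l = ⟨ H ⟩ * ρ ↑ l

    0≤W : ∀ l → 0ℚ ≤ W l
    0≤W l = 0≤* (0≤⟨⟩ H) (0≤↑ 0≤ρ l)

    W-suc : ∀ l → W l * ρ ≡ W (suc l)
    W-suc l = solve 3 (λ h r p → h :* p :* r := h :* (r :* p)) refl (⟨ H ⟩) ρ (ρ ↑ l)

    -- Reads ‖z‖ ≤ c H ρ^(l - j) without subtraction in the exponent. A value of a list of length l
    -- has j = 1, a first divided difference j = 2.
    Bounded : ℕ → ℕ → ℕ → K → Set
    Bounded j c l z = ‖ z ‖ * ρ ↑ j ≤ ⟨ c ⟩ * W l

    zero-bounded : ∀ j c l → Bounded j c l 0ᴷ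
    zero-bounded j c l = subst (_≤ ⟨ c ⟩ * W l)
      (sym (trans (cong (_* ρ ↑ j) (‖real‖ 0ℚ)) (*-zeroˡ (ρ ↑ j)))) (0≤* (0≤⟨⟩ c) (0≤W l))

    step : ∀ {j l A B C e y q} → ‖ y ‖ ≤ ρ → Bounded j A (suc l) e → Bounded j B l q →
      A ℕ.+ B ℕ.≤ C → Bounded j C (suc l) (e ⊕ (y ⊗ q))
    step {j} {l} {A} {B} {C} {e} {y} {q} y≤ρ e≤ q≤ le =
      subst (λ w → ‖ e ⊕ (y ⊗ q) ‖ * ρ ↑ j ≤ ⟨ C ⟩ * w) (W-suc l)
        (horner-step e y q {A = A} {B} {C} (0≤↑ 0≤ρ j) 0≤ρ (0≤W l) y≤ρ
          (subst (λ w → ‖ e ‖ * ρ ↑ j ≤ ⟨ A ⟩ * w) (sym (W-suc l)) e≤) q≤ le)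

    raise : ∀ j c l z → Bounded j c l z → Bounded (suc j) c (suc l) z
    raise j c l z z≤ = subst₂ _≤_
      (solve 3 (λ z r p → z :* p :* r := z :* (r :* p)) refl (‖ z ‖) ρ (ρ ↑ j))
      (trans (*-assoc ⟨ c ⟩ (W l) ρ) (cong (⟨ c ⟩ *_) (W-suc l)))
      (*-monoʳ₀ 0≤ρ z≤)

    widen : ∀ j c l z → Bounded j c l z → Bounded j c (suc l) z
    widen j c l z z≤ = ≤-trans z≤ (*-monoˡ₀ (0≤⟨⟩ c) (*-monoˡ₀ (0≤⟨⟩ H)
      (subst (_≤ ρ ↑ suc l) (*-identityˡ (ρ ↑ l)) (*-monoʳ₀ (0≤↑ 0≤ρ l) 1≤ρ))))

    constant : ∀ a l → ℤ.∣ a ∣ ℕ.≤ H → Bounded 1 1 (suc l) (ιᴷ a)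
    constant a l a≤H = begin
      ‖ ιᴷ a ‖ * (ρ * 1ℚ) ≡⟨ cong (_* (ρ * 1ℚ)) (‖ιᴷ‖ a) ⟩
      ⟨ ℤ.∣ a ∣ ⟩ * (ρ * 1ℚ)
        ≤⟨ *-mono₀ (0≤⟨⟩ ℤ.∣ a ∣) (⟨⟩-mono a≤H) (0≤* 0≤ρ 0≤1) (*-monoˡ₀ 0≤ρ (1≤↑ 1≤ρ l)) ⟩
      ⟨ H ⟩ * (ρ * ρ ↑ l) ≡⟨ sym (*-identityˡ _) ⟩
      1ℚ * W (suc l) ≡⟨ cong (_* W (suc l)) (sym ⟨1⟩) ⟩
      ⟨ 1 ⟩ * W (suc l) ∎
      where open ≤-Reasoning

    module _ {x : K} (x≤ρ : ‖ x ‖ ≤ ρ) where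

      ev-bound : ∀ p → (∀ i → ℤ.∣ coeff p i ∣ ℕ.≤ H) → Bounded 1 (length p ℕ.^ 1) (length p) (ev p x)
      ev-bound []      p≤H = zero-bounded 1 0 0
      ev-bound (a ∷ p) p≤H = step {1} {length p} {1} {length p ℕ.^ 1} x≤ρ (constant a (length p) (p≤H 0))
        (ev-bound p (p≤H ∘ suc)) (power-sum (length p) 0)

      quot-bound : ∀ {y} → ‖ y ‖ ≤ ρ → ∀ p → (∀ i → ℤ.∣ coeff p i ∣ ℕ.≤ H) →
        Bounded 2 (length p ℕ.^ 2) (length p) (quot p x y)
      quot-bound y≤ρ []      p≤H = zero-bounded 2 0 0
      quot-bound y≤ρ (a ∷ p) p≤H = step {2} {length p} {length p ℕ.^ 1} {length p ℕ.^ 2} y≤ρ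
        (raise 1 (length p ℕ.^ 1) (length p) (ev p x) (ev-bound p (p≤H ∘ suc)))
        (quot-bound y≤ρ p (p≤H ∘ suc)) (power-sum (length p) 1)

      D¹-bound : ∀ p → (∀ i → ℤ.∣ coeff p i ∣ ℕ.≤ H) → Bounded 2 (length p ℕ.^ 2) (length p) (D¹ p x)
      D¹-bound []      p≤H = zero-bounded 2 0 0
      D¹-bound (a ∷ p) p≤H = step {2} {length p} {length p ℕ.^ 1} {length p ℕ.^ 2} x≤ρ
        (raise 1 (length p ℕ.^ 1) (length p) (ev p x) (ev-bound p (p≤H ∘ suc)))
        (D¹-bound p (p≤H ∘ suc)) (power-sum (length p) 1)

      -- `widen` gives away one power of ρ: the exponent is l - 2, where l - 3 would be the true
      -- order. This is the order that `same-factor` works with.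
      D²-bound : ∀ p → (∀ i → ℤ.∣ coeff p i ∣ ℕ.≤ H) → Bounded 2 (length p ℕ.^ 3) (length p) (D² p x)
      D²-bound []      p≤H = zero-bounded 2 0 0
      D²-bound (a ∷ p) p≤H = step {2} {length p} {length p ℕ.^ 2} {length p ℕ.^ 3} x≤ρ
        (widen 2 (length p ℕ.^ 2) (length p) (D¹ p x) (D¹-bound p (p≤H ∘ suc)))
        (D²-bound p (p≤H ∘ suc)) (power-sum (length p) 2)

      D³-bound : ∀ {u} → ‖ x ⊕ u ‖ ≤ ρ → ∀ p → (∀ i → ℤ.∣ coeff p i ∣ ℕ.≤ H) →
        Bounded 3 (length p ℕ.^ 4) (length p) (D³ p x u)
      D³-bound x+u≤ρ []      p≤H = zero-bounded 3 0 0
      D³-bound {u} x+u≤ρ (a ∷ p) p≤H = step {3} {length p} {length p ℕ.^ 3} {length p ℕ.^ 4} x+u≤ρ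
        (raise 2 (length p ℕ.^ 3) (length p) (D² p x) (D²-bound p (p≤H ∘ suc)))
        (D³-bound {u} x+u≤ρ p (p≤H ∘ suc)) (power-sum (length p) 3)

  monomial : ℕ → ℤ → Poly
  monomial zero    k = k ∷ []
  monomial (suc j) k = + 0 ∷ monomial j k

  coeff-monomial : ∀ j k → coeff (monomial j k) j ≡ k
  coeff-monomial zero    k = refl
  coeff-monomial (suc j) k = coeff-monomial j k

  coeff-monomial-≢ : ∀ j k {i} → i ≢ j → coeff (monomial j k) i ≡ + 0
  coeff-monomial-≢ zero    k {zero}  i≢j = contradiction refl i≢j
  coeff-monomial-≢ zero    k {suc i} i≢j = refl
  coeff-monomial-≢ (suc j) k {zero}  i≢j = refl
  coeff-monomial-≢ (suc j) k {suc i} i≢j = coeff-monomial-≢ j k (i≢j ∘ cong suc)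

  two : ℚ
  two = 1ℚ + 1ℚ

  0≤two : 0ℚ ≤ two
  0≤two = 0≤+ 0≤1 0≤1

  1≤two : 1ℚ ≤ two
  1≤two = ≤-by 1ℚ 0≤1 refl

  -- A nonzero integer has absolute value at least 1, and each factor γ costs a 2 by `‖⊗‖-lower`.
  monomial-lower : ∀ j k γ → k ≢ + 0 → ‖ γ ‖ ↑ j ≤ two ↑ j * ‖ ev (monomial j k) γ ‖
  monomial-lower zero k γ k≢0 = begin
    1ℚ ≡⟨ sym ⟨1⟩ ⟩
    ⟨ 1 ⟩ ≤⟨ ⟨⟩-mono 1≤∣ k≢0 ∣ ⟩
    ⟨ ℤ.∣ k ∣ ⟩ ≡⟨ sym (‖ιᴷ‖ k) ⟩
    ‖ ιᴷ k ‖ ≡⟨ cong ‖_‖ (sym (trans (cong (ιᴷ k ⊕_) (CR.zeroʳ γ)) (CR.+-identityʳ (ιᴷ k)))) ⟩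
    ‖ ιᴷ k ⊕ (γ ⊗ 0ᴷ) ‖ ≡⟨ sym (*-identityˡ _) ⟩
    1ℚ * ‖ ιᴷ k ⊕ (γ ⊗ 0ᴷ) ‖ ∎
    where open ≤-Reasoning
          module CR = Algebra.Structures.IsCommutativeRing isCommutativeRingᴷ
  monomial-lower (suc j) k γ k≢0 = begin
    ‖ γ ‖ * ‖ γ ‖ ↑ j ≤⟨ *-monoˡ₀ (0≤‖‖ γ) (monomial-lower j k γ k≢0) ⟩
    ‖ γ ‖ * (two ↑ j * ‖ e ‖)
      ≡⟨ solve 3 (λ g t e → g :* (t :* e) := t :* (g :* e)) refl (‖ γ ‖) (two ↑ j) (‖ e ‖) ⟩
    two ↑ j * (‖ γ ‖ * ‖ e ‖) ≤⟨ *-monoˡ₀ (0≤↑ 0≤two j) (‖⊗‖-lower γ e) ⟩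
    two ↑ j * (‖ γ ⊗ e ‖ + ‖ γ ⊗ e ‖)
      ≡⟨ solve 2 (λ t z → t :* (z :+ z) := (con two :* t) :* z) refl (two ↑ j) (‖ γ ⊗ e ‖) ⟩
    two ↑ suc j * ‖ γ ⊗ e ‖ ≡⟨ cong (λ z → two ↑ suc j * ‖ z ‖) (sym (ev-0∷ (monomial j k) γ)) ⟩
    two ↑ suc j * ‖ ev (monomial (suc j) k) γ ‖ ∎
    where open ≤-Reasoning
          e : K
          e = ev (monomial j k) γ

  -- Injectivity of the Sylvester map (U, V) ↦ U f + V g: the non-vanishing of the resultant, stated
  -- without a determinant.
  Independent : ℕ → ℕ → Poly → Poly → Set
  Independent m n f g = ∀ U V → length U ≡ n → length V ≡ m →
    (∀ i → coeff (U *ₚ f) i ℤ.+ coeff (V *ₚ g) i ≡ + 0) → U ≈ₚ [] × V ≈ₚ []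

  module _ (m′ n′ F G : ℕ) (1≤F : 1 ℕ.≤ F) (1≤G : 1 ℕ.≤ G) where

    private
      m n N t e : ℕ
      m = suc m′
      n = suc n′
      e = m′ ℕ.+ n
      N = m ℕ.+ n
      t = siegelScale m′ n′ F G

    module _ (f g : Poly) (f≤F : ∀ i → ℤ.∣ coeff f i ∣ ℕ.≤ F) (g≤G : ∀ i → ℤ.∣ coeff g i ∣ ℕ.≤ G)
      (f< : Below f (suc m)) (g< : Below g (suc n)) (independent : Independent m n f g) where

      module Combination (U V : Poly) (lenU : length U ≡ n) (lenV : length V ≡ m)
        (nonzero : ¬ (U ≈ₚ [] × V ≈ₚ [])) (j : ℕ) (vanish : ∀ i → i ℕ.< N → i ≢ j →
          coeff (U *ₚ f) i ℤ.+ coeff (V *ₚ g) i ≡ + 0) where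

        w : ℕ → ℤ
        w i = coeff (U *ₚ f) i ℤ.+ coeff (V *ₚ g) i

        vanish′ : ∀ i → i ≢ j → w i ≡ + 0
        vanish′ i i≢j with i ℕₚ.<? N
        ... | yes i<N = vanish i i<N i≢j
        ... | no i≮N = cong₂ ℤ._+_
          (*ₚ-above U f (λ i n≤i → coeff-length U (subst (ℕ._≤ i) (sym lenU) n≤i)) f< i
            (subst (ℕ._≤ i) (ℕₚ.+-comm m n) (ℕₚ.≮⇒≥ i≮N)))
          (*ₚ-above V g (λ i m≤i → coeff-length V (subst (ℕ._≤ i) (sym lenV) m≤i)) g< i (ℕₚ.≮⇒≥ i≮N))

        k≢0 : w j ≢ + 0
        k≢0 k≡0 = nonzero (independent U V lenU lenV vanishes)
          where
          vanishes : ∀ i → w i ≡ + 0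
          vanishes i with i ℕₚ.≟ j
          ... | yes refl = k≡0
          ... | no  i≢j  = vanish′ i i≢j

        W≈ : (U *ₚ f) +ₚ (V *ₚ g) ≈ₚ monomial j (w j)
        W≈ i with i ℕₚ.≟ j
        ... | yes refl = trans (coeff-+ (U *ₚ f) (V *ₚ g) i) (sym (coeff-monomial i (w i)))
        ... | no  i≢j  = trans (coeff-+ (U *ₚ f) (V *ₚ g) i)
          (trans (vanish′ i i≢j) (sym (coeff-monomial-≢ j (w j) i≢j)))

      combination : ∀ j → j ℕ.< N → ∃[ U ] ∃[ V ] ∃[ k ] length U ≡ n × length V ≡ m ×
        (∀ i → ℤ.∣ coeff U i ∣ ℕ.≤ t ℕ.* G) × (∀ i → ℤ.∣ coeff V i ∣ ℕ.≤ t ℕ.* F) ×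
        k ≢ + 0 × (U *ₚ f) +ₚ (V *ₚ g) ≈ₚ monomial j k
      combination j j<N = build (siegel m′ n′ F G 1≤F 1≤G f g f≤F g≤G (fromℕ< j<N))
        where
        vanishing : ∀ U V → (∀ i → i ≢ fromℕ< j<N → coeff (U *ₚ f) (toℕ i) ℤ.+ coeff (V *ₚ g) (toℕ i) ≡ + 0) →
          ∀ i → i ℕ.< N → i ≢ j → coeff (U *ₚ f) i ℤ.+ coeff (V *ₚ g) i ≡ + 0
        vanishing U V vanish i i<N i≢j =
          subst (λ i → coeff (U *ₚ f) i ℤ.+ coeff (V *ₚ g) i ≡ + 0) (Finₚ.toℕ-fromℕ< i<N)
            (vanish (fromℕ< i<N) λ eq → i≢j (trans (sym (Finₚ.toℕ-fromℕ< i<N))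
              (trans (cong toℕ eq) (Finₚ.toℕ-fromℕ< j<N))))
        build : _ → _
        build (U , V , lenU , lenV , U≤ , V≤ , nonzero , vanish) =
          U , V , w j , lenU , lenV , U≤ , V≤ , k≢0 , W≈
          where open Combination U V lenU lenV nonzero j (vanishing U V vanish)

      -- For μ = 1 the surviving monomial is the constant one, for μ = ‖γ‖ the one of top degree e.
      -- Either way its value is at least μ^e up to 2^e, so the lower bound is homogeneous for small
      -- and large γ alike.
      combination-lower : ∀ γ {μ} → 1ℚ ≤ μ → μ ≡ 1ℚ ⊎ μ ≡ ‖ γ ‖ → ∃[ U ] ∃[ V ]
        length U ≡ n × length V ≡ m ×
        (∀ i → ℤ.∣ coeff U i ∣ ℕ.≤ t ℕ.* G) × (∀ i → ℤ.∣ coeff V i ∣ ℕ.≤ t ℕ.* F) ×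
        μ ↑ e ≤ two ↑ e * (‖ ev U γ ‖ * ‖ ev f γ ‖ + ‖ ev V γ ‖ * ‖ ev g γ ‖)
      combination-lower γ {μ} 1≤μ μ-choice = choose μ-choice
        where
        open ≤-Reasoning
        Goal : Set
        Goal = ∃[ U ] ∃[ V ] length U ≡ n × length V ≡ m ×
          (∀ i → ℤ.∣ coeff U i ∣ ℕ.≤ t ℕ.* G) × (∀ i → ℤ.∣ coeff V i ∣ ℕ.≤ t ℕ.* F) ×
          μ ↑ e ≤ two ↑ e * (‖ ev U γ ‖ * ‖ ev f γ ‖ + ‖ ev V γ ‖ * ‖ ev g γ ‖)

        finish : ∀ j → (∀ k → k ≢ + 0 → μ ↑ e ≤ two ↑ e * ‖ ev (monomial j k) γ ‖) →
          (∃[ U ] ∃[ V ] ∃[ k ] length U ≡ n × length V ≡ m ×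
          (∀ i → ℤ.∣ coeff U i ∣ ℕ.≤ t ℕ.* G) × (∀ i → ℤ.∣ coeff V i ∣ ℕ.≤ t ℕ.* F) ×
          k ≢ + 0 × (U *ₚ f) +ₚ (V *ₚ g) ≈ₚ monomial j k) → Goal
        finish j lower (U , V , k , lenU , lenV , U≤ , V≤ , k≢0 , W≈) =
          U , V , lenU , lenV , U≤ , V≤ , (begin
            μ ↑ e ≤⟨ lower k k≢0 ⟩
            two ↑ e * ‖ ev (monomial j k) γ ‖ ≡⟨ cong (λ z → two ↑ e * ‖ z ‖) eq ⟩
            two ↑ e * ‖ (ev U γ ⊗ ev f γ) ⊕ (ev V γ ⊗ ev g γ) ‖
              ≤⟨ *-monoˡ₀ (0≤↑ 0≤two e) (≤-trans (‖⊕‖ (ev U γ ⊗ ev f γ) (ev V γ ⊗ ev g γ))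
                   (+-mono-≤ (‖⊗‖ (ev U γ) (ev f γ)) (‖⊗‖ (ev V γ) (ev g γ)))) ⟩
            two ↑ e * (‖ ev U γ ‖ * ‖ ev f γ ‖ + ‖ ev V γ ‖ * ‖ ev g γ ‖) ∎)
          where
          eq : ev (monomial j k) γ ≡ (ev U γ ⊗ ev f γ) ⊕ (ev V γ ⊗ ev g γ)
          eq = trans (sym (ev-≈ ((U *ₚ f) +ₚ (V *ₚ g)) (monomial j k) γ W≈))
            (trans (ev-+ (U *ₚ f) (V *ₚ g) γ) (cong₂ _⊕_ (ev-* U f γ) (ev-* V g γ)))

        choose : μ ≡ 1ℚ ⊎ μ ≡ ‖ γ ‖ → Goal
        choose (inj₁ refl) = finish 0 (λ k k≢0 → begin
            1ℚ ↑ e ≡⟨ 1↑ e ⟩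
            1ℚ ≤⟨ monomial-lower 0 k γ k≢0 ⟩
            1ℚ * ‖ ev (monomial 0 k) γ ‖ ≤⟨ *-monoʳ₀ (0≤‖‖ (ev (monomial 0 k) γ)) (1≤↑ 1≤two e) ⟩
            two ↑ e * ‖ ev (monomial 0 k) γ ‖ ∎) (combination 0 (s≤s z≤n))
        choose (inj₂ refl) = finish e (λ k k≢0 → monomial-lower e k γ k≢0) (combination e ℕₚ.≤-refl)

      -- Depends on the heights, but only ever multiplies the error η, which is chosen once the
      -- polynomials are fixed.
      lossFactor : ℚ
      lossFactor = two ↑ e * (⟨ n ⟩ * ⟨ t ℕ.* G ⟩ + ⟨ m ⟩ * ⟨ t ℕ.* F ⟩)

      -- U(γ) and V(γ) are of order μ^(n - 1) and μ^(m - 1); against the μ^m and μ^n of the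
      -- hypotheses this makes μ^e throughout, which cancels with `combination-lower`. The weight
      -- `w` serves both cases: w = 1, v = ‖u‖ for distinct minimal polynomials, and w = ‖u‖, v =
      -- ‖u‖³ for a common one, where the values are known to be small only after multiplication by
      -- ‖u‖.
      resultant-bound : ∀ γ {μ w η v} c → 1ℚ ≤ μ → ‖ γ ‖ ≤ μ → μ ≡ 1ℚ ⊎ μ ≡ ‖ γ ‖ →
        0ℚ ≤ w →
        ‖ ev f γ ‖ * w ≤ (η + ⟨ c ℕ.* F ⟩ * v) * μ ↑ m →
        ‖ ev g γ ‖ * w ≤ (η + ⟨ c ℕ.* G ⟩ * v) * μ ↑ n →
        w ≤ lossFactor * η + two ↑ e * ⟨ N ℕ.* c ℕ.* (t ℕ.* (F ℕ.* G)) ⟩ * v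
      resultant-bound γ {μ} {w} {η} {v} c 1≤μ γ≤μ μ-choice 0≤w f≤ g≤ =
        conclude (combination-lower γ 1≤μ μ-choice)
        where
        open ≤-Reasoning
        a b P T : ℚ
        a = ⟨ n ⟩ * ⟨ t ℕ.* G ⟩
        b = ⟨ m ⟩ * ⟨ t ℕ.* F ⟩
        P = μ ↑ e
        T = two ↑ e
        0<P : 0ℚ < P
        0<P = 0<↑ (<-≤-trans 0<1 1≤μ) e

        value≤ : ∀ U {l A} → length U ≡ suc l → (∀ i → ℤ.∣ coeff U i ∣ ℕ.≤ A) →
          ‖ ev U γ ‖ ≤ ⟨ suc l ⟩ * ⟨ A ⟩ * μ ↑ l
        value≤ U {l} {A} lenU U≤ = *-cancelʳ₀ (<-≤-trans 0<1 1≤μ) (begin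
          ‖ ev U γ ‖ * μ ≡⟨ cong (‖ ev U γ ‖ *_) (sym (*-identityʳ μ)) ⟩
          ‖ ev U γ ‖ * (μ * 1ℚ) ≤⟨ Bounds.ev-bound 1≤μ A γ≤μ U U≤ ⟩
          ⟨ length U ℕ.* 1 ⟩ * (⟨ A ⟩ * μ ↑ length U)
            ≡⟨ cong₂ (λ x y → ⟨ x ⟩ * (⟨ A ⟩ * μ ↑ y)) (trans (ℕₚ.*-identityʳ (length U)) lenU) lenU ⟩
          ⟨ suc l ⟩ * (⟨ A ⟩ * (μ * μ ↑ l))
            ≡⟨ solve 4 (λ s a u p → s :* (a :* (u :* p)) := s :* a :* p :* u) refl (⟨ suc l ⟩) (⟨ A ⟩) μ
                (μ ↑ l) ⟩
          ⟨ suc l ⟩ * ⟨ A ⟩ * μ ↑ l * μ ∎)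

        part : ∀ (x y z C Q : ℚ) l → 0ℚ ≤ y → 0ℚ ≤ x → x ≤ C * μ ↑ l →
          y ≤ (η + z * v) * Q → μ ↑ l * Q ≡ P → x * y ≤ (C * η + C * z * v) * P
        part x y z C Q l 0≤y 0≤x x≤ y≤ eq = begin
          x * y ≤⟨ *-mono₀ 0≤x x≤ 0≤y y≤ ⟩
          C * μ ↑ l * ((η + z * v) * Q)
            ≡⟨ solve 6 (λ C R h z v Q → C :* R :* ((h :+ z :* v) :* Q) := (C :* h :+ C :* z :* v) :*
                (R :* Q)) refl C (μ ↑ l) η z v Q ⟩
          (C * η + C * z * v) * (μ ↑ l * Q) ≡⟨ cong ((C * η + C * z * v) *_) eq ⟩
          (C * η + C * z * v) * P ∎

        conclude : _ → w ≤ lossFactor * η + T * ⟨ N ℕ.* c ℕ.* (t ℕ.* (F ℕ.* G)) ⟩ * v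
        conclude (U , V , lenU , lenV , U≤ , V≤ , lower) = *-cancelʳ₀ 0<P (begin
          w * P
            ≤⟨ *-monoˡ₀ 0≤w lower ⟩
          w * (T * (‖ ev U γ ‖ * ‖ ev f γ ‖ + ‖ ev V γ ‖ * ‖ ev g γ ‖))
            ≡⟨ solve 6 (λ w T x f y g → w :* (T :* (x :* f :+ y :* g)) := T :* (x :* (f :* w) :+ y :* (g :* w)))
                 refl w T (‖ ev U γ ‖) (‖ ev f γ ‖) (‖ ev V γ ‖) (‖ ev g γ ‖) ⟩
          T * (‖ ev U γ ‖ * (‖ ev f γ ‖ * w) + ‖ ev V γ ‖ * (‖ ev g γ ‖ * w))
            ≤⟨ *-monoˡ₀ (0≤↑ 0≤two e) (+-mono-≤
                 (part (‖ ev U γ ‖) (‖ ev f γ ‖ * w) ⟨ c ℕ.* F ⟩ a (μ ↑ m) n′ (0≤* (0≤‖‖ (ev f γ)) 0≤w)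
                     (0≤‖‖ (ev U γ))
                   (value≤ U lenU U≤) f≤
                   (trans (sym (↑-+ μ n′ m)) (cong (μ ↑_) n′+m≡e)))
                 (part (‖ ev V γ ‖) (‖ ev g γ ‖ * w) ⟨ c ℕ.* G ⟩ b (μ ↑ n) m′ (0≤* (0≤‖‖ (ev g γ)) 0≤w)
                     (0≤‖‖ (ev V γ))
                   (value≤ V lenV V≤) g≤ (sym (↑-+ μ m′ n)))) ⟩
          T * ((a * η + a * ⟨ c ℕ.* F ⟩ * v) * P + (b * η + b * ⟨ c ℕ.* G ⟩ * v) * P)
            ≡⟨ solve 8 (λ T a b h v P x y → T :* ((a :* h :+ a :* x :* v) :* P :+ (b :* h :+ b :* y :* v) :* P)
                 := (T :* (a :+ b) :* h :+ T :* (a :* x :+ b :* y) :* v) :* P) refl T a b η v P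
                     (⟨ c ℕ.* F ⟩) (⟨ c ℕ.* G ⟩) ⟩
          (lossFactor * η + T * (a * ⟨ c ℕ.* F ⟩ + b * ⟨ c ℕ.* G ⟩) * v) * P
            ≡⟨ cong (λ z → (lossFactor * η + T * z * v) * P) collect ⟩
          (lossFactor * η + T * ⟨ N ℕ.* c ℕ.* (t ℕ.* (F ℕ.* G)) ⟩ * v) * P ∎)
          where
          n′+m≡e : n′ ℕ.+ m ≡ e
          n′+m≡e = trans (ℕₚ.+-suc n′ m′) (trans (cong suc (ℕₚ.+-comm n′ m′)) (sym (ℕₚ.+-suc m′ n′)))
          collect : a * ⟨ c ℕ.* F ⟩ + b * ⟨ c ℕ.* G ⟩ ≡ ⟨ N ℕ.* c ℕ.* (t ℕ.* (F ℕ.* G)) ⟩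
          collect = trans (cong₂ _+_
            (trans (cong (_* ⟨ c ℕ.* F ⟩) (sym (⟨⟩-* n (t ℕ.* G)))) (sym (⟨⟩-* (n ℕ.* (t ℕ.* G)) (c ℕ.* F))))
            (trans (cong (_* ⟨ c ℕ.* G ⟩) (sym (⟨⟩-* m (t ℕ.* F)))) (sym (⟨⟩-* (m ℕ.* (t ℕ.* F)) (c ℕ.* G)))))
            (trans (sym (⟨⟩-+ (n ℕ.* (t ℕ.* G) ℕ.* (c ℕ.* F)) (m ℕ.* (t ℕ.* F) ℕ.* (c ℕ.* G))))
              (cong ⟨_⟩ (ℕS.solve 6 (λ n m t F G c →
                n ℕS.:* (t ℕS.:* G) ℕS.:* (c ℕS.:* F) ℕS.:+ m ℕS.:* (t ℕS.:* F) ℕS.:* (c ℕS.:* G)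
                ℕS.:= (m ℕS.:+ n) ℕS.:* c ℕS.:* (t ℕS.:* (F ℕS.:* G))) refl n m t F G c)))

-- A ring solver for the Gaussian rationals with integer coefficients.

module GaussianSolver where

  open Rationals
  open Gaussian
  open Resultant using (ιᴷ; ιᴷ-+; ιᴷ-*)
  import Algebra.Solver.Ring as RingSolver
  open import Algebra.Solver.Ring.AlmostCommutativeRing using (fromCommutativeRing; _-Raw-AlmostCommutative⟶_)
  open import Relation.Binary.Consequences using (dec⇒weaklyDec)
  import Data.Maybe.Base as Maybe
  open import Level using (0ℓ)

  ringᴷ : CommutativeRing 0ℓ 0ℓ
  ringᴷ = record { isCommutativeRing = isCommutativeRingᴷ }

  open CommutativeRing ringᴷ public
    using () renaming (+-assoc to ⊕-assoc; +-comm to ⊕-comm; +-identityˡ to ⊕-identityˡ;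
      +-identityʳ to ⊕-identityʳ; -‿inverseʳ to ⊖-inverseʳ; zeroʳ to ⊗-zeroʳ; zeroˡ to ⊗-zeroˡ)

  morphism : ℤ.+-*-rawRing -Raw-AlmostCommutative⟶ fromCommutativeRing ringᴷ
  morphism = record
    { ⟦_⟧    = ιᴷ
    ; +-homo = ιᴷ-+
    ; *-homo = ιᴷ-*
    ; -‿homo = λ a → trans (cong real (cast-neg a)) (real-neg (cast a))
    ; 0-homo = cong real ⟨0⟩
    ; 1-homo = cong real ⟨1⟩
    }

  module K-Solver = RingSolver ℤ.+-*-rawRing (fromCommutativeRing ringᴷ) morphism
    (λ a b → Maybe.map (cong ιᴷ) (dec⇒weaklyDec ℤₚ._≟_ a b))

-- The two main estimates: distinct factors, and one common factor.

module Cases where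

  open IntPoly
  open Siegel
  open Rationals
  open Gaussian
  open Resultant
  open GaussianSolver
  import Data.Nat.Solver
  open import Data.Rational.Base hiding (truncate)
  open import Data.Rational.Properties
  open import Data.Rational.Solver using (module +-*-Solver)

  private
    module ℕS = Data.Nat.Solver.+-*-Solver
    module KS = K-Solver

  open ℤ[x]
  open +-*-Solver

  max1 : ∀ x → ∃[ μ ] 1ℚ ≤ μ × x ≤ μ × (μ ≡ 1ℚ ⊎ μ ≡ x)
  max1 x with ≤-total x 1ℚ
  ... | inj₁ x≤1 = 1ℚ , ≤-refl , x≤1 , inj₁ refl
  ... | inj₂ 1≤x = x , 1≤x , ≤-refl , inj₂ refl

  module Settle {μ : ℚ} (1≤μ : 1ℚ ≤ μ) (H : ℕ) where

    0≤μ : 0ℚ ≤ μ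
    0≤μ = ≤-trans 0≤1 1≤μ

    -- Twice μ leaves room for the neighbouring point: ‖x + u‖ ≤ μ + 1 ≤ 2μ whenever ‖u‖ ≤ 1. The
    -- resulting powers of 2 go into `settleConstant`.
    ρ : ℚ
    ρ = two * μ

    μ≤ρ : μ ≤ ρ
    μ≤ρ = ≤-by μ 0≤μ (solve 1 (λ μ → (con 1ℚ :+ con 1ℚ) :* μ := μ :+ μ) refl μ)

    μ+1≤ρ : μ + 1ℚ ≤ ρ
    μ+1≤ρ = ≤-trans (+-monoʳ-≤ μ 1≤μ) (≤-reflexive (solve 1 (λ μ → μ :+ μ := (con 1ℚ :+ con 1ℚ) :* μ) refl μ))

    1≤ρ : 1ℚ ≤ ρ
    1≤ρ = ≤-trans 1≤μ μ≤ρ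

    open Bounds 1≤ρ H public

    lower : ∀ j c l z → Bounded (suc j) c (suc l) z → Bounded j c l z
    lower j c l z z≤ = *-cancelʳ₀ 0<ρ (subst₂ _≤_
      (solve 3 (λ z r p → z :* (r :* p) := z :* p :* r) refl (‖ z ‖) ρ (ρ ↑ j))
      (trans (cong (⟨ c ⟩ *_) (sym (W-suc l))) (sym (*-assoc ⟨ c ⟩ (W l) ρ)))
      z≤)

    settleConstant : ℕ → ℕ → ℕ
    settleConstant c l = c ℕ.* (2 ℕ.^ l) ℕ.* H

    settled : ∀ c l → ⟨ c ⟩ * W l ≡ ⟨ settleConstant c l ⟩ * μ ↑ l
    settled c l = begin
      ⟨ c ⟩ * (⟨ H ⟩ * (two * μ) ↑ l) ≡⟨ cong (λ p → ⟨ c ⟩ * (⟨ H ⟩ * p)) (↑-* two μ l) ⟩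
      ⟨ c ⟩ * (⟨ H ⟩ * (two ↑ l * μ ↑ l))
        ≡⟨ solve 4 (λ c h t p → c :* (h :* (t :* p)) := c :* t :* h :* p) refl (⟨ c ⟩) (⟨ H ⟩) (two ↑ l)
            (μ ↑ l) ⟩
      ⟨ c ⟩ * two ↑ l * ⟨ H ⟩ * μ ↑ l ≡⟨ cong (λ t → ⟨ c ⟩ * t ↑ l * ⟨ H ⟩ * μ ↑ l) (sym ⟨2⟩) ⟩
      ⟨ c ⟩ * ⟨ 2 ⟩ ↑ l * ⟨ H ⟩ * μ ↑ l ≡⟨ cong (λ t → ⟨ c ⟩ * t * ⟨ H ⟩ * μ ↑ l) (sym (⟨⟩-^ 2 l)) ⟩
      ⟨ c ⟩ * ⟨ 2 ℕ.^ l ⟩ * ⟨ H ⟩ * μ ↑ l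
        ≡⟨ cong (λ t → t * ⟨ H ⟩ * μ ↑ l) (sym (⟨⟩-* c (2 ℕ.^ l))) ⟩
      ⟨ c ℕ.* 2 ℕ.^ l ⟩ * ⟨ H ⟩ * μ ↑ l ≡⟨ cong (_* μ ↑ l) (sym (⟨⟩-* (c ℕ.* 2 ℕ.^ l) H)) ⟩
      ⟨ settleConstant c l ⟩ * μ ↑ l ∎
      where
      open ≡-Reasoning
      ⟨2⟩ : ⟨ 2 ⟩ ≡ two
      ⟨2⟩ = trans (⟨⟩-+ 1 1) (cong₂ _+_ ⟨1⟩ ⟨1⟩)

    settle₀ : ∀ c l z → Bounded 0 c l z → ‖ z ‖ ≤ ⟨ settleConstant c l ⟩ * μ ↑ l
    settle₀ c l z z≤ = subst₂ _≤_ (*-identityʳ ‖ z ‖) (settled c l) z≤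

    settle₁ : ∀ c l z → Bounded 1 c l z → ‖ z ‖ * μ ≤ ⟨ settleConstant c l ⟩ * μ ↑ l
    settle₁ c l z z≤ = ≤-trans
      (*-monoˡ₀ (0≤‖‖ z) (≤-trans μ≤ρ (≤-reflexive (sym (*-identityʳ ρ)))))
      (≤-trans z≤ (≤-reflexive (settled c l)))

    drop-μ : ∀ z {b} → ‖ z ‖ * μ ≤ b → ‖ z ‖ ≤ b
    drop-μ z {b} z≤ = ≤-trans (subst (_≤ ‖ z ‖ * μ) (*-identityʳ ‖ z ‖) (*-monoˡ₀ (0≤‖‖ z) 1≤μ)) z≤

  -- The factor m + n comes from `resultant-bound`; (n + 1)² 2ⁿ bounds the divided difference of
  -- `g`, a list of length n + 1, at ρ = 2μ.
  distinctConstant : ℕ → ℕ → ℕ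
  distinctConstant m′ n′ = (suc m′ ℕ.+ suc n′) ℕ.* (suc (suc n′) ℕ.^ 2 ℕ.* 2 ℕ.^ suc n′)

  module _ (m′ n′ : ℕ) (f g : Poly) (deg-f : Degree (suc m′) f) (deg-g : Degree (suc n′) g)
    (independent : Independent (suc m′) (suc n′) f g) where

    private
      m n c F G t : ℕ
      m = suc m′
      n = suc n′
      c = suc n ℕ.^ 2 ℕ.* 2 ℕ.^ n
      F = height f
      G = height g
      t = siegelScale m′ n′ F G

    distinctLoss : ℚ
    distinctLoss = lossFactor m′ n′ F G (1≤height f deg-f) (1≤height g deg-g) f g
      (coeff≤height f) (coeff≤height g) (below deg-f) (below deg-g) independent

    distinct-factors : ∀ a u η → ‖ u ‖ ≤ 1ℚ → 0ℚ ≤ η → ‖ ev f a ‖ ≤ η → ‖ ev g (a ⊕ u) ‖ ≤ η →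
      1ℚ ≤ distinctLoss * η +
        two ↑ (m′ ℕ.+ n) * ⟨ distinctConstant m′ n′ ℕ.* (siegelScale m′ n′ F G ℕ.* (F ℕ.* G)) ⟩ * ‖ u ‖
    distinct-factors a u η u≤1 0≤η fa≤η gb≤η with max1 ‖ a ‖
    ... | μ , 1≤μ , a≤μ , μ-choice = resultant-bound m′ n′ F G (1≤height f deg-f) (1≤height g deg-g) f g
      (coeff≤height f) (coeff≤height g) (below deg-f) (below deg-g) independent
      a c 1≤μ a≤μ μ-choice 0≤1 f≤ g≤
      where
      open Settle 1≤μ G
      open ≤-Reasoning
      Q : K
      Q = quot g a (a ⊕ u)
      Q≤ : ‖ Q ‖ ≤ ⟨ c ℕ.* G ⟩ * μ ↑ n
      Q≤ = drop-μ Q (settle₁ (suc n ℕ.^ 2) n Q (lower 1 (suc n ℕ.^ 2) n Q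
        (subst (λ l → Bounded 2 (l ℕ.^ 2) l Q) (len deg-g)
          (quot-bound (≤-trans a≤μ μ≤ρ)
            (≤-trans (‖⊕‖ a u) (≤-trans (+-mono-≤ a≤μ u≤1) μ+1≤ρ)) g (coeff≤height g)))))
      η≤ : ∀ l → η ≤ η * μ ↑ l
      η≤ l = subst (_≤ η * μ ↑ l) (*-identityʳ η) (*-monoˡ₀ 0≤η (1≤↑ 1≤μ l))
      f≤ : ‖ ev f a ‖ * 1ℚ ≤ (η + ⟨ c ℕ.* F ⟩ * ‖ u ‖) * μ ↑ m
      f≤ = begin
        ‖ ev f a ‖ * 1ℚ ≡⟨ *-identityʳ _ ⟩
        ‖ ev f a ‖ ≤⟨ fa≤η ⟩
        η ≤⟨ η≤ m ⟩
        η * μ ↑ m ≤⟨ *-monoʳ₀ (0≤↑ 0≤μ m) (p≤p+q η (0≤* (0≤⟨⟩ (c ℕ.* F)) (0≤‖‖ u))) ⟩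
        (η + ⟨ c ℕ.* F ⟩ * ‖ u ‖) * μ ↑ m ∎
      ga≡ : ev g a ≡ ev g (a ⊕ u) ⊕ (⊖ (u ⊗ Q))
      ga≡ = trans (KS.solve 2 (λ x y → x KS.:= (x KS.:+ y) KS.:+ (KS.:- y)) refl (ev g a) (u ⊗ Q))
        (cong (_⊕ (⊖ (u ⊗ Q))) (sym (ev-quot g a u)))
      g≤ : ‖ ev g a ‖ * 1ℚ ≤ (η + ⟨ c ℕ.* G ⟩ * ‖ u ‖) * μ ↑ n
      g≤ = begin
        ‖ ev g a ‖ * 1ℚ ≡⟨ *-identityʳ _ ⟩
        ‖ ev g a ‖ ≡⟨ cong ‖_‖ ga≡ ⟩
        ‖ ev g (a ⊕ u) ⊕ (⊖ (u ⊗ Q)) ‖ ≤⟨ ‖⊕‖ _ _ ⟩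
        ‖ ev g (a ⊕ u) ‖ + ‖ ⊖ (u ⊗ Q) ‖ ≡⟨ cong (_+_ (‖ ev g (a ⊕ u) ‖)) (‖⊖‖ (u ⊗ Q)) ⟩
        ‖ ev g (a ⊕ u) ‖ + ‖ u ⊗ Q ‖
          ≤⟨ +-mono-≤ (≤-trans gb≤η (η≤ n)) (≤-trans (‖⊗‖ u Q) (*-monoˡ₀ (0≤‖‖ u) Q≤)) ⟩
        η * μ ↑ n + ‖ u ‖ * (⟨ c ℕ.* G ⟩ * μ ↑ n)
          ≡⟨ solve 4 (λ h p u c → h :* p :+ u :* (c :* p) := (h :+ c :* u) :* p) refl η (μ ↑ n) (‖ u ‖)
              (⟨ c ℕ.* G ⟩) ⟩
        (η + ⟨ c ℕ.* G ⟩ * ‖ u ‖) * μ ↑ n ∎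

  coeff-deriv : ∀ p i → coeff (deriv p) i ≡ + suc i ℤ.* coeff p (suc i)
  coeff-deriv []      i = sym (ℤₚ.*-zeroʳ (+ suc i))
  coeff-deriv (a ∷ p) zero = trans (coeff-+ p (+ 0 ∷ deriv p) 0)
    (trans (ℤₚ.+-identityʳ _) (sym (ℤₚ.*-identityˡ _)))
  coeff-deriv (a ∷ p) (suc i) = trans (coeff-+ p (+ 0 ∷ deriv p) (suc i))
    (trans (cong (ℤ._+_ (coeff p (suc i))) (coeff-deriv p i))
      (sym (ℤₚ.suc-* (+ suc i) (coeff p (suc i)))))

  -- k q − x q′, the second partial derivative of the binary form of degree k of q.
  coderiv : ℕ → Poly → Poly
  coderiv k q = map (+ k ℤ.*_) q +ₚ (+ 0 ∷ map (ℤ.-1ℤ ℤ.*_) (deriv q))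

  coeff-coderiv-zero : ∀ k q → coeff (coderiv k q) 0 ≡ + k ℤ.* coeff q 0
  coeff-coderiv-zero k q = trans (coeff-+ (map (+ k ℤ.*_) q) _ 0)
    (trans (ℤₚ.+-identityʳ _) (coeff-map (+ k) q 0))

  coeff-coderiv-suc : ∀ k q i →
    coeff (coderiv k q) (suc i) ≡ + k ℤ.* coeff q (suc i) ℤ.- + suc i ℤ.* coeff q (suc i)
  coeff-coderiv-suc k q i = trans (coeff-+ (map (+ k ℤ.*_) q) _ (suc i))
    (cong₂ ℤ._+_ (coeff-map (+ k) q (suc i))
      (trans (coeff-map ℤ.-1ℤ (deriv q) i) (trans (ℤₚ.-1*i≡-i _) (cong ℤ.-_ (coeff-deriv q i)))))

  module _ {k : ℕ} (q : Poly) (deg : Degree (suc k) q) where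

    private
      H : ℕ
      H = height q
      K₁ : ℕ
      K₁ = suc k

    deriv-below : Below (deriv q) K₁
    deriv-below i k<i = trans (coeff-deriv q i)
      (trans (cong (+ suc i ℤ.*_) (below deg (suc i) (s≤s k<i))) (ℤₚ.*-zeroʳ (+ suc i)))

    coderiv-below : Below (coderiv K₁ q) K₁
    coderiv-below (suc i) (s≤s k≤i) with ℕₚ.m≤n⇒m<n∨m≡n k≤i
    -- The leading terms of k q and x q′ cancel, which brings the second partial derivative down to
    -- the degree of the first.
    ... | inj₂ refl = trans (coeff-coderiv-suc K₁ q k) (ℤₚ.+-inverseʳ (+ K₁ ℤ.* coeff q K₁))
    ... | inj₁ k<i = trans (coeff-coderiv-suc K₁ q i) (trans
      (cong (λ x → + K₁ ℤ.* x ℤ.- + suc i ℤ.* x) (below deg (suc i) (s≤s k<i)))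
      (cong₂ ℤ._-_ (ℤₚ.*-zeroʳ (+ K₁)) (ℤₚ.*-zeroʳ (+ suc i))))

    term≤ : ∀ i j → i ℕ.≤ K₁ → ℤ.∣ + i ℤ.* coeff q j ∣ ℕ.≤ K₁ ℕ.* H
    term≤ i j i≤ = subst (ℕ._≤ K₁ ℕ.* H) (sym (ℤₚ.abs-* (+ i) (coeff q j)))
      (ℕₚ.*-mono-≤ i≤ (coeff≤height q j))

    deriv-≤ : ∀ i → ℤ.∣ coeff (truncate K₁ (deriv q)) i ∣ ℕ.≤ 2 ℕ.* (K₁ ℕ.* H)
    deriv-≤ i with i ℕₚ.<? K₁
    ... | yes i<k = subst (λ x → ℤ.∣ x ∣ ℕ.≤ 2 ℕ.* (K₁ ℕ.* H))
      (sym (trans (truncate-≈ K₁ (deriv q) deriv-below i) (coeff-deriv q i)))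
      (ℕₚ.≤-trans (term≤ (suc i) (suc i) i<k) (ℕₚ.m≤n*m (K₁ ℕ.* H) 2))
    ... | no i≮k = subst (λ x → ℤ.∣ x ∣ ℕ.≤ 2 ℕ.* (K₁ ℕ.* H))
      (sym (trans (truncate-≈ K₁ (deriv q) deriv-below i) (deriv-below i (ℕₚ.≮⇒≥ i≮k)))) z≤n

    coderiv-≤ : ∀ i → ℤ.∣ coeff (truncate K₁ (coderiv K₁ q)) i ∣ ℕ.≤ 2 ℕ.* (K₁ ℕ.* H)
    coderiv-≤ i = subst (λ x → ℤ.∣ x ∣ ℕ.≤ 2 ℕ.* (K₁ ℕ.* H))
      (sym (truncate-≈ K₁ (coderiv K₁ q) coderiv-below i)) (bound i)
      where
      bound : ∀ i → ℤ.∣ coeff (coderiv K₁ q) i ∣ ℕ.≤ 2 ℕ.* (K₁ ℕ.* H)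
      bound zero = subst (λ x → ℤ.∣ x ∣ ℕ.≤ 2 ℕ.* (K₁ ℕ.* H)) (sym (coeff-coderiv-zero K₁ q))
        (ℕₚ.≤-trans (term≤ K₁ 0 ℕₚ.≤-refl) (ℕₚ.m≤n*m (K₁ ℕ.* H) 2))
      bound (suc i) with suc i ℕₚ.<? K₁
      ... | yes i<k = subst (λ x → ℤ.∣ x ∣ ℕ.≤ 2 ℕ.* (K₁ ℕ.* H)) (sym (coeff-coderiv-suc K₁ q i))
        (ℕₚ.≤-trans (ℤₚ.∣i-j∣≤∣i∣+∣j∣ (+ K₁ ℤ.* coeff q (suc i)) (+ suc i ℤ.* coeff q (suc i)))
          (ℕₚ.≤-trans (ℕₚ.+-mono-≤ (term≤ K₁ (suc i) ℕₚ.≤-refl) (term≤ (suc i) (suc i) (ℕₚ.<⇒≤ i<k)))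
            (ℕₚ.≤-reflexive (cong (ℕ._+_ (K₁ ℕ.* H)) (sym (ℕₚ.+-identityʳ (K₁ ℕ.* H)))))))
      ... | no i≮k = subst (λ x → ℤ.∣ x ∣ ℕ.≤ 2 ℕ.* (K₁ ℕ.* H))
        (sym (coderiv-below (suc i) (ℕₚ.≮⇒≥ i≮k))) z≤n

    ev-truncate-deriv : ∀ x → ev (truncate K₁ (deriv q)) x ≡ D¹ q x
    ev-truncate-deriv x = trans
      (ev-≈ (truncate K₁ (deriv q)) (deriv q) x (truncate-≈ K₁ (deriv q) deriv-below)) (ev-deriv q x)

    ev-truncate-coderiv : ∀ x → ev (truncate K₁ (coderiv K₁ q)) x ≡ (ιᴷ (+ K₁) ⊗ ev q x) ⊕ (⊖ (x ⊗ D¹ q x))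
    ev-truncate-coderiv x = trans
      (ev-≈ (truncate K₁ (coderiv K₁ q)) (coderiv K₁ q) x (truncate-≈ K₁ (coderiv K₁ q) coderiv-below))
      (trans (ev-+ (map (+ K₁ ℤ.*_) q) (+ 0 ∷ map (ℤ.-1ℤ ℤ.*_) (deriv q)) x)
        (cong₂ _⊕_ (ev-map (+ K₁) q x)
          (trans (ev-0∷ (map (ℤ.-1ℤ ℤ.*_) (deriv q)) x) (trans (cong (x ⊗_)
            (trans (ev-map ℤ.-1ℤ (deriv q) x) (cong (ιᴷ ℤ.-1ℤ ⊗_) (ev-deriv q x))))
            (KS.solve 2 (λ x y → x KS.:* (KS.con ℤ.-1ℤ KS.:* y) KS.:= KS.:- (x KS.:* y)) refl x (D¹ q x))))))

  double-cancel : ∀ {a b} → a + a ≤ b + b → a ≤ b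
  double-cancel {a} {b} le = *-cancelˡ₀ {two} (<-≤-trans 0<1 1≤two) (subst₂ _≤_
    (solve 1 (λ a → a :+ a := (con 1ℚ :+ con 1ℚ) :* a) refl a)
    (solve 1 (λ a → a :+ a := (con 1ℚ :+ con 1ℚ) :* a) refl b) le)

  module _ (q : Poly) (x u : K) where

    private
      d₀ d₁ d₂ d₃ d₃′ qa qb : K
      d₀ = ev q x
      d₁ = D¹ q x
      d₂ = D² q x
      d₃ = D³ q x u
      d₃′ = D³ q x (⊖ u)
      qa = ev q (x ⊕ u)
      qb = ev q (x ⊕ (⊖ u))
      d : ℚ
      d = ‖ u ‖
      0≤d : 0ℚ ≤ d
      0≤d = 0≤‖‖ u

    open ≤-Reasoning

    -- In q(x + u) - q(x - u) the even terms drop out. When both values are almost zero, u q′(x) is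
    -- therefore of third order in u, which is the gain from expanding at the midpoint.
    odd-part : (u ⊗ d₁) ⊕ (u ⊗ d₁) ≡ (qa ⊕ (⊖ qb)) ⊕ (⊖ (u ⊗ (u ⊗ (u ⊗ (d₃ ⊕ d₃′)))))
    odd-part = trans (KS.solve 6 (λ u d₀ d₁ d₂ d₃ d₃′ →
        u KS.:* d₁ KS.:+ u KS.:* d₁ KS.:=
        ((d₀ KS.:+ u KS.:* (d₁ KS.:+ u KS.:* (d₂ KS.:+ u KS.:* d₃))) KS.:+
          (KS.:- (d₀ KS.:+ (KS.:- u) KS.:* (d₁ KS.:+ (KS.:- u) KS.:* (d₂ KS.:+ (KS.:- u) KS.:* d₃′)))))
        KS.:+ (KS.:- (u KS.:* (u KS.:* (u KS.:* (d₃ KS.:+ d₃′)))))) refl u d₀ d₁ d₂ d₃ d₃′)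
      (cong₂ (λ a b → (a ⊕ (⊖ b)) ⊕ (⊖ (u ⊗ (u ⊗ (u ⊗ (d₃ ⊕ d₃′)))))) (sym (taylor q x u))
          (sym (taylor q x (⊖ u))))

    -- In q(x + u) + q(x - u) the term u q′(x) drops out, so that q(x) is of second order in u.
    even-part : d₀ ⊕ d₀ ≡ (qa ⊕ qb) ⊕ (⊖ (u ⊗ (u ⊗ ((d₂ ⊕ d₂) ⊕ (u ⊗ (d₃ ⊕ (⊖ d₃′)))))))
    even-part = trans (KS.solve 6 (λ u d₀ d₁ d₂ d₃ d₃′ →
        d₀ KS.:+ d₀ KS.:=
        ((d₀ KS.:+ u KS.:* (d₁ KS.:+ u KS.:* (d₂ KS.:+ u KS.:* d₃))) KS.:+
          (d₀ KS.:+ (KS.:- u) KS.:* (d₁ KS.:+ (KS.:- u) KS.:* (d₂ KS.:+ (KS.:- u) KS.:* d₃′))))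
        KS.:+ (KS.:- (u KS.:* (u KS.:* ((d₂ KS.:+ d₂) KS.:+ u KS.:* (d₃ KS.:+ (KS.:- d₃′))))))) refl u
            d₀ d₁ d₂ d₃ d₃′)
      (cong₂ (λ a b → (a ⊕ b) ⊕ (⊖ (u ⊗ (u ⊗ ((d₂ ⊕ d₂) ⊕ (u ⊗ (d₃ ⊕ (⊖ d₃′)))))))) (sym (taylor q x u))
          (sym (taylor q x (⊖ u))))

    ‖⊖‖-sum : ∀ y z → ‖ y ⊕ (⊖ z) ‖ ≤ ‖ y ‖ + ‖ z ‖
    ‖⊖‖-sum y z = ≤-trans (‖⊕‖ y (⊖ z)) (≤-reflexive (cong (_+_ (‖ y ‖)) (‖⊖‖ z)))

    first-derivative-bound : ∀ {η} → ‖ qa ‖ ≤ η → ‖ qb ‖ ≤ η →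
      d * ‖ d₁ ‖ ≤ η + η + d * d * d * (‖ d₃ ‖ + ‖ d₃′ ‖)
    first-derivative-bound {η} qa≤ qb≤ = begin
      d * ‖ d₁ ‖ ≤⟨ ‖⊗‖-lower u d₁ ⟩
      ‖ u ⊗ d₁ ‖ + ‖ u ⊗ d₁ ‖ ≡⟨ sym (‖x⊕x‖ (u ⊗ d₁)) ⟩
      ‖ (u ⊗ d₁) ⊕ (u ⊗ d₁) ‖ ≡⟨ cong ‖_‖ odd-part ⟩
      ‖ (qa ⊕ (⊖ qb)) ⊕ (⊖ (u ⊗ (u ⊗ (u ⊗ (d₃ ⊕ d₃′))))) ‖
        ≤⟨ ‖⊖‖-sum (qa ⊕ (⊖ qb)) (u ⊗ (u ⊗ (u ⊗ (d₃ ⊕ d₃′)))) ⟩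
      ‖ qa ⊕ (⊖ qb) ‖ + ‖ u ⊗ (u ⊗ (u ⊗ (d₃ ⊕ d₃′))) ‖
        ≤⟨ +-mono-≤ (≤-trans (‖⊖‖-sum qa qb) (+-mono-≤ qa≤ qb≤))
             (≤-trans (‖⊗‖ u _) (*-monoˡ₀ 0≤d (≤-trans (‖⊗‖ u _) (*-monoˡ₀ 0≤d
               (≤-trans (‖⊗‖ u _) (*-monoˡ₀ 0≤d (‖⊕‖ d₃ d₃′))))))) ⟩
      η + η + d * (d * (d * (‖ d₃ ‖ + ‖ d₃′ ‖)))
        ≡⟨ solve 3 (λ h d y → h :+ d :* (d :* (d :* y)) := h :+ d :* d :* d :* y) refl (η + η) d
            (‖ d₃ ‖ + ‖ d₃′ ‖) ⟩
      η + η + d * d * d * (‖ d₃ ‖ + ‖ d₃′ ‖) ∎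

    value-bound : ∀ {η} → d ≤ 1ℚ → ‖ qa ‖ ≤ η → ‖ qb ‖ ≤ η →
      ‖ d₀ ‖ + ‖ d₀ ‖ ≤ η + η + d * d * (‖ d₂ ‖ + ‖ d₂ ‖ + (‖ d₃ ‖ + ‖ d₃′ ‖))
    value-bound {η} d≤1 qa≤ qb≤ = begin
      ‖ d₀ ‖ + ‖ d₀ ‖ ≡⟨ sym (‖x⊕x‖ d₀) ⟩
      ‖ d₀ ⊕ d₀ ‖ ≡⟨ cong ‖_‖ even-part ⟩
      ‖ (qa ⊕ qb) ⊕ (⊖ (u ⊗ (u ⊗ ((d₂ ⊕ d₂) ⊕ (u ⊗ (d₃ ⊕ (⊖ d₃′))))))) ‖
        ≤⟨ ‖⊖‖-sum (qa ⊕ qb) (u ⊗ (u ⊗ ((d₂ ⊕ d₂) ⊕ (u ⊗ (d₃ ⊕ (⊖ d₃′)))))) ⟩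
      ‖ qa ⊕ qb ‖ + ‖ u ⊗ (u ⊗ ((d₂ ⊕ d₂) ⊕ (u ⊗ (d₃ ⊕ (⊖ d₃′))))) ‖
        ≤⟨ +-mono-≤ (≤-trans (‖⊕‖ qa qb) (+-mono-≤ qa≤ qb≤))
             (≤-trans (‖⊗‖ u _) (*-monoˡ₀ 0≤d (≤-trans (‖⊗‖ u _) (*-monoˡ₀ 0≤d
               (≤-trans (‖⊕‖ (d₂ ⊕ d₂) (u ⊗ (d₃ ⊕ (⊖ d₃′)))) (+-mono-≤ (‖⊕‖ d₂ d₂)
                 (≤-trans (‖⊗‖ u _) (≤-trans (*-mono₀ 0≤d d≤1 (0≤‖‖ (d₃ ⊕ (⊖ d₃′))) (‖⊖‖-sum d₃ d₃′))
                   (≤-reflexive (*-identityˡ (‖ d₃ ‖ + ‖ d₃′ ‖)))))))))))  ⟩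
      η + η + d * (d * (‖ d₂ ‖ + ‖ d₂ ‖ + (‖ d₃ ‖ + ‖ d₃′ ‖)))
        ≡⟨ cong (_+_ (η + η)) (sym (*-assoc d d _)) ⟩
      η + η + d * d * (‖ d₂ ‖ + ‖ d₂ ‖ + (‖ d₃ ‖ + ‖ d₃′ ‖)) ∎

  -- With k the degree of `q`: the fourth power of k + 1 and the power of 2 bound `D³` at ρ = 2μ,
  -- the factor 2(k + 1) comes from k q - x q′, and the first factor from `resultant-bound`.
  sameConstant : ℕ → ℕ
  sameConstant m′ = (suc m′ ℕ.+ suc m′) ℕ.*
    (2 ℕ.* suc (suc (suc m′)) ℕ.* (suc (suc (suc m′)) ℕ.^ 4 ℕ.* 2 ℕ.^ suc m′))

  module _ (m′ : ℕ) (q : Poly) (deg : Degree (suc (suc m′)) q) where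

    private
      m k H F C c B : ℕ
      m = suc m′
      k = suc m
      H = height q
      F = 2 ℕ.* (k ℕ.* H)
      C = suc k ℕ.^ 4
      c = 2 ℕ.* suc k ℕ.* (C ℕ.* 2 ℕ.^ m)
      B = C ℕ.* 2 ℕ.^ m ℕ.* H

      f g : Poly
      f = truncate k (deriv q)
      g = truncate k (coderiv k q)

      1≤F : 1 ℕ.≤ F
      1≤F = ℕₚ.*-mono-≤ {1} {2} (s≤s z≤n) (ℕₚ.*-mono-≤ {1} {k} (s≤s z≤n) (1≤height q deg))

      f< : Below f (suc m)
      f< i k≤i = coeff-length f (subst (ℕ._≤ i) (sym (length-truncate k (deriv q))) k≤i)

      g< : Below g (suc m)
      g< i k≤i = coeff-length g (subst (ℕ._≤ i) (sym (length-truncate k (coderiv k q))) k≤i)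

    module _ (independent : Independent m m f g) where

      sameLoss : ℚ
      sameLoss = lossFactor m′ m′ F F 1≤F 1≤F f g (deriv-≤ q deg) (coderiv-≤ q deg) f< g< independent

      -- Both partial derivatives are of second order at the midpoint x. The estimate keeps the
      -- weight ‖u‖ on the left, since dividing `first-derivative-bound` by ‖u‖ would divide the
      -- error η as well.
      same-factor : ∀ x u η → ‖ u ‖ ≤ 1ℚ → 0ℚ ≤ η →
        ‖ ev q (x ⊕ u) ‖ ≤ η → ‖ ev q (x ⊕ (⊖ u)) ‖ ≤ η →
        ‖ u ‖ ≤ sameLoss * (⟨ k ℕ.+ 2 ⟩ * η) +
          two ↑ (m′ ℕ.+ m) * ⟨ sameConstant m′ ℕ.* (siegelScale m′ m′ F F ℕ.* (F ℕ.* F)) ⟩ *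
          (‖ u ‖ * ‖ u ‖ * ‖ u ‖)
      same-factor x u η u≤1 0≤η qa≤ qb≤ with max1 ‖ x ‖
      ... | μ , 1≤μ , x≤μ , μ-choice = resultant-bound m′ m′ F F 1≤F 1≤F f g
        (deriv-≤ q deg) (coderiv-≤ q deg) f< g< independent
        x c 1≤μ x≤μ μ-choice 0≤d f≤ g≤
        where
        open Settle 1≤μ H
        open ≤-Reasoning
        d v B̂ M y₃ y₃′ : ℚ
        d = ‖ u ‖
        v = d * d * d
        M = μ ↑ m
        B̂ = ⟨ B ⟩ * M
        y₃ = ‖ D³ q x u ‖
        y₃′ = ‖ D³ q x (⊖ u) ‖
        0≤d : 0ℚ ≤ d
        0≤d = 0≤‖‖ u
        0≤v : 0ℚ ≤ v
        0≤v = 0≤* (0≤* 0≤d 0≤d) 0≤d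
        0≤M : 0ℚ ≤ M
        0≤M = 0≤↑ 0≤μ m
        x≤ρ : ‖ x ‖ ≤ ρ
        x≤ρ = ≤-trans x≤μ μ≤ρ
        shifted≤ρ : ∀ w → ‖ w ‖ ≤ 1ℚ → ‖ x ⊕ w ‖ ≤ ρ
        shifted≤ρ w w≤1 = ≤-trans (‖⊕‖ x w) (≤-trans (+-mono-≤ x≤μ w≤1) μ+1≤ρ)
        -- The spare factor μ is spent on the x in x q′(x).
        D³≤ : ∀ w → ‖ w ‖ ≤ 1ℚ → ‖ D³ q x w ‖ * μ ≤ B̂
        D³≤ w w≤1 = settle₁ C m (D³ q x w) (lower 1 C m (D³ q x w) (lower 2 C (suc m) (D³ q x w)
          (subst (λ l → Bounded 3 (l ℕ.^ 4) l (D³ q x w)) (len deg)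
            (D³-bound x≤ρ {w} (shifted≤ρ w w≤1) q (coeff≤height q)))))
        y₃≤ : y₃ * μ ≤ B̂
        y₃≤ = D³≤ u u≤1
        y₃′≤ : y₃′ * μ ≤ B̂
        y₃′≤ = D³≤ (⊖ u) (subst (_≤ 1ℚ) (sym (‖⊖‖ u)) u≤1)
        y₂≤ : ‖ D² q x ‖ ≤ B̂
        y₂≤ = ≤-trans (settle₀ (suc k ℕ.^ 3) m (D² q x)
            (lower 0 (suc k ℕ.^ 3) m (D² q x) (lower 1 (suc k ℕ.^ 3) (suc m) (D² q x)
            (subst (λ l → Bounded 2 (l ℕ.^ 3) l (D² q x)) (len deg)
              (D²-bound x≤ρ q (coeff≤height q))))))
          (*-monoʳ₀ 0≤M (⟨⟩-mono {settleConstant (suc k ℕ.^ 3) m} {B}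
              (ℕₚ.*-monoˡ-≤ H (ℕₚ.*-monoˡ-≤ (2 ℕ.^ m) cube≤C))))
          where
          cube≤C : suc k ℕ.^ 3 ℕ.≤ C
          cube≤C = ℕₚ.^-monoʳ-≤ (suc k) {3} {4} (ℕₚ.n≤1+n 3)
        μ≤M : μ ≤ M
        μ≤M = subst (_≤ M) (*-identityʳ μ) (*-monoˡ₀ 0≤μ (1≤↑ 1≤μ m′))
        1≤M : 1ℚ ≤ M
        1≤M = 1≤↑ 1≤μ m

        D¹≤ : ‖ D¹ q x ‖ * d ≤ η + η + v * (y₃ + y₃′)
        D¹≤ = subst (_≤ η + η + v * (y₃ + y₃′)) (*-comm d (‖ D¹ q x ‖)) (first-derivative-bound q x u qa≤ qb≤)

        ev≤ : ‖ ev q x ‖ * d ≤ η + v * (B̂ + B̂)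
        ev≤ = double-cancel (begin
          ‖ ev q x ‖ * d + ‖ ev q x ‖ * d
            ≡⟨ solve 2 (λ e d → e :* d :+ e :* d := d :* (e :+ e)) refl (‖ ev q x ‖) d ⟩
          d * (‖ ev q x ‖ + ‖ ev q x ‖)
            ≤⟨ *-monoˡ₀ 0≤d (value-bound q x u u≤1 qa≤ qb≤) ⟩
          d * (η + η + d * d * (‖ D² q x ‖ + ‖ D² q x ‖ + (y₃ + y₃′)))
            ≡⟨ solve 3 (λ d h y → d :* (h :+ d :* d :* y) := d :* h :+ d :* d :* d :* y) refl d (η + η)
                (‖ D² q x ‖ + ‖ D² q x ‖ + (y₃ + y₃′)) ⟩
          d * (η + η) + v * (‖ D² q x ‖ + ‖ D² q x ‖ + (y₃ + y₃′))
            ≤⟨ +-mono-≤ (*-monoʳ₀ (0≤+ 0≤η 0≤η) u≤1) (*-monoˡ₀ 0≤v (+-mono-≤ (+-mono-≤ y₂≤ y₂≤)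
                 (+-mono-≤ (drop-μ (D³ q x u) y₃≤) (drop-μ (D³ q x (⊖ u)) y₃′≤)))) ⟩
          1ℚ * (η + η) + v * (B̂ + B̂ + (B̂ + B̂))
            ≡⟨ solve 3 (λ h v b → con 1ℚ :* (h :+ h) :+ v :* (b :+ b :+ (b :+ b)) :=
                (h :+ v :* (b :+ b)) :+ (h :+ v :* (b :+ b))) refl η v B̂ ⟩
          (η + v * (B̂ + B̂)) + (η + v * (B̂ + B̂)) ∎)

        constant≤ : ∀ j → j ℕ.≤ k → (⟨ j ⟩ + 1ℚ) * (B̂ + B̂) ≤ ⟨ c ℕ.* F ⟩ * M
        constant≤ j j≤k = begin
          (⟨ j ⟩ + 1ℚ) * (⟨ B ⟩ * M + ⟨ B ⟩ * M)
            ≡⟨ cong (λ o → (⟨ j ⟩ + o) * (⟨ B ⟩ * M + ⟨ B ⟩ * M)) (sym ⟨1⟩) ⟩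
          (⟨ j ⟩ + ⟨ 1 ⟩) * (⟨ B ⟩ * M + ⟨ B ⟩ * M)
            ≡⟨ solve 3 (λ j b m → j :* (b :* m :+ b :* m) := j :* (b :+ b) :* m) refl (⟨ j ⟩ + ⟨ 1 ⟩)
                (⟨ B ⟩) M ⟩
          (⟨ j ⟩ + ⟨ 1 ⟩) * (⟨ B ⟩ + ⟨ B ⟩) * M
            ≡⟨ cong (_* M) (trans (cong₂ _*_ (sym (⟨⟩-+ j 1)) (sym (⟨⟩-+ B B)))
                (sym (⟨⟩-* (j ℕ.+ 1) (B ℕ.+ B)))) ⟩
          ⟨ (j ℕ.+ 1) ℕ.* (B ℕ.+ B) ⟩ * M
            ≤⟨ *-monoʳ₀ 0≤M (⟨⟩-mono {(j ℕ.+ 1) ℕ.* (B ℕ.+ B)} {c ℕ.* F} (ℕₚ.≤-trans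
                 (ℕₚ.*-monoˡ-≤ (B ℕ.+ B) {j ℕ.+ 1} {suc k} (ℕₚ.≤-trans (ℕₚ.+-monoˡ-≤ 1 j≤k)
                     (ℕₚ.≤-reflexive (ℕₚ.+-comm k 1))))
                 (ℕₚ.≤-trans
                   (ℕₚ.≤-reflexive (ℕS.solve 3 (λ s w h →
                     s ℕS.:* (w ℕS.:* h ℕS.:+ w ℕS.:* h) ℕS.:= ℕS.con 2 ℕS.:* s ℕS.:* w ℕS.:* h)
                     refl (suc k) (C ℕ.* 2 ℕ.^ m) H))
                   (ℕₚ.*-monoʳ-≤ c (ℕₚ.≤-trans (ℕₚ.m≤n*m H k) (ℕₚ.m≤n*m (k ℕ.* H) 2)))))) ⟩
          ⟨ c ℕ.* F ⟩ * M ∎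

        -- Used with j = 0 for q′ and with j = k for k q - x q′. The latter collects k errors η from
        -- q(x) and two from q′(x), hence k + 2.
        finish : ∀ j → j ℕ.≤ k → (⟨ j ⟩ + two) * (η * M) + v * ((⟨ j ⟩ + 1ℚ) * (B̂ + B̂)) ≤
          (⟨ k ℕ.+ 2 ⟩ * η + ⟨ c ℕ.* F ⟩ * v) * M
        finish j j≤k = begin
          (⟨ j ⟩ + two) * (η * M) + v * ((⟨ j ⟩ + 1ℚ) * (B̂ + B̂))
            ≤⟨ +-mono-≤ (*-monoʳ₀ (0≤* 0≤η 0≤M) (subst (⟨ j ⟩ + two ≤_) (sym (trans (⟨⟩-+ k 2)
                 (cong (_+_ (⟨ k ⟩)) (trans (⟨⟩-+ 1 1) (cong₂ _+_ ⟨1⟩ ⟨1⟩))))) (+-monoˡ-≤ two (⟨⟩-mono j≤k))))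
               (*-monoˡ₀ 0≤v (constant≤ j j≤k)) ⟩
          ⟨ k ℕ.+ 2 ⟩ * (η * M) + v * (⟨ c ℕ.* F ⟩ * M)
            ≡⟨ solve 5 (λ k h m v c → k :* (h :* m) :+ v :* (c :* m) := (k :* h :+ c :* v) :* m) refl
                (⟨ k ℕ.+ 2 ⟩) η M v (⟨ c ℕ.* F ⟩) ⟩
          (⟨ k ℕ.+ 2 ⟩ * η + ⟨ c ℕ.* F ⟩ * v) * M ∎

        f≤ : ‖ ev f x ‖ * d ≤ (⟨ k ℕ.+ 2 ⟩ * η + ⟨ c ℕ.* F ⟩ * v) * M
        f≤ = begin
          ‖ ev f x ‖ * d ≡⟨ cong (λ z → ‖ z ‖ * d) (ev-truncate-deriv q deg x) ⟩
          ‖ D¹ q x ‖ * d ≤⟨ D¹≤ ⟩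
          η + η + v * (y₃ + y₃′)
            ≤⟨ +-mono-≤ (*-mono₂ η≤ηM) (*-monoˡ₀ 0≤v (+-mono-≤ (drop-μ (D³ q x u) y₃≤)
                (drop-μ (D³ q x (⊖ u)) y₃′≤))) ⟩
          η * M + η * M + v * (B̂ + B̂)
            ≡⟨ solve 3 (λ h v b → h :+ h :+ v :* b := (con 0ℚ :+ (con 1ℚ :+ con 1ℚ)) :* h :+ v :*
                ((con 0ℚ :+ con 1ℚ) :* b)) refl (η * M) v (B̂ + B̂) ⟩
          (0ℚ + two) * (η * M) + v * ((0ℚ + 1ℚ) * (B̂ + B̂))
            ≡⟨ cong (λ o → (o + two) * (η * M) + v * ((o + 1ℚ) * (B̂ + B̂))) (sym ⟨0⟩) ⟩
          (⟨ 0 ⟩ + two) * (η * M) + v * ((⟨ 0 ⟩ + 1ℚ) * (B̂ + B̂)) ≤⟨ finish 0 z≤n ⟩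
          (⟨ k ℕ.+ 2 ⟩ * η + ⟨ c ℕ.* F ⟩ * v) * M ∎
          where
          η≤ηM : η ≤ η * M
          η≤ηM = subst (_≤ η * M) (*-identityʳ η) (*-monoˡ₀ 0≤η 1≤M)
          *-mono₂ : ∀ {a b} → a ≤ b → a + a ≤ b + b
          *-mono₂ le = +-mono-≤ le le

        g≤ : ‖ ev g x ‖ * d ≤ (⟨ k ℕ.+ 2 ⟩ * η + ⟨ c ℕ.* F ⟩ * v) * M
        g≤ = begin
          ‖ ev g x ‖ * d
            ≡⟨ cong (λ z → ‖ z ‖ * d) (ev-truncate-coderiv q deg x) ⟩
          ‖ (ιᴷ (+ k) ⊗ ev q x) ⊕ (⊖ (x ⊗ D¹ q x)) ‖ * d
            ≤⟨ *-monoʳ₀ 0≤d (≤-trans (‖⊖‖-sum q x u (ιᴷ (+ k) ⊗ ev q x) (x ⊗ D¹ q x))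
                 (+-mono-≤ (≤-trans (‖⊗‖ (ιᴷ (+ k)) (ev q x)) (≤-reflexive (cong (_* ‖ ev q x ‖) (‖ιᴷ‖ (+ k)))))
                   (≤-trans (‖⊗‖ x (D¹ q x)) (*-monoʳ₀ (0≤‖‖ (D¹ q x)) x≤μ)))) ⟩
          (⟨ k ⟩ * ‖ ev q x ‖ + μ * ‖ D¹ q x ‖) * d
            ≡⟨ solve 5 (λ k e m f d → (k :* e :+ m :* f) :* d := k :* (e :* d) :+ m :* (f :* d)) refl
                (⟨ k ⟩) (‖ ev q x ‖) μ (‖ D¹ q x ‖) d ⟩
          ⟨ k ⟩ * (‖ ev q x ‖ * d) + μ * (‖ D¹ q x ‖ * d)
            ≤⟨ +-mono-≤ (*-monoˡ₀ (0≤⟨⟩ k) ev≤) (*-monoˡ₀ 0≤μ D¹≤) ⟩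
          ⟨ k ⟩ * (η + v * (B̂ + B̂)) + μ * (η + η + v * (y₃ + y₃′))
            ≡⟨ solve 7 (λ k h v b m y y′ → k :* (h :+ v :* b) :+ m :* (h :+ h :+ v :* (y :+ y′))
                 := k :* (h :* con 1ℚ) :+ k :* (v :* b) :+ ((con 1ℚ :+ con 1ℚ) :* (h :* m) :+ v :*
                     (y :* m :+ y′ :* m)))
                 refl (⟨ k ⟩) η v (B̂ + B̂) μ y₃ y₃′ ⟩
          ⟨ k ⟩ * (η * 1ℚ) + ⟨ k ⟩ * (v * (B̂ + B̂)) + (two * (η * μ) + v * (y₃ * μ + y₃′ * μ))
            ≤⟨ +-mono-≤ (+-monoˡ-≤ (⟨ k ⟩ * (v * (B̂ + B̂))) (*-monoˡ₀ (0≤⟨⟩ k) (*-monoˡ₀ 0≤η 1≤M)))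
                 (+-mono-≤ (*-monoˡ₀ 0≤two (*-monoˡ₀ 0≤η μ≤M)) (*-monoˡ₀ 0≤v (+-mono-≤ y₃≤ y₃′≤))) ⟩
          ⟨ k ⟩ * (η * M) + ⟨ k ⟩ * (v * (B̂ + B̂)) + (two * (η * M) + v * (B̂ + B̂))
            ≡⟨ solve 5 (λ k h v b t → k :* h :+ k :* (v :* b) :+ (t :* h :+ v :* b)
                 := (k :+ t) :* h :+ v :* ((k :+ con 1ℚ) :* b)) refl (⟨ k ⟩) (η * M) v (B̂ + B̂) two ⟩
          (⟨ k ⟩ + two) * (η * M) + v * ((⟨ k ⟩ + 1ℚ) * (B̂ + B̂)) ≤⟨ finish k ℕₚ.≤-refl ⟩
          (⟨ k ℕ.+ 2 ⟩ * η + ⟨ c ℕ.* F ⟩ * v) * M ∎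

      0≤sameLoss : 0ℚ ≤ sameLoss
      0≤sameLoss = 0≤* (0≤↑ 0≤two (m′ ℕ.+ m)) (0≤+
        (0≤* (0≤⟨⟩ m) (0≤⟨⟩ (siegelScale m′ m′ F F ℕ.* F))) (0≤* (0≤⟨⟩ m) (0≤⟨⟩ (siegelScale m′ m′ F F ℕ.* F))))

-- Polynomials near an integer root of a linear factor.

module Linear where

  open IntPoly
  open Gelfond using (evℤ)
  open Rationals
  open Gaussian
  open Resultant
  open GaussianSolver
  open Cases
  open import Data.Rational.Base hiding (truncate)
  open import Data.Rational.Properties
  open import Data.Rational.Solver using (module +-*-Solver)

  open ℤ[x]
  open +-*-Solver
  private module KS = K-Solver

  ev-ιᴷ : ∀ p b → ev p (ιᴷ b) ≡ ιᴷ (evℤ p b)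
  ev-ιᴷ []      b = cong real (sym ⟨0⟩)
  ev-ιᴷ (a ∷ p) b = trans (cong (λ e → ιᴷ a ⊕ (ιᴷ b ⊗ e)) (ev-ιᴷ p b))
    (trans (cong (ιᴷ a ⊕_) (sym (ιᴷ-* b (evℤ p b)))) (sym (ιᴷ-+ a (b ℤ.* evℤ p b))))

  integer-value-bound : ∀ f b u {η Q} → evℤ f b ≢ + 0 → ‖ ev f (ιᴷ b ⊕ u) ‖ ≤ η →
    ‖ quot f (ιᴷ b) (ιᴷ b ⊕ u) ‖ ≤ Q → 1ℚ ≤ η + Q * ‖ u ‖
  integer-value-bound f b u {η} {Q} fb≢0 fa≤η q≤Q = begin
    1ℚ ≡⟨ sym ⟨1⟩ ⟩
    ⟨ 1 ⟩ ≤⟨ ⟨⟩-mono 1≤∣ fb≢0 ∣ ⟩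
    ⟨ ℤ.∣ evℤ f b ∣ ⟩ ≡⟨ sym (‖ιᴷ‖ (evℤ f b)) ⟩
    ‖ ιᴷ (evℤ f b) ‖ ≡⟨ cong ‖_‖ (sym (ev-ιᴷ f b)) ⟩
    ‖ ev f (ιᴷ b) ‖                    ≡⟨ cong ‖_‖ (trans
        (KS.solve 2 (λ x y → x KS.:= (x KS.:+ y) KS.:+ (KS.:- y)) refl (ev f (ιᴷ b)) (u ⊗ q))
        (cong (_⊕ (⊖ (u ⊗ q))) (sym (ev-quot f (ιᴷ b) u)))) ⟩
    ‖ ev f (ιᴷ b ⊕ u) ⊕ (⊖ (u ⊗ q)) ‖ ≤⟨ ‖⊕‖ _ _ ⟩
    ‖ ev f (ιᴷ b ⊕ u) ‖ + ‖ ⊖ (u ⊗ q) ‖ ≡⟨ cong (_+_ (‖ ev f (ιᴷ b ⊕ u) ‖)) (‖⊖‖ (u ⊗ q)) ⟩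
    ‖ ev f (ιᴷ b ⊕ u) ‖ + ‖ u ⊗ q ‖ ≤⟨ +-mono-≤ fa≤η (≤-trans (‖⊗‖ u q) (*-monoˡ₀ (0≤‖‖ u) q≤Q)) ⟩
    η + ‖ u ‖ * Q ≡⟨ cong (_+_ η) (*-comm (‖ u ‖) Q) ⟩
    η + Q * ‖ u ‖ ∎
    where
    open ≤-Reasoning
    q : K
    q = quot f (ιᴷ b) (ιᴷ b ⊕ u)

  linearConstant : ℕ → ℕ
  linearConstant m′ = suc (suc m′) ℕ.^ 2 ℕ.* 2 ℕ.^ m′

  -- With ‖b‖ ≤ G the divided difference of `f` is of order F G^(m - 1), one power of G better than
  -- the general estimate F Gᵐ for n = 1. The saving matters because beside a linear factor m can be
  -- d - 1.
  linear-factor : ∀ m′ f → Degree (suc m′) f → ∀ b G u η → ℤ.∣ b ∣ ℕ.≤ G → 1 ℕ.≤ G →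
    evℤ f b ≢ + 0 → ‖ u ‖ ≤ 1ℚ → ‖ ev f (ιᴷ b ⊕ u) ‖ ≤ η →
    1ℚ ≤ η + ⟨ linearConstant m′ ℕ.* height f ℕ.* G ℕ.^ m′ ⟩ * ‖ u ‖
  linear-factor m′ f deg b G u η b≤G 1≤G fb≢0 u≤1 fa≤η =
    integer-value-bound f b u fb≢0 fa≤η (≤-trans
      (settle₀ C m′ q (lower 0 C m′ q (lower 1 C (suc m′) q
        (subst (λ l → Bounded 2 (l ℕ.^ 2) l q) (len deg)
          (quot-bound (≤-trans b≤⟨G⟩ μ≤ρ)
            (≤-trans (‖⊕‖ (ιᴷ b) u) (≤-trans (+-mono-≤ b≤⟨G⟩ u≤1) μ+1≤ρ)) f (coeff≤height f))))))
      (≤-reflexive (trans (cong (⟨ settleConstant C m′ ⟩ *_) (sym (⟨⟩-^ G m′)))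
        (sym (⟨⟩-* (settleConstant C m′) (G ℕ.^ m′))))))
    where
    1≤⟨G⟩ : 1ℚ ≤ ⟨ G ⟩
    1≤⟨G⟩ = subst (_≤ ⟨ G ⟩) ⟨1⟩ (⟨⟩-mono 1≤G)
    open Settle 1≤⟨G⟩ (height f)
    C : ℕ
    C = suc (suc m′) ℕ.^ 2
    q : K
    q = quot f (ιᴷ b) (ιᴷ b ⊕ u)
    b≤⟨G⟩ : ‖ ιᴷ b ‖ ≤ ⟨ G ⟩
    b≤⟨G⟩ = subst (_≤ ⟨ G ⟩) (sym (‖ιᴷ‖ b)) (⟨⟩-mono b≤G)

  -- For d = 2 the bound must not depend on the height at all. Here the divided difference is the
  -- leading coefficient, of absolute value 1.
  linear-linear : ∀ f → Degree 1 f → ℤ.∣ coeff f 1 ∣ ≡ 1 → ∀ b u η →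
    evℤ f b ≢ + 0 → ‖ ev f (ιᴷ b ⊕ u) ‖ ≤ η → 1ℚ ≤ η + 1ℚ * ‖ u ‖
  linear-linear (f₀ ∷ f₁ ∷ []) deg ∣f₁∣≡1 b u η fb≢0 fa≤η =
    integer-value-bound (f₀ ∷ f₁ ∷ []) b u fb≢0 fa≤η
      (≤-reflexive (trans (cong ‖_‖ quot≡) (trans (‖ιᴷ‖ f₁) (trans (cong ⟨_⟩ ∣f₁∣≡1) ⟨1⟩))))
    where
    y : K
    y = ιᴷ b ⊕ u
    quot≡ : (ιᴷ f₁ ⊕ (ιᴷ b ⊗ 0ᴷ)) ⊕ (y ⊗ (0ᴷ ⊕ (y ⊗ 0ᴷ))) ≡ ιᴷ f₁
    quot≡ = trans (cong₂ _⊕_ (trans (cong (ιᴷ f₁ ⊕_) (⊗-zeroʳ (ιᴷ b))) (⊕-identityʳ (ιᴷ f₁)))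
        (trans (cong (y ⊗_) (trans (⊕-identityˡ (y ⊗ 0ᴷ)) (⊗-zeroʳ y))) (⊗-zeroʳ y)))
      (⊕-identityʳ (ιᴷ f₁))

-- From complex numbers to sequences of Gaussian rationals.

module Analysis where

  open Rationals
  open Gaussian
  open Resultant
  open GaussianSolver
  open import Data.Rational.Base
  open import Data.Rational.Properties
  open import Data.Rational.Solver using (module +-*-Solver)

  open ℤ[x]
  open +-*-Solver
  private module KS = K-Solver

  at : ℂ → ℕ → K
  at z n = seq (re z) n +𝕚 seq (im z) n

  at-fromℤ : ∀ a n → at (fromℤ a) n ≡ ιᴷ a
  at-fromℤ a n = cong real (sym (cast≡ a))

  at-+ : ∀ z w n → at (z +ᶜ w) n ≡ at z n ⊕ at w n
  at-+ z w n = sym (⊕≡ (seq (re z) n) (seq (im z) n) (seq (re w) n) (seq (im w) n))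

  at-- : ∀ z w n → at (z -ᶜ w) n ≡ at z n ⊕ (⊖ at w n)
  at-- z w n = sym (⊖≡ (seq (re z) n) (seq (im z) n) (seq (re w) n) (seq (im w) n))

  at-* : ∀ z w n → at (z *ᶜ w) n ≡ at z n ⊗ at w n
  at-* z w n = sym (⊗≡ (seq (re z) n) (seq (im z) n) (seq (re w) n) (seq (im w) n))

  at-eval : ∀ p z n → at (eval p z) n ≡ ev p (at z n)
  at-eval []      z n = refl
  at-eval (a ∷ p) z n = trans (at-+ (fromℤ a) (z *ᶜ eval p z) n)
    (cong₂ _⊕_ (at-fromℤ a n) (trans (at-* z (eval p z) n) (cong (at z n ⊗_) (at-eval p z n))))

  -- Together with `Apart` this expresses "is zero" and "is not zero" for a limit on its rational
  -- approximations, so that all estimates can be made on exact Gaussian rationals.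
  Null : (ℕ → K) → Set
  Null s = ∀ ε → 0ℚ < ε → ∃[ N ] ∀ n → N ℕ.≤ n → ‖ s n ‖ ≤ ε

  Apart : (ℕ → K) → Set
  Apart s = ∃[ δ ] 0ℚ < δ × (∃[ N ] ∀ n → N ℕ.≤ n → δ ≤ ‖ s n ‖)

  Cauchyᴷ : (ℕ → K) → Set
  Cauchyᴷ s = ∀ ε → 0ℚ < ε → ∃[ N ] ∀ m n → N ℕ.≤ m → N ℕ.≤ n → ‖ s m ⊕ (⊖ s n) ‖ ≤ ε

  EventuallyBounded : (ℕ → K) → Set
  EventuallyBounded s = ∃[ R ] 0ℚ ≤ R × (∃[ N ] ∀ n → N ℕ.≤ n → ‖ s n ‖ ≤ R)

  half : ∀ {ε} → 0ℚ < ε → 0ℚ < ε * ½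
  half 0<ε = 0<* 0<ε 0<½

  ½+½ : ∀ ε → ε * ½ + ε * ½ ≡ ε
  ½+½ ε = solve 1 (λ ε → ε :* con ½ :+ ε :* con ½ := ε) refl ε

  null-cong : ∀ {s t} → (∀ n → s n ≡ t n) → Null s → Null t
  null-cong s≡t null ε 0<ε with null ε 0<ε
  ... | N , h = N , λ n N≤n → subst (λ z → ‖ z ‖ ≤ ε) (s≡t n) (h n N≤n)

  null-+ : ∀ {s t} → Null s → Null t → Null (λ n → s n ⊕ t n)
  null-+ {s} {t} ns nt ε 0<ε with ns (ε * ½) (half 0<ε) | nt (ε * ½) (half 0<ε)
  ... | M , hs | N , ht = M ℕ.⊔ N , λ n p → ≤-trans (‖⊕‖ (s n) (t n))
    (≤-trans (+-mono-≤ (hs n (ℕₚ.m⊔n≤o⇒m≤o M N p)) (ht n (ℕₚ.m⊔n≤o⇒n≤o M N p)))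
      (≤-reflexive (½+½ ε)))

  null-⊖ : ∀ {s} → Null s → Null (λ n → ⊖ s n)
  null-⊖ {s} ns ε 0<ε with ns ε 0<ε
  ... | N , h = N , λ n p → subst (_≤ ε) (sym (‖⊖‖ (s n))) (h n p)

  abstract
   -- Takes η = ε / (L + 1), which covers L = 0.
   scale-down : ∀ L ε → 0ℚ ≤ L → 0ℚ < ε → ∃[ η ] 0ℚ < η × L * η ≤ ε
   scale-down L ε 0≤L 0<ε = η , 0<* 0<ε (positive⁻¹ i {{1/pos⇒pos S {{S-pos}}}}) , (begin
     L * η ≤⟨ p≤p+q (L * η) (0≤* (<⇒≤ 0<ε) (<⇒≤ (positive⁻¹ i {{1/pos⇒pos S {{S-pos}}}}))) ⟩
     L * η + η
       ≡⟨ solve 3 (λ L e i → L :* (e :* i) :+ e :* i := e :* ((L :+ con 1ℚ) :* i)) refl L ε i ⟩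
     ε * (S * i) ≡⟨ cong (ε *_) (*-inverseʳ S) ⟩
     ε * 1ℚ ≡⟨ *-identityʳ ε ⟩
     ε ∎)
     where
     open ≤-Reasoning
     S : ℚ
     S = L + 1ℚ
     0<S : 0ℚ < S
     0<S = <-≤-trans 0<1 (≤-by L 0≤L (+-comm L 1ℚ))
     S-pos : Positive S
     S-pos = positive 0<S
     instance
       S≢0 : NonZero S
       S≢0 = pos⇒nonZero S {{S-pos}}
     i η : ℚ
     i = 1/ S
     η = ε * i

  null-*ˡ : ∀ {s t} → EventuallyBounded s → Null t → Null (λ n → s n ⊗ t n)
  null-*ˡ {s} {t} (R , 0≤R , M , hs) nt ε 0<ε with scale-down R ε 0≤R 0<ε
  ... | η , 0<η , Rη≤ε with nt η 0<η
  ...   | N , ht = M ℕ.⊔ N , λ n p → ≤-trans (‖⊗‖ (s n) (t n)) (≤-trans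
    (*-mono₀ (0≤‖‖ (s n)) (hs n (ℕₚ.m⊔n≤o⇒m≤o M N p)) (0≤‖‖ (t n)) (ht n (ℕₚ.m⊔n≤o⇒n≤o M N p))) Rη≤ε)

  null-cancelˡ : ∀ {s t} → Apart s → Null (λ n → s n ⊗ t n) → Null t
  -- The ½ pays for the 2 in `‖⊗‖-lower`.
  null-cancelˡ {s} {t} (δ , 0<δ , M , hs) nst ε 0<ε with nst (δ * ε * ½) (half (0<* 0<δ 0<ε))
  ... | N , h = M ℕ.⊔ N , λ n p → *-cancelˡ₀ 0<δ (begin
    δ * ‖ t n ‖ ≤⟨ *-monoʳ₀ (0≤‖‖ (t n)) (hs n (ℕₚ.m⊔n≤o⇒m≤o M N p)) ⟩
    ‖ s n ‖ * ‖ t n ‖ ≤⟨ ‖⊗‖-lower (s n) (t n) ⟩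
    ‖ s n ⊗ t n ‖ + ‖ s n ⊗ t n ‖
      ≤⟨ +-mono-≤ (h n (ℕₚ.m⊔n≤o⇒n≤o M N p)) (h n (ℕₚ.m⊔n≤o⇒n≤o M N p)) ⟩
    δ * ε * ½ + δ * ε * ½ ≡⟨ ½+½ (δ * ε) ⟩
    δ * ε ∎)
    where open ≤-Reasoning

  -- If a late term of a Cauchy sequence exceeds ε, all late terms stay above ε/2 and the sequence
  -- is apart from 0. Whenever the goal is a contradiction, this permits a case distinction on
  -- whether a value vanishes.
  not-apart⇒null : ∀ {s} → Cauchyᴷ s → ¬ Apart s → Null s
  not-apart⇒null {s} cauchy ¬apart ε 0<ε with cauchy (ε * ½) (half 0<ε)
  ... | N , h = N , bound
    where
    bound : ∀ n → N ℕ.≤ n → ‖ s n ‖ ≤ ε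
    bound n N≤n with ‖ s n ‖ ≤? ε
    ... | yes le = le
    ... | no  ≰ε = contradiction (ε * ½ , half 0<ε , N , λ m N≤m → lower m N≤m) ¬apart
      where
      open ≤-Reasoning
      lower : ∀ m → N ℕ.≤ m → ε * ½ ≤ ‖ s m ‖
      lower m N≤m = +-cancelʳ-≤′ (begin
        ε * ½ + ε * ½ ≡⟨ ½+½ ε ⟩
        ε ≤⟨ <⇒≤ (≰⇒> ≰ε) ⟩
        ‖ s n ‖
          ≡⟨ cong ‖_‖ (KS.solve 2 (λ x y → x KS.:= y KS.:+ (x KS.:+ (KS.:- y))) refl (s n) (s m)) ⟩
        ‖ s m ⊕ (s n ⊕ (⊖ s m)) ‖ ≤⟨ ‖⊕‖ _ _ ⟩
        ‖ s m ‖ + ‖ s n ⊕ (⊖ s m) ‖ ≤⟨ +-monoʳ-≤ (‖ s m ‖) (h n m N≤n N≤m) ⟩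
        ‖ s m ‖ + ε * ½ ∎)
        where
        +-cancelʳ-≤′ : ∀ {a b c} → a + c ≤ b + c → a ≤ b
        +-cancelʳ-≤′ {a} {b} {c} le = subst₂ _≤_
          (solve 2 (λ a c → a :+ c :- c := a) refl a c)
          (solve 2 (λ b c → b :+ c :- c := b) refl b c) (+-monoˡ-≤ (- c) le)

  apart⇒not-null : ∀ {s} → Apart s → ¬ Null s
  apart⇒not-null {s} (δ , 0<δ , A , h) null with null (δ * ½) (half 0<δ)
  ... | B , h′ = <-irrefl refl (<-≤-trans δ½<δ (≤-trans (h (A ℕ.⊔ B) (ℕₚ.m≤m⊔n A B))
      (h′ (A ℕ.⊔ B) (ℕₚ.m≤n⊔m A B))))
    where
    δ½<δ : δ * ½ < δ
    δ½<δ = subst₂ _<_ (+-identityʳ (δ * ½)) (½+½ δ) (+-monoʳ-< (δ * ½) (half 0<δ))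

  cauchy-bounded : ∀ {s} → Cauchyᴷ s → EventuallyBounded s
  cauchy-bounded {s} cauchy with cauchy 1ℚ 0<1
  ... | N , h = 1ℚ + ‖ s N ‖ , 0≤+ 0≤1 (0≤‖‖ (s N)) , N , λ n N≤n → begin
    ‖ s n ‖
      ≡⟨ cong ‖_‖ (KS.solve 2 (λ x y → x KS.:= (x KS.:+ (KS.:- y)) KS.:+ y) refl (s n) (s N)) ⟩
    ‖ (s n ⊕ (⊖ s N)) ⊕ s N ‖ ≤⟨ ‖⊕‖ _ _ ⟩
    ‖ s n ⊕ (⊖ s N) ‖ + ‖ s N ‖ ≤⟨ +-monoˡ-≤ (‖ s N ‖) (h n N N≤n ℕₚ.≤-refl) ⟩
    1ℚ + ‖ s N ‖ ∎
    where open ≤-Reasoning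

  at-cauchy : ∀ z → Cauchyᴷ (at z)
  at-cauchy z ε 0<ε with cauchy (re z) (ε * ½) (half 0<ε) | cauchy (im z) (ε * ½) (half 0<ε)
  ... | M , hr | N , hi = M ℕ.⊔ N , λ m n p q → ≤-trans
    (≤-reflexive (trans (cong ‖_‖ (⊖≡ _ _ _ _)) (‖‖≡ _ _)))
    (≤-trans (+-mono-≤
        (<⇒≤ (hr m n (ℕₚ.m⊔n≤o⇒m≤o M N p) (ℕₚ.m⊔n≤o⇒m≤o M N q)))
        (<⇒≤ (hi m n (ℕₚ.m⊔n≤o⇒n≤o M N p) (ℕₚ.m⊔n≤o⇒n≤o M N q))))
      (≤-reflexive (½+½ ε)))

  cauchy-cong : ∀ {s t} → (∀ n → s n ≡ t n) → Cauchyᴷ s → Cauchyᴷ t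
  cauchy-cong s≡t cs ε 0<ε with cs ε 0<ε
  ... | N , h = N , λ m n p q → subst₂ (λ x y → ‖ x ⊕ (⊖ y) ‖ ≤ ε) (s≡t m) (s≡t n) (h m n p q)

  ev-cauchy : ∀ p z → Cauchyᴷ (λ n → ev p (at z n))
  ev-cauchy p z = cauchy-cong (at-eval p z) (at-cauchy (eval p z))

  ∣∣≤ : ∀ {x ε} → x ≤ 0ℚ + ε → 0ℚ ≤ x + ε → ∣ x ∣ ≤ ε
  ∣∣≤ {x} {ε} x≤ 0≤ with ∣p∣≡p∨∣p∣≡-p x
  ... | inj₁ eq = ≤-trans (≤-reflexive eq) (≤-trans x≤ (≤-reflexive (+-identityˡ ε)))
  ... | inj₂ eq = ≤-trans (≤-reflexive eq) (subst₂ _≤_ (+-identityˡ (- x))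
    (solve 2 (λ x ε → x :+ ε :+ (:- x) := ε) refl x ε) (+-monoˡ-≤ (- x) 0≤))

  ≃0⇒null : ∀ z → z ≃ᶜ fromℤ (+ 0) → Null (at z)
  ≃0⇒null z ((r≤ , r≥) , (i≤ , i≥)) ε 0<ε
    with r≤ (ε * ½) (half 0<ε) | r≥ (ε * ½) (half 0<ε) | i≤ (ε * ½) (half 0<ε) | i≥ (ε * ½) (half 0<ε)
  ... | A , a | B , b | C , c | D , d = (A ℕ.⊔ B) ℕ.⊔ (C ℕ.⊔ D) , λ n p →
    let p₁ = ℕₚ.m⊔n≤o⇒m≤o (A ℕ.⊔ B) (C ℕ.⊔ D) p
        p₂ = ℕₚ.m⊔n≤o⇒n≤o (A ℕ.⊔ B) (C ℕ.⊔ D) p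
    in ≤-trans (≤-reflexive (‖‖≡ _ _)) (≤-trans (+-mono-≤
      (∣∣≤ (a n (ℕₚ.m⊔n≤o⇒m≤o A B p₁)) (b n (ℕₚ.m⊔n≤o⇒n≤o A B p₁)))
      (∣∣≤ (c n (ℕₚ.m⊔n≤o⇒m≤o C D p₂)) (d n (ℕₚ.m⊔n≤o⇒n≤o C D p₂))))
      (≤-reflexive (½+½ ε)))

  root⇒null : ∀ p z → IsRoot p z → Null (λ n → ev p (at z n))
  root⇒null p z root = null-cong (at-eval p z) (≃0⇒null (eval p z) root)

  difference-bound : ∀ {x y ε} → ∣ x - y ∣ ≤ ε → x ≤ y + ε
  difference-bound {x} {y} {ε} le = subst (_≤ y + ε) (solve 2 (λ x y → y :+ (x :- y) := x) refl x y)
    (+-monoʳ-≤ y (≤-trans (p≤∣p∣ (x - y)) le))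

  null⇒≃ : ∀ z w → Null (λ n → at z n ⊕ (⊖ at w n)) → z ≃ᶜ w
  null⇒≃ z w null =
    ((λ ε 0<ε → let N , h = null ε 0<ε in N , λ n p → difference-bound (re≤ n (h n p))) ,
     (λ ε 0<ε → let N , h = null ε 0<ε in N , λ n p → difference-bound (flip (seq (re z) n) (seq (re w) n) (re≤ n (h n p))))) ,
    ((λ ε 0<ε → let N , h = null ε 0<ε in N , λ n p → difference-bound (im≤ n (h n p))) ,
     (λ ε 0<ε → let N , h = null ε 0<ε in N , λ n p → difference-bound (flip (seq (im z) n) (seq (im w) n) (im≤ n (h n p)))))
    where
    norm≡ : ∀ n → ‖ at z n ⊕ (⊖ at w n) ‖ ≡ ∣ seq (re z) n - seq (re w) n ∣ + ∣ seq (im z) n - seq (im w) n ∣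
    norm≡ n = trans (cong ‖_‖ (⊖≡ _ _ _ _)) (‖‖≡ _ _)
    re≤ : ∀ n {ε} → ‖ at z n ⊕ (⊖ at w n) ‖ ≤ ε → ∣ seq (re z) n - seq (re w) n ∣ ≤ ε
    re≤ n le = ≤-trans (p≤p+q _ (0≤∣p∣ _)) (≤-trans (≤-reflexive (sym (norm≡ n))) le)
    im≤ : ∀ n {ε} → ‖ at z n ⊕ (⊖ at w n) ‖ ≤ ε → ∣ seq (im z) n - seq (im w) n ∣ ≤ ε
    im≤ n le = ≤-trans (≤-trans (p≤p+q (∣ y ∣) (0≤∣p∣ x)) (≤-reflexive (+-comm (∣ y ∣) (∣ x ∣))))
        (≤-trans (≤-reflexive (sym (norm≡ n))) le)
      where
      x y : ℚ
      x = seq (re z) n - seq (re w) n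
      y = seq (im z) n - seq (im w) n
    flip : ∀ x y {ε} → ∣ x - y ∣ ≤ ε → ∣ y - x ∣ ≤ ε
    flip x y le = subst (_≤ _) (trans (sym (∣-p∣≡∣p∣ (x - y)))
      (cong ∣_∣ (solve 2 (λ x y → :- (x :- y) := y :- x) refl x y))) le

-- Minimal polynomials and the independence of the pairs in use.

module MinimalPoly where

  open IntPoly
  open Rationals
  open Gaussian
  open Resultant
  open GaussianSolver
  open Cases
  open Analysis
  open import Data.Rational.Base using (ℚ; 1ℚ)
  import Data.Rational.Properties as ℚₚ
  open import Relation.Binary.Definitions using (tri<; tri≈; tri>)

  open ℤ[x]
  private module KS = K-Solver

  values : Poly → ℂ → ℕ → K
  values p z n = ev p (at z n)

  Vanishes : Poly → ℂ → Set
  Vanishes p z = Null (values p z)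

  values-bounded : ∀ p z → EventuallyBounded (values p z)
  values-bounded p z = cauchy-bounded (ev-cauchy p z)

  vanishes-≈ : ∀ p q z → p ≈ₚ q → Vanishes p z → Vanishes q z
  vanishes-≈ p q z p≈q = null-cong (λ n → ev-≈ p q (at z n) p≈q)

  vanishes-cofactor : ∀ p q z → Apart (values q z) → Vanishes (p *ₚ q) z → Vanishes p z
  vanishes-cofactor p q z apart null = null-cancelˡ apart
    (null-cong (λ n → trans (ev-* p q (at z n))
      (KS.solve 2 (λ x y → x KS.:* y KS.:= y KS.:* x) refl (values p z n) (values q z n))) null)

  apart-constant : ∀ {s} → s ≢ + 0 → Apart (λ _ → ιᴷ s)
  apart-constant {s} s≢0 = 1ℚ , 0<1 , 0 , λ _ _ →
    subst₂ ℚ._≤_ ⟨1⟩ (sym (‖ιᴷ‖ s)) (⟨⟩-mono 1≤∣ s≢0 ∣)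

  vanishes-unscale : ∀ {s} q q′ z → s ≢ + 0 → (∀ i → coeff q i ≡ s ℤ.* coeff q′ i) →
    Vanishes q z → Vanishes q′ z
  vanishes-unscale {s} q q′ z s≢0 q≡ null = null-cancelˡ (apart-constant s≢0)
    (null-cong (λ n → trans (ev-≈ q (map (s ℤ.*_) q′) (at z n)
        (λ i → trans (q≡ i) (sym (coeff-map s q′ i)))) (ev-map s q′ (at z n))) null)

  Annihilator : ℂ → ℕ → Set
  Annihilator z k = ∃[ q ] Degree k q × Vanishes q z

  -- Least degree among integer annihilators takes the place of irreducibility; it yields directly
  -- that shorter polynomials vanishing at `z` are zero. The polynomial may have content.
  record MinPoly (z : ℂ) (k : ℕ) : Set where
    field
      poly     : Poly
      deg      : Degree k poly
      vanishes : Vanishes poly z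
      minimal  : ∀ j → j ℕ.< k → ¬ Annihilator z j

  open MinPoly

  -- Whether an annihilator of smaller degree exists is undecidable, so the least degree is found by
  -- strong induction under a double negation.
  ¬¬minPoly : ∀ {z k} → Annihilator z k → ¬ (∀ j → ¬ MinPoly z j)
  ¬¬minPoly {z} {k} ann none = below-none (suc k) k ℕₚ.≤-refl ann
    where
    below-none : ∀ n j → j ℕ.< n → ¬ Annihilator z j
    below-none (suc n) j (s≤s j≤n) (q , deg-q , null) = none j (record
      { poly = q ; deg = deg-q ; vanishes = null
      ; minimal = λ i i<j → below-none n i (ℕₚ.<-≤-trans i<j j≤n) })

  module _ {z : ℂ} {k : ℕ} (M : MinPoly z k) where

    degree≤ : ∀ {j} → Annihilator z j → k ℕ.≤ j
    degree≤ {j} ann = ℕₚ.≮⇒≥ λ j<k → minimal M j j<k ann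

    short-vanishing : ∀ p → length p ℕ.≤ k → Vanishes p z → p ≈ₚ []
    short-vanishing p p≤k null with trim (ℤₚ._≟ + 0) p
    ... | inj₁ p≈0 = p≈0
    ... | inj₂ (j , q , j<p , deg-q , q≈p) = contradiction
      (q , deg-q , vanishes-≈ p q z (λ i → sym (q≈p i)) null) (minimal M j (ℕₚ.<-≤-trans j<p p≤k))

  constant-not-vanishing : ∀ {q} z → Degree 0 q → ¬ Vanishes q z
  constant-not-vanishing {a ∷ []} z deg-q null with null ℚ.½ 0<½
  ... | N , h = ℚₚ.<-irrefl refl (ℚₚ.<-≤-trans ½<1 (ℚₚ.≤-trans 1≤ (h N ℕₚ.≤-refl)))
    where
    ½<1 : ℚ.½ ℚ.< 1ℚ
    ½<1 = ℚ.*<* (ℤ.+<+ (s≤s (s≤s z≤n)))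
    1≤ : 1ℚ ℚ.≤ ‖ ev (a ∷ []) (at z N) ‖
    1≤ = subst₂ ℚ._≤_ ⟨1⟩ (sym (trans (cong ‖_‖ (trans (cong (ιᴷ a ⊕_) (⊗-zeroʳ (at z N)))
        (⊕-identityʳ (ιᴷ a)))) (‖ιᴷ‖ a)))
      (⟨⟩-mono 1≤∣ top deg-q ∣)

  degree-unique : ∀ {D E p} → Degree D p → coeff p E ≢ + 0 → Below p (suc E) → D ≡ E
  degree-unique {D} {E} deg-p top≢0 p< with ℕₚ.<-cmp D E
  ... | tri< D<E _ _ = contradiction (below deg-p E D<E) top≢0
  ... | tri≈ _ D≡E _ = D≡E
  ... | tri> _ _ E<D = contradiction (p< D E<D) (top deg-p)

  *-nonzeroₚ : ∀ {p q n} → Degree n q → p *ₚ q ≈ₚ [] → p ≈ₚ []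
  *-nonzeroₚ {p} {q} {n} deg-q pq≈0 with trim (ℤₚ._≟ + 0) p
  ... | inj₁ p≈0 = p≈0
  ... | inj₂ (l , p′ , _ , deg-p′ , p′≈p) = contradiction
    (trans (sym (*ₚ-top p′ q (below deg-p′) (below deg-q)))
      (trans (*ₚ-congˡ {p′} {p} q p′≈p (l ℕ.+ n)) (pq≈0 (l ℕ.+ n))))
    (*-nonzero (top deg-p′) (top deg-q))

  -- Divisibility over ℤ is obtained by changing the given minimal polynomial by a scalar, hence the
  -- new `minPoly` in the record. For monic `P`, `tops` makes both leading coefficients ±1.
  record Factor {D : ℕ} (P : Poly) (z : ℂ) (k : ℕ) : Set where
    field
      minPoly   : MinPoly z k
      cofactor  : Poly
      codegree  : ℕ
      codeg     : Degree codegree cofactor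
      degree-+  : codegree ℕ.+ k ≡ D
      product≈  : P ≈ₚ cofactor *ₚ poly minPoly
      tops      : coeff cofactor codegree ℤ.* coeff (poly minPoly) k ≡ coeff P D

  -- The remainder of the pseudo-division vanishes at `z` and is too short not to be zero; Gauss's
  -- lemma then removes the scalar from c P = h q.
  factor : ∀ {D P z k} → Degree D P → Vanishes P z → MinPoly z k → Factor {D} P z k
  factor {D} {P} {z} {k} deg-P null M with pseudoDivision (poly M) (deg M) P
  ... | c , h , r , c≢0 , len-r , eq = build (reduce-scalar c c≢0 P h (poly M) eq′)
    where
    r-vanishes : Vanishes r z
    r-vanishes = null-cong
      (λ n → trans (cong (_⊕ (⊖ ev (h *ₚ poly M) (at z n)))
          (trans (identity n) (ev-+ (h *ₚ poly M) r (at z n))))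
        (KS.solve 2 (λ x y → (x KS.:+ y) KS.:+ (KS.:- x) KS.:= y) refl (ev (h *ₚ poly M) (at z n))
            (ev r (at z n))))
      (null-+ (null-*ˡ (1≤bounded c) null)
        (null-⊖ (null-cong (λ n → sym (ev-* h (poly M) (at z n)))
          (null-*ˡ (values-bounded h z) (vanishes M)))))
      where
      1≤bounded : ∀ c → EventuallyBounded (λ _ → ιᴷ c)
      1≤bounded c = ‖ ιᴷ c ‖ , 0≤‖‖ (ιᴷ c) , 0 , λ _ _ → ℚₚ.≤-refl
      identity : ∀ n → ιᴷ c ⊗ ev P (at z n) ≡ ev ((h *ₚ poly M) +ₚ r) (at z n)
      identity n = trans (sym (ev-map c P (at z n))) (ev-≈ (map (c ℤ.*_) P) ((h *ₚ poly M) +ₚ r) (at z n)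
        (λ i → trans (coeff-map c P i) (trans (eq i) (sym (coeff-+ (h *ₚ poly M) r i)))))
    eq′ : ∀ i → c ℤ.* coeff P i ≡ coeff (h *ₚ poly M) i
    eq′ i = trans (eq i) (trans (cong (ℤ._+_ (coeff (h *ₚ poly M) i))
      (short-vanishing M r (ℕₚ.≤-reflexive len-r) r-vanishes i)) (ℤₚ.+-identityʳ _))

    build : Reduct P (poly M) → Factor P z k
    build (s , h′ , q′ , s≢0 , len-q′ , q≡ , P≈) with trim (ℤₚ._≟ + 0) h′
    ... | inj₁ h′≈0 = contradiction
      (trans (P≈ D) (*ₚ-zeroˡ {h′} q′ h′≈0 D)) (top deg-P)
    ... | inj₂ (j , h″ , _ , deg-h″ , h″≈h′) = record
      { minPoly = record { poly = q′ ; deg = deg-q′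
                         ; vanishes = vanishes-unscale (poly M) q′ z s≢0 q≡ (vanishes M)
                         ; minimal = minimal M }
      ; cofactor = h″ ; codegree = j ; codeg = deg-h″ ; degree-+ = sym D≡
      ; product≈ = P≈′
      ; tops = trans (sym (*ₚ-top h″ q′ (below deg-h″) (below deg-q′)))
          (trans (sym (P≈′ (j ℕ.+ k))) (cong (coeff P) (sym D≡))) }
      where
      deg-q′ : Degree k q′
      deg-q′ = degree (trans len-q′ (len (deg M)))
        (λ top≡0 → top (deg M) (trans (q≡ k) (trans (cong (s ℤ.*_) top≡0) (ℤₚ.*-zeroʳ s))))
      P≈′ : P ≈ₚ h″ *ₚ q′
      P≈′ i = trans (P≈ i) (sym (*ₚ-congˡ {h″} {h′} q′ h″≈h′ i))
      D≡ : D ≡ j ℕ.+ k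
      D≡ = degree-unique deg-P
        (λ e → *-nonzero (top deg-h″) (top deg-q′)
          (trans (sym (*ₚ-top h″ q′ (below deg-h″) (below deg-q′))) (trans (sym (P≈′ (j ℕ.+ k))) e)))
        (λ i lt → trans (P≈′ i) (*ₚ-above h″ q′ (below deg-h″) (below deg-q′) i lt))

  cofactor-sum : ∀ U V p q z → (∀ i → coeff (U *ₚ p) i ℤ.+ coeff (V *ₚ q) i ≡ + 0) → ∀ n →
    (ev U (at z n) ⊗ ev p (at z n)) ⊕ (ev V (at z n) ⊗ ev q (at z n)) ≡ 0ᴷ
  cofactor-sum U V p q z eq n = trans
    (sym (trans (ev-+ (U *ₚ p) (V *ₚ q) (at z n)) (cong₂ _⊕_ (ev-* U p (at z n)) (ev-* V q (at z n)))))
    (ev-zero ((U *ₚ p) +ₚ (V *ₚ q)) (at z n) (λ i → trans (coeff-+ (U *ₚ p) (V *ₚ q) i) (eq i)))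

  -- At β the second product vanishes and the first polynomial does not, so U(β) = 0. As `U` is
  -- shorter than the minimal polynomial of β, U = 0, and then V = 0.
  independent-distinct : ∀ {α β m n} (M : MinPoly α m) (N : MinPoly β n) →
    Apart (values (poly M) β) → Independent m n (poly M) (poly N)
  independent-distinct {α} {β} {m} {n} M N apart U V lenU lenV eq = U≈0 , V≈0
    where
    p q : Poly
    p = poly M
    q = poly N
    U-vanishes : Vanishes U β
    U-vanishes = null-cancelˡ apart (null-cong
      (λ i → rearrange (values U β i) (values p β i) (values V β i) (values q β i)
          (cofactor-sum U V p q β eq i))
      (null-⊖ (null-*ˡ (values-bounded V β) (vanishes N))))
      where
      rearrange : ∀ u p v q → (u ⊗ p) ⊕ (v ⊗ q) ≡ 0ᴷ → ⊖ (v ⊗ q) ≡ p ⊗ u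
      rearrange u p v q e = trans (sym (⊕-identityˡ _)) (trans (cong (_⊕ (⊖ (v ⊗ q))) (sym e))
        (KS.solve 4 (λ u p v q → (u KS.:* p KS.:+ v KS.:* q) KS.:+ (KS.:- (v KS.:* q)) KS.:= p KS.:* u)
            refl u p v q))
    U≈0 : U ≈ₚ []
    U≈0 = short-vanishing N U (ℕₚ.≤-reflexive lenU) U-vanishes
    V≈0 : V ≈ₚ []
    V≈0 = *-nonzeroₚ {V} {q} (deg N) (λ i → trans (sym (trans
      (cong (ℤ._+ coeff (V *ₚ q) i) (*ₚ-zeroˡ {U} p U≈0 i)) (ℤₚ.+-identityˡ _))) (eq i))

  module _ {α : ℂ} {m : ℕ} (M : MinPoly α (suc m)) where

    private
      k : ℕ
      k = suc m
      q f g : Poly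
      q = poly M
      f = truncate k (deriv q)
      g = truncate k (coderiv k q)

      f≈ : f ≈ₚ deriv q
      f≈ = truncate-≈ k (deriv q) (deriv-below q (deg M))

      f-top : coeff f m ≢ + 0
      f-top e = *-nonzero {+ k} (λ ()) (top (deg M)) (trans (sym (trans (f≈ m) (coeff-deriv q m))) e)

      f< : Below f (suc m)
      f< i m<i = coeff-length f (subst (ℕ._≤ i) (sym (length-truncate k (deriv q))) m<i)

      g< : Below g (suc m)
      g< i m<i = coeff-length g (subst (ℕ._≤ i) (sym (length-truncate k (coderiv k q))) m<i)

    deriv-not-vanishing : ¬ Vanishes f α
    deriv-not-vanishing null = f-top
      (short-vanishing M f (ℕₚ.≤-reflexive (length-truncate k (deriv q))) null m)

    -- Modulo q the relation reads f (U - x V) = 0. So W = U - x V vanishes at α, its degree is less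
    -- than k, and U = x V. In x V f + V g = 0 only the first product reaches degree deg V + m + 1 -
    -- 1 + 1 counted from f of degree m, that is deg V + 1 + m; its leading coefficient is not zero
    -- unless V is.
    independent-derivative : Apart (values f α) → Independent m m f g
    independent-derivative apart U V lenU lenV eq = U≈0 , V≈0
      where
      W : Poly
      W = U +ₚ (+ 0 ∷ map (ℤ.-1ℤ ℤ.*_) V)

      coeff-W : ∀ i → coeff W i ≡ coeff U i ℤ.+ coeff (+ 0 ∷ map (ℤ.-1ℤ ℤ.*_) V) i
      coeff-W = coeff-+ U (+ 0 ∷ map (ℤ.-1ℤ ℤ.*_) V)

      W< : Below W k
      W< (suc i) (s≤s m≤i) = trans (coeff-W (suc i)) (cong₂ ℤ._+_
        (coeff-length U (subst (ℕ._≤ suc i) (sym lenU) (ℕₚ.m≤n⇒m≤1+n m≤i)))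
        (trans (coeff-map ℤ.-1ℤ V i) (cong (ℤ.-1ℤ ℤ.*_) (coeff-length V (subst (ℕ._≤ i) (sym lenV) m≤i)))))

      ev-W : ∀ x → ev W x ≡ ev U x ⊕ (⊖ (x ⊗ ev V x))
      ev-W x = trans (ev-+ U (+ 0 ∷ map (ℤ.-1ℤ ℤ.*_) V) x) (cong (ev U x ⊕_)
        (trans (ev-0∷ (map (ℤ.-1ℤ ℤ.*_) V) x) (trans (cong (x ⊗_) (ev-map ℤ.-1ℤ V x))
          (KS.solve 2 (λ x y → x KS.:* (KS.con ℤ.-1ℤ KS.:* y) KS.:= KS.:- (x KS.:* y)) refl x (ev V x)))))

      W-vanishes : Vanishes W α
      W-vanishes = null-cancelˡ apart (null-cong
        (λ n → rearrange (at α n) (values U α n) (values V α n) (values q α n) (values f α n)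
            (values g α n) (values W α n)
          (cofactor-sum U V f g α eq n)
          (trans (ev-truncate-coderiv q (deg M) (at α n))
            (cong (λ d → (ιᴷ (+ k) ⊗ values q α n) ⊕ (⊖ (at α n ⊗ d)))
                (sym (ev-truncate-deriv q (deg M) (at α n)))))
          (ev-W (at α n)))
        (null-⊖ (null-*ˡ (bounded-⊗ (values-bounded V α)) (vanishes M))))
        where
        bounded-⊗ : ∀ {s} → EventuallyBounded s → EventuallyBounded (λ n → ιᴷ (+ k) ⊗ s n)
        bounded-⊗ {s} (R , 0≤R , N , h) = ‖ ιᴷ (+ k) ‖ ℚ.* R , 0≤* (0≤‖‖ (ιᴷ (+ k))) 0≤R , N ,
          λ n N≤n → ℚₚ.≤-trans (‖⊗‖ (ιᴷ (+ k)) (s n)) (*-monoˡ₀ (0≤‖‖ (ιᴷ (+ k))) (h n N≤n))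
        rearrange : ∀ x u v q f g w → (u ⊗ f) ⊕ (v ⊗ g) ≡ 0ᴷ →
          g ≡ (ιᴷ (+ k) ⊗ q) ⊕ (⊖ (x ⊗ f)) → w ≡ u ⊕ (⊖ (x ⊗ v)) →
          ⊖ ((ιᴷ (+ k) ⊗ v) ⊗ q) ≡ f ⊗ w
        rearrange x u v q f g w e refl refl = trans (sym (⊕-identityˡ _))
          (trans (cong (_⊕ (⊖ ((ιᴷ (+ k) ⊗ v) ⊗ q))) (sym e))
          (KS.solve 6 (λ x u v q f κ →
            (u KS.:* f KS.:+ v KS.:* (κ KS.:* q KS.:+ (KS.:- (x KS.:* f)))) KS.:+ (KS.:- ((κ KS.:* v) KS.:* q))
            KS.:= f KS.:* (u KS.:+ (KS.:- (x KS.:* v)))) refl x u v q f (ιᴷ (+ k))))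

      W≈0 : W ≈ₚ []
      W≈0 i = trans (sym (truncate-≈ k W W< i))
        (short-vanishing M (truncate k W) (ℕₚ.≤-reflexive (length-truncate k W))
          (vanishes-≈ W (truncate k W) α (λ i → sym (truncate-≈ k W W< i)) W-vanishes) i)

      U≈ : U ≈ₚ (+ 0 ∷ V)
      U≈ zero = trans (sym (ℤₚ.+-identityʳ _)) (trans (sym (coeff-W 0)) (W≈0 0))
      U≈ (suc i) = ℤₚ.i-j≡0⇒i≡j (coeff U (suc i)) (coeff V i)
        (trans (cong (ℤ._+_ (coeff U (suc i))) (sym (trans (coeff-map ℤ.-1ℤ V i) (ℤₚ.-1*i≡-i _))))
          (trans (sym (coeff-W (suc i))) (W≈0 (suc i))))

      V≈0 : V ≈ₚ []
      V≈0 with trim (ℤₚ._≟ + 0) V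
      ... | inj₁ V≈0 = V≈0
      ... | inj₂ (l , V′ , _ , deg-V′ , V′≈V) = contradiction
        (trans (sym (*ₚ-top (+ 0 ∷ V′) f {suc l} {m} xV′< f<)) (trans
          (sym (trans (cong₂ ℤ._+_
            (*ₚ-congˡ {U} {+ 0 ∷ V′} f (λ { zero → U≈ 0 ; (suc i) → trans (U≈ (suc i)) (sym (V′≈V i)) })
                (suc l ℕ.+ m))
            (trans (*ₚ-congˡ {V} {V′} g (λ i → sym (V′≈V i)) (suc l ℕ.+ m))
              (*ₚ-above V′ g (below deg-V′) g< (suc l ℕ.+ m) ℕₚ.≤-refl)))
            (ℤₚ.+-identityʳ _)))
          (eq (suc l ℕ.+ m))))
        (*-nonzero (top deg-V′) f-top)
        where
        xV′< : Below (+ 0 ∷ V′) (suc (suc l))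
        xV′< (suc i) (s≤s l<i) = below deg-V′ i l<i

      U≈0 : U ≈ₚ []
      U≈0 zero    = U≈ 0
      U≈0 (suc i) = trans (U≈ (suc i)) (V≈0 i)

-- Rational factorisations bound the degrees of minimal polynomials.

module Reducibility where

  open IntPoly using (Degree; degree; truncate; length-truncate; coeff-truncate; truncate-≈; *-nonzero)
  open Rationals
  open Gaussian
  open Resultant
  open GaussianSolver
  open Analysis
  open MinimalPoly
  open import Data.Rational.Base using (0ℚ; 1ℚ; _*_; _+_; 1/_; ↥_; ↧_; toℚᵘ; mkℚ; NonZero; ≢-nonZero)
  import Data.Rational.Properties as ℚₚ
  import Data.Rational.Unnormalised.Base as ℚᵘ
  import Data.Rational.Unnormalised.Properties as ℚᵘₚ

  private
    module KS = K-Solver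
    module PolyQ = PolyTheory ℚₚ.+-*-isCommutativeRing
    module EvQ = Evaluation ℚₚ.+-*-isCommutativeRing isCommutativeRingᴷ real refl real-+ real-*

  cast-↧ : ∀ a → cast (↧ a) * a ≡ cast (↥ a)
  cast-↧ a@(mkℚ n d-1 _) = ℚₚ.toℚᵘ-injective (ℚᵘₚ.≃-trans (ℚₚ.toℚᵘ-homo-* (cast (↧ a)) a)
    (ℚᵘₚ.≃-trans (ℚᵘₚ.*-congʳ {toℚᵘ a} (toℚᵘ-cast (↧ a)))
      (ℚᵘₚ.≃-trans (ℚᵘ.*≡* eq) (ℚᵘₚ.≃-sym (toℚᵘ-cast (↥ a))))))
    where
    eq : (+ suc d-1 ℤ.* n) ℤ.* + 1 ≡ n ℤ.* (+ (1 ℕ.* suc d-1))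
    eq = trans (ℤₚ.*-identityʳ _) (trans (ℤₚ.*-comm (+ suc d-1) n)
        (cong (λ x → n ℤ.* + x) (sym (ℕₚ.*-identityˡ (suc d-1)))))

  ev-toℚ : ∀ p x → EvQ.ev (toℚ[x] p) x ≡ ev p x
  ev-toℚ []      x = refl
  ev-toℚ (a ∷ p) x = cong₂ (λ c e → c ⊕ (x ⊗ e)) (cong real (sym (cast≡ a))) (ev-toℚ p x)

  coeff-toℚ : ∀ p i → ℚ[x].coeff (toℚ[x] p) i ≡ cast (ℤ[x].coeff p i)
  coeff-toℚ []      i       = sym ⟨0⟩
  coeff-toℚ (a ∷ p) zero    = sym (cast≡ a)
  coeff-toℚ (a ∷ p) (suc i) = coeff-toℚ p i

  -- Both readings are carried along: coefficients determine the degree, values decide where the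
  -- polynomial vanishes.
  Cleared : ℚ[x].Poly → ℤ → ℤ[x].Poly → Set
  Cleared f c p = (∀ i → cast (ℤ[x].coeff p i) ≡ cast c * ℚ[x].coeff f i) ×
    (∀ x → ev p x ≡ ιᴷ c ⊗ EvQ.ev f x)

  clearDenominators : ∀ f → ∃[ c ] ∃[ p ] c ≢ + 0 × Cleared f c p
  clearDenominators [] = + 1 , [] , (λ ()) ,
    (λ i → trans ⟨0⟩ (sym (ℚₚ.*-zeroʳ (cast (+ 1))))) , (λ x → sym (⊗-zeroʳ (ιᴷ (+ 1))))
  clearDenominators (a ∷ f) with clearDenominators f
  ... | c , p , c≢0 , coeffs , evs =
    ↧ a ℤ.* c , ↥ a ℤ.* c ∷ map (↧ a ℤ.*_) p , *-nonzero {↧ a} {c} (λ ()) c≢0 ,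
    (λ { zero → head≡
       ; (suc i) → trans (cong cast (IntPoly.coeff-map (↧ a) p i)) (trans (cast-* (↧ a) _)
          (trans (cong (cast (↧ a) *_) (coeffs i)) (trans (sym
              (ℚₚ.*-assoc (cast (↧ a)) (cast c) (ℚ[x].coeff f i)))
            (cong (_* ℚ[x].coeff f i) (sym (cast-* (↧ a) c)))))) }) ,
    λ x → trans
      (cong₂ (λ u e → u ⊕ (x ⊗ e)) (trans (cong real head≡) (real-* (cast (↧ a ℤ.* c)) a))
        (trans (ev-map (↧ a) p x) (cong (ιᴷ (↧ a) ⊗_) (evs x))))
      (trans (cong (λ y → (y ⊗ real a) ⊕ (x ⊗ (ιᴷ (↧ a) ⊗ (ιᴷ c ⊗ EvQ.ev f x)))) (ιᴷ-* (↧ a) c))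
        (trans (KS.solve 5 (λ d c a x e → d KS.:* c KS.:* a KS.:+ x KS.:* (d KS.:* (c KS.:* e))
            KS.:= (d KS.:* c) KS.:* (a KS.:+ x KS.:* e)) refl (ιᴷ (↧ a)) (ιᴷ c) (real a) x (EvQ.ev f x))
          (cong (_⊗ (real a ⊕ (x ⊗ EvQ.ev f x))) (sym (ιᴷ-* (↧ a) c)))))
    where
    head≡ : cast (↥ a ℤ.* c) ≡ cast (↧ a ℤ.* c) * a
    head≡ = begin
      cast (↥ a ℤ.* c) ≡⟨ cast-* (↥ a) c ⟩
      cast (↥ a) * cast c ≡⟨ cong (_* cast c) (sym (cast-↧ a)) ⟩
      cast (↧ a) * a * cast c ≡⟨ ℚₚ.*-assoc (cast (↧ a)) a (cast c) ⟩
      cast (↧ a) * (a * cast c) ≡⟨ cong (cast (↧ a) *_) (ℚₚ.*-comm a (cast c)) ⟩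
      cast (↧ a) * (cast c * a) ≡⟨ sym (ℚₚ.*-assoc (cast (↧ a)) (cast c) a) ⟩
      cast (↧ a) * cast c * a ≡⟨ cong (_* a) (sym (cast-* (↧ a) c)) ⟩
      cast (↧ a ℤ.* c) * a ∎
      where open ≡-Reasoning

  cast-nonzero : ∀ {c} → c ≢ + 0 → cast c ≢ 0ℚ
  cast-nonzero c≢0 e = c≢0 (cast-injective (trans e (sym ⟨0⟩)))

  ℚ-nonzero-* : ∀ {a b} → a ≢ 0ℚ → b ≢ 0ℚ → a * b ≢ 0ℚ
  ℚ-nonzero-* {a} {b} a≢0 b≢0 ab≡0 = b≢0 (begin
    b ≡⟨ sym (ℚₚ.*-identityˡ b) ⟩
    1ℚ * b ≡⟨ cong (_* b) (sym (ℚₚ.*-inverseˡ a)) ⟩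
    (1/ a) * a * b ≡⟨ ℚₚ.*-assoc (1/ a) a b ⟩
    (1/ a) * (a * b) ≡⟨ cong ((1/ a) *_) ab≡0 ⟩
    (1/ a) * 0ℚ ≡⟨ ℚₚ.*-zeroʳ (1/ a) ⟩
    0ℚ ∎)
    where
    open ≡-Reasoning
    instance
      a-nonZero : NonZero a
      a-nonZero = ≢-nonZero a≢0

  cleared-degree : ∀ {f c p m} → c ≢ + 0 → Cleared f c p → ℚ[x].HasDegree f m →
    Degree m (truncate (suc m) p) × truncate (suc m) p ℤ[x].≈ₚ p
  cleared-degree {f} {c} {p} {m} c≢0 (coeffs , _) (top≢0 , above) =
    degree (length-truncate (suc m) p)
      (λ e → ℚ-nonzero-* (cast-nonzero c≢0) top≢0 (trans (sym (coeffs m))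
        (trans (cong cast (trans (sym (coeff-truncate (suc m) p ℕₚ.≤-refl)) e)) ⟨0⟩))) ,
    truncate-≈ (suc m) p λ i m<i → cast-injective (trans (coeffs i)
      (trans (cong (cast c *_) (above i m<i)) (trans (ℚₚ.*-zeroʳ (cast c)) (sym ⟨0⟩))))

  -- One of the two rational factors vanishes at `z`, and its degree is at most d - 1 because the
  -- other is not constant. Which one it is cannot be decided, hence the double negation.
  reducible-degree : ∀ {P d z k} → ℤ[x].HasDegree P d → Reducible (toℚ[x] P) → Vanishes P z →
    MinPoly z k → ¬ ¬ (suc k ℕ.≤ d)
  reducible-degree {P} {d} {z} {k} (_ , P<) (f , g , m , n , 1≤m , 1≤n , deg-f , deg-g , P≈) null M k≮d
    with clearDenominators f | clearDenominators g
  ... | c , p , c≢0 , cleared-p | e , q , e≢0 , cleared-q =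
    p-not-vanishing (not-apart⇒null (ev-cauchy p z) λ apart → q-not-vanishing (null-cancelˡ apart product-null))
    where
    m+n≤d : m ℕ.+ n ℕ.≤ d
    m+n≤d = ℕₚ.≮⇒≥ λ d<m+n → ℚ-nonzero-* (proj₁ deg-f) (proj₁ deg-g)
      (trans (sym (PolyQ.*ₚ-top f g (λ i m<i → proj₂ deg-f i m<i) (λ i n<i → proj₂ deg-g i n<i)))
        (trans (sym (P≈ (m ℕ.+ n))) (trans (coeff-toℚ P (m ℕ.+ n))
          (trans (cong cast (P< (m ℕ.+ n) d<m+n)) ⟨0⟩))))

    product-null : Null (λ i → values p z i ⊗ values q z i)
    product-null = null-cong
      (λ i → trans (cong ((ιᴷ c ⊗ ιᴷ e) ⊗_) (sym (value≡ i)))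
        (trans (KS.solve 4 (λ c e f g → (c KS.:* e) KS.:* (f KS.:* g) KS.:= (c KS.:* f) KS.:* (e KS.:* g))
            refl (ιᴷ c) (ιᴷ e) (F i) (G i))
          (cong₂ _⊗_ (sym (proj₂ cleared-p (at z i))) (sym (proj₂ cleared-q (at z i))))))
      (null-*ˡ {λ _ → ιᴷ c ⊗ ιᴷ e} (‖ ιᴷ c ⊗ ιᴷ e ‖ , 0≤‖‖ (ιᴷ c ⊗ ιᴷ e) , 0 , λ _ _ → ℚₚ.≤-refl) null)
      where
      F G : ℕ → K
      F i = EvQ.ev f (at z i)
      G i = EvQ.ev g (at z i)
      value≡ : ∀ i → F i ⊗ G i ≡ values P z i
      value≡ i = trans (sym (EvQ.ev-* f g (at z i)))
        (trans (sym (EvQ.ev-≈ (toℚ[x] P) (f ℚ[x].*ₚ g) (at z i) P≈)) (ev-toℚ P (at z i)))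

    p-not-vanishing : ¬ Vanishes p z
    p-not-vanishing p-null with cleared-degree {f} {c} {p} c≢0 cleared-p deg-f
    ... | deg-p , p≈ = k≮d (ℕₚ.≤-trans (s≤s (degree≤ M (_ , deg-p , vanishes-≈ p (truncate (suc m) p) z
        (λ i → sym (p≈ i)) p-null)))
      (ℕₚ.≤-trans (ℕₚ.≤-trans (ℕₚ.≤-reflexive (ℕₚ.+-comm 1 m)) (ℕₚ.+-monoʳ-≤ m 1≤n)) m+n≤d))

    q-not-vanishing : ¬ Vanishes q z
    q-not-vanishing q-null with cleared-degree {g} {e} {q} e≢0 cleared-q deg-g
    ... | deg-q , q≈ = k≮d (ℕₚ.≤-trans (s≤s (degree≤ M (_ , deg-q , vanishes-≈ q (truncate (suc n) q) z
        (λ i → sym (q≈ i)) q-null)))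
      (ℕₚ.≤-trans (ℕₚ.+-monoˡ-≤ n 1≤m) m+n≤d))

-- Separation of roots with different minimal polynomials.

module Separation where

  open IntPoly
  open Siegel
  open Gelfond using (evℤ; synth; gelfondConstant; gelfond)
  open Rationals
  open Gaussian
  open Resultant
  open GaussianSolver
  open Cases
  open Linear
  open Analysis
  open MinimalPoly
  import Data.Nat.Solver
  open import Data.Rational.Base hiding (truncate)
  open import Data.Rational.Properties
  open import Data.Rational.Solver using (module +-*-Solver)

  open ℤ[x]
  open MinPoly
  open +-*-Solver using (solve; _:=_; _:+_; _:*_; _:-_; :-_; con)
  private
    module KS = K-Solver
    module ℕS = Data.Nat.Solver.+-*-Solver

  sup : (ℕ → ℕ) → ℕ → ℕ
  sup f zero    = f 0
  sup f (suc n) = sup f n ℕ.⊔ f (suc n)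

  ≤sup : ∀ f {i n} → i ℕ.≤ n → f i ℕ.≤ sup f n
  ≤sup f {n = zero}  z≤n = ℕₚ.≤-refl
  ≤sup f {i} {suc n} i≤n with ℕₚ.m≤n⇒m<n∨m≡n i≤n
  ... | inj₁ (s≤s i≤n′) = ℕₚ.≤-trans (≤sup f i≤n′) (ℕₚ.m≤m⊔n _ _)
  ... | inj₂ refl       = ℕₚ.m≤n⊔m _ _

  difference : ℂ → ℂ → ℕ → K
  difference α β n = at α n ⊕ (⊖ at β n)

  difference-flip : ∀ α β n → ‖ difference α β n ‖ ≡ ‖ difference β α n ‖
  difference-flip α β n = trans (sym (‖⊖‖ (difference α β n)))
    (cong ‖_‖ (KS.solve 2 (λ x y → KS.:- (x KS.:+ (KS.:- y)) KS.:= y KS.:+ (KS.:- x)) refl (at α n) (at β n)))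

  SeparatedBy : ℕ → ℂ → ℂ → Set
  SeparatedBy C α β = ∃[ N ] ∀ n → N ℕ.≤ n → 1ℚ ≤ ⟨ C ⟩ * ‖ difference α β n ‖

  separated-≤ : ∀ {C D} α β → C ℕ.≤ D → SeparatedBy C α β → SeparatedBy D α β
  separated-≤ α β C≤D (N , h) = N , λ n N≤n →
    ≤-trans (h n N≤n) (*-monoʳ₀ (0≤‖‖ (difference α β n)) (⟨⟩-mono C≤D))

  separated-sym : ∀ {C} α β → SeparatedBy C α β → SeparatedBy C β α
  separated-sym {C} α β (N , h) = N , λ n N≤n →
    subst (λ x → 1ℚ ≤ ⟨ C ⟩ * x) (difference-flip α β n) (h n N≤n)

  absorb : ∀ {x D X} → 1ℚ ≤ x + D * X → x ≤ ½ → 1ℚ ≤ (two * D) * X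
  absorb {x} {D} {X} le x≤½ = begin
    1ℚ ≡⟨ refl ⟩
    two * (1ℚ - ½) ≤⟨ *-monoˡ₀ 0≤two (+-monoˡ-≤ (- ½) (≤-trans le (+-monoˡ-≤ (D * X) x≤½))) ⟩
    two * (½ + D * X - ½)
      ≡⟨ solve 3 (λ h D X → con two :* (h :+ D :* X :- h) := con two :* D :* X) refl ½ D X ⟩
    (two * D) * X ∎
    where open ≤-Reasoning

  1≤⟨⟩* : ∀ {C X} → 1 ℕ.≤ C → 1ℚ ≤ X → 1ℚ ≤ ⟨ C ⟩ * X
  1≤⟨⟩* {C} {X} 1≤C 1≤X = subst (_≤ ⟨ C ⟩ * X) (*-identityˡ 1ℚ)
    (*-mono₀ 0≤1 (subst (_≤ ⟨ C ⟩) ⟨1⟩ (⟨⟩-mono 1≤C)) 0≤1 1≤X)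

  two≡ : two ≡ ⟨ 2 ⟩
  two≡ = sym (trans (⟨⟩-+ 1 1) (cong₂ _+_ ⟨1⟩ ⟨1⟩))

  two↑ : ∀ e → two ↑ e ≡ ⟨ 2 ℕ.^ e ⟩
  two↑ e = trans (cong (_↑ e) two≡) (sym (⟨⟩-^ 2 e))

  0≤lossFactor : ∀ m′ n′ F G 1≤F 1≤G f g f≤F g≤G f< g< ind →
    0ℚ ≤ lossFactor m′ n′ F G 1≤F 1≤G f g f≤F g≤G f< g< ind
  0≤lossFactor m′ n′ F G 1≤F 1≤G f g f≤F g≤G f< g< ind =
    0≤* (0≤↑ 0≤two (m′ ℕ.+ suc n′)) (0≤+
      (0≤* (0≤⟨⟩ (suc n′)) (0≤⟨⟩ (siegelScale m′ n′ F G ℕ.* G)))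
      (0≤* (0≤⟨⟩ (suc m′)) (0≤⟨⟩ (siegelScale m′ n′ F G ℕ.* F))))

  -- Once the polynomials are fixed, the precision η is taken so small that the loss term is at most
  -- ½; moving it to the other side costs the outer factor 2.
  distinct-separated : ∀ {α β} m′ n′ (M : MinPoly α (suc m′)) (N : MinPoly β (suc n′)) →
    Apart (values (poly M) β) →
    SeparatedBy (2 ℕ.* (2 ℕ.^ (m′ ℕ.+ suc n′) ℕ.* (distinctConstant m′ n′ ℕ.*
      (siegelScale m′ n′ (height (poly M)) (height (poly N)) ℕ.* (height (poly M) ℕ.* height (poly N)))))) α β
  distinct-separated {α} {β} m′ n′ M N apart = separate (scale-down L ½ 0≤L 0<½)
    where
    f g : Poly
    f = poly M
    g = poly N
    independent : Independent (suc m′) (suc n′) f g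
    independent = independent-distinct M N apart
    L : ℚ
    L = distinctLoss m′ n′ f g (deg M) (deg N) independent
    0≤L : 0ℚ ≤ L
    0≤L = 0≤lossFactor m′ n′ (height f) (height g) (1≤height f (deg M)) (1≤height g (deg N)) f g
        (coeff≤height f) (coeff≤height g)
      (below (deg M)) (below (deg N)) independent
    S T D E : ℕ
    S = distinctConstant m′ n′ ℕ.* (siegelScale m′ n′ (height f) (height g) ℕ.* (height f ℕ.* height g))
    T = 2 ℕ.^ (m′ ℕ.+ suc n′)
    D = T ℕ.* S
    E = 2 ℕ.* D
    1≤E : 1 ℕ.≤ E
    1≤E = ℕₚ.*-mono-≤ {1} {2} (s≤s z≤n) (ℕₚ.*-mono-≤ (1≤^ {2} (m′ ℕ.+ suc n′) (s≤s z≤n))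
      (ℕₚ.*-mono-≤ (ℕₚ.*-mono-≤ {1} {suc m′ ℕ.+ suc n′} (s≤s z≤n)
          (ℕₚ.*-mono-≤ (1≤^ {suc (suc n′)} 2 (s≤s z≤n)) (1≤^ {2} (suc n′) (s≤s z≤n))))
        (ℕₚ.*-mono-≤ (1≤siegelScale m′ n′ (1≤height f (deg M)) (1≤height g (deg N)))
          (ℕₚ.*-mono-≤ (1≤height f (deg M)) (1≤height g (deg N))))))
    D≡ : two ↑ (m′ ℕ.+ suc n′) * ⟨ S ⟩ ≡ ⟨ D ⟩
    D≡ = trans (cong (_* ⟨ S ⟩) (two↑ (m′ ℕ.+ suc n′))) (sym (⟨⟩-* T S))
    E≡ : two * ⟨ D ⟩ ≡ ⟨ E ⟩
    E≡ = trans (cong (_* ⟨ D ⟩) two≡) (sym (⟨⟩-* 2 D))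

    separate : ∃[ η ] 0ℚ < η × L * η ≤ ½ → SeparatedBy E α β
    separate (η , 0<η , Lη≤½) = combine (vanishes M η 0<η) (vanishes N η 0<η)
      where
      combine : _ → _ → SeparatedBy E α β
      combine (A , fα≤) (B , gβ≤) = A ℕ.⊔ B , bound
        where
        bound : ∀ n → A ℕ.⊔ B ℕ.≤ n → 1ℚ ≤ ⟨ E ⟩ * ‖ difference α β n ‖
        bound n p with ≤-total ‖ difference α β n ‖ 1ℚ
        -- `distinct-factors` needs ‖u‖ ≤ 1. At larger distance the constant being at least 1 is
        -- enough.
        ... | inj₂ 1≤X = 1≤⟨⟩* 1≤E 1≤X
        ... | inj₁ X≤1 = subst₂ (λ e x → 1ℚ ≤ e * x) E≡ (sym (difference-flip α β n))
          (absorb {L * η} {⟨ D ⟩} {‖ difference β α n ‖} (subst (λ e → 1ℚ ≤ L * η + e * ‖ difference β α n ‖) D≡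
            (distinct-factors m′ n′ f g (deg M) (deg N) independent (at α n) (difference β α n) η
              (subst (_≤ 1ℚ) (difference-flip α β n) X≤1) (<⇒≤ 0<η)
              (fα≤ n (ℕₚ.m⊔n≤o⇒m≤o A B p))
              (subst (λ z → ‖ ev g z ‖ ≤ η)
                (KS.solve 2 (λ x y → y KS.:= x KS.:+ (y KS.:+ (KS.:- x))) refl (at α n) (at β n))
                (gβ≤ n (ℕₚ.m⊔n≤o⇒n≤o A B p))))) Lη≤½)

  quot-synth : ∀ b f y → quot f (ιᴷ b) y ≡ ev (synth b f) y
  quot-synth b []          y = refl
  quot-synth b (a ∷ [])    y = trans (⊕-identityˡ (y ⊗ 0ᴷ)) (⊗-zeroʳ y)
  quot-synth b (a ∷ c ∷ f) y = cong₂ (λ u v → u ⊕ (y ⊗ v)) (ev-ιᴷ (c ∷ f) b) (quot-synth b (c ∷ f) y)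

  -- The only root of ±x + b₀ is the integer ∓b₀.
  linear-root : Poly → ℤ
  linear-root q = ℤ.- (coeff q 1 ℤ.* coeff q 0)

  unit-square : ∀ a → ℤ.∣ a ∣ ≡ 1 → a ℤ.* a ≡ + 1
  unit-square (+ 1)      refl = refl
  unit-square -[1+ 0 ]   refl = refl

  linear-value : ∀ q → Degree 1 q → ℤ.∣ coeff q 1 ∣ ≡ 1 → ∀ x →
    x ⊕ (⊖ ιᴷ (linear-root q)) ≡ ιᴷ (coeff q 1) ⊗ ev q x
  linear-value (b₀ ∷ b₁ ∷ []) deg-q unit x = begin
    x ⊕ (⊖ ιᴷ (ℤ.- (b₁ ℤ.* b₀)))
      ≡⟨ cong (λ z → x ⊕ (⊖ z)) (trans (trans (cong real (cast-neg (b₁ ℤ.* b₀))) (real-neg _))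
          (cong ⊖_ (ιᴷ-* b₁ b₀))) ⟩
    x ⊕ (⊖ (⊖ (ιᴷ b₁ ⊗ ιᴷ b₀)))
      ≡⟨ KS.solve 3 (λ x b₁ b₀ → x KS.:+ (KS.:- (KS.:- (b₁ KS.:* b₀))) KS.:= b₁ KS.:* b₀ KS.:+ x KS.:*
          KS.con (+ 1)) refl x (ιᴷ b₁) (ιᴷ b₀) ⟩
    (ιᴷ b₁ ⊗ ιᴷ b₀) ⊕ (x ⊗ ιᴷ (+ 1))
      ≡⟨ cong (λ z → (ιᴷ b₁ ⊗ ιᴷ b₀) ⊕ (x ⊗ z)) (trans (cong ιᴷ (sym (unit-square b₁ unit))) (ιᴷ-* b₁ b₁)) ⟩
    (ιᴷ b₁ ⊗ ιᴷ b₀) ⊕ (x ⊗ (ιᴷ b₁ ⊗ ιᴷ b₁))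
      ≡⟨ KS.solve 3 (λ x b₁ b₀ → b₁ KS.:* b₀ KS.:+ x KS.:* (b₁ KS.:* b₁) KS.:= b₁ KS.:*
          (b₀ KS.:+ x KS.:* b₁)) refl x (ιᴷ b₁) (ιᴷ b₀) ⟩
    ιᴷ b₁ ⊗ (ιᴷ b₀ ⊕ (x ⊗ ιᴷ b₁))
      ≡⟨ cong (λ z → ιᴷ b₁ ⊗ (ιᴷ b₀ ⊕ (x ⊗ z))) (sym (trans (cong (ιᴷ b₁ ⊕_) (⊗-zeroʳ x))
          (⊕-identityʳ (ιᴷ b₁)))) ⟩
    ιᴷ b₁ ⊗ (ιᴷ b₀ ⊕ (x ⊗ (ιᴷ b₁ ⊕ (x ⊗ 0ᴷ)))) ∎
    where open ≡-Reasoning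

  module LinearCase {α β : ℂ} (f : Poly) (N : MinPoly β 1)
    (unit : ℤ.∣ coeff (poly N) 1 ∣ ≡ 1) (f-apart : Apart (values f β)) where

    private
      q : Poly
      q = poly N
      b : ℤ
      b = linear-root q

    near-root : ∀ x {η} → ‖ ev q x ‖ ≤ η → ‖ x ⊕ (⊖ ιᴷ b) ‖ ≤ η
    near-root x {η} qx≤ = begin
      ‖ x ⊕ (⊖ ιᴷ b) ‖ ≡⟨ cong ‖_‖ (linear-value q (deg N) unit x) ⟩
      ‖ ιᴷ (coeff q 1) ⊗ ev q x ‖ ≤⟨ ‖⊗‖ (ιᴷ (coeff q 1)) (ev q x) ⟩
      ‖ ιᴷ (coeff q 1) ‖ * ‖ ev q x ‖
        ≡⟨ cong (_* ‖ ev q x ‖) (trans (‖ιᴷ‖ (coeff q 1)) (trans (cong ⟨_⟩ unit) ⟨1⟩)) ⟩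
      1ℚ * ‖ ev q x ‖ ≡⟨ *-identityˡ _ ⟩
      ‖ ev q x ‖ ≤⟨ qx≤ ⟩
      η ∎
      where open ≤-Reasoning

    -- If f(b) = 0, then X - b divides f. Since β = b in the limit, f would vanish at β.
    root-value≢0 : evℤ f b ≢ + 0
    root-value≢0 fb≡0 = apart⇒not-null f-apart
      (null-cong (λ n → factorisation (at β n)) (null-*ˡ (values-bounded (synth b f) β) near-null))
      where
      near-null : Null (λ n → at β n ⊕ (⊖ ιᴷ b))
      near-null ε 0<ε with vanishes N ε 0<ε
      ... | A , h = A , λ n p → near-root (at β n) (h n p)
      factorisation : ∀ y → ev (synth b f) y ⊗ (y ⊕ (⊖ ιᴷ b)) ≡ ev f y
      factorisation y = begin
        ev (synth b f) y ⊗ (y ⊕ (⊖ ιᴷ b))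
          ≡⟨ cong (_⊗ (y ⊕ (⊖ ιᴷ b))) (sym (quot-synth b f y)) ⟩
        quot f (ιᴷ b) y ⊗ (y ⊕ (⊖ ιᴷ b))
          ≡⟨ KS.solve 2 (λ q u → q KS.:* u KS.:= KS.con (+ 0) KS.:+ u KS.:* q) refl (quot f (ιᴷ b) y)
              (y ⊕ (⊖ ιᴷ b)) ⟩
        ιᴷ (+ 0) ⊕ ((y ⊕ (⊖ ιᴷ b)) ⊗ quot f (ιᴷ b) y)
          ≡⟨ cong₂ (λ e z → e ⊕ ((y ⊕ (⊖ ιᴷ b)) ⊗ quot f (ιᴷ b) z))
               (trans (cong ιᴷ (sym fb≡0)) (sym (ev-ιᴷ f b))) (sym shift) ⟩
        ev f (ιᴷ b) ⊕ ((y ⊕ (⊖ ιᴷ b)) ⊗ quot f (ιᴷ b) (ιᴷ b ⊕ (y ⊕ (⊖ ιᴷ b))))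
          ≡⟨ sym (ev-quot f (ιᴷ b) (y ⊕ (⊖ ιᴷ b))) ⟩
        ev f (ιᴷ b ⊕ (y ⊕ (⊖ ιᴷ b))) ≡⟨ cong (ev f) shift ⟩
        ev f y ∎
        where
        open ≡-Reasoning
        shift : ιᴷ b ⊕ (y ⊕ (⊖ ιᴷ b)) ≡ y
        shift = KS.solve 2 (λ b y → b KS.:+ (y KS.:+ (KS.:- b)) KS.:= y) refl (ιᴷ b) y

    root≤height : ℤ.∣ b ∣ ℕ.≤ height q
    root≤height = subst (ℕ._≤ height q) (sym (trans (ℤₚ.∣-i∣≡∣i∣ (coeff q 1 ℤ.* coeff q 0))
      (trans (ℤₚ.abs-* (coeff q 1) (coeff q 0)) (trans (cong (ℕ._* ℤ.∣ coeff q 0 ∣) unit) (ℕₚ.*-identityˡ _)))))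
      (coeff≤height q 0)

    -- The estimate is made at the exact integer b, which the approximations of β only approach: |α
    -- - b| ≤ |α - β| + η. The error is η from f(α) and D η from this shift, hence the factor 1 + D.
    separated-from-root : Vanishes f α → ∀ D → 1 ℕ.≤ D →
      (∀ u {η} → 0ℚ ≤ η → ‖ u ‖ ≤ 1ℚ → ‖ ev f (ιᴷ b ⊕ u) ‖ ≤ η → 1ℚ ≤ η + ⟨ D ⟩ * ‖ u ‖) →
      SeparatedBy (2 ℕ.* D) α β
    separated-from-root null D 1≤D value-bound = separate (scale-down (1ℚ + ⟨ D ⟩) ½ (0≤+ 0≤1 (0≤⟨⟩ D)) 0<½)
      where
      open ≤-Reasoning
      separate : ∃[ η ] 0ℚ < η × (1ℚ + ⟨ D ⟩) * η ≤ ½ → SeparatedBy (2 ℕ.* D) α β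
      separate (η , 0<η , small) = combine (null η 0<η) (vanishes N η 0<η)
        where
        combine : _ → _ → SeparatedBy (2 ℕ.* D) α β
        combine (A , fα≤) (B , qβ≤) = A ℕ.⊔ B , bound
          where
          bound : ∀ n → A ℕ.⊔ B ℕ.≤ n → 1ℚ ≤ ⟨ 2 ℕ.* D ⟩ * ‖ difference α β n ‖
          bound n p = subst (λ e → 1ℚ ≤ e * X) (trans (cong (_* ⟨ D ⟩) two≡) (sym (⟨⟩-* 2 D)))
            (absorb {(1ℚ + ⟨ D ⟩) * η} {⟨ D ⟩} {X} before small)
            where
            X : ℚ
            X = ‖ difference α β n ‖
            u : K
            u = at α n ⊕ (⊖ ιᴷ b)
            u≤ : ‖ u ‖ ≤ X + η
            u≤ = begin
              ‖ u ‖
                ≡⟨ cong ‖_‖ (KS.solve 3 (λ x y b → x KS.:+ (KS.:- b) KS.:= (x KS.:+ (KS.:- y)) KS.:+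
                    (y KS.:+ (KS.:- b))) refl (at α n) (at β n) (ιᴷ b)) ⟩
              ‖ difference α β n ⊕ (at β n ⊕ (⊖ ιᴷ b)) ‖ ≤⟨ ‖⊕‖ _ _ ⟩
              X + ‖ at β n ⊕ (⊖ ιᴷ b) ‖
                ≤⟨ +-monoʳ-≤ X (near-root (at β n) (qβ≤ n (ℕₚ.m⊔n≤o⇒n≤o A B p))) ⟩
              X + η ∎
            before : 1ℚ ≤ (1ℚ + ⟨ D ⟩) * η + ⟨ D ⟩ * X
            before with ≤-total ‖ u ‖ 1ℚ
            ... | inj₁ u≤1 = begin
              1ℚ                          ≤⟨ value-bound u (<⇒≤ 0<η) u≤1 (subst (λ z → ‖ ev f z ‖ ≤ η)
                  (KS.solve 2 (λ x b → x KS.:= b KS.:+ (x KS.:+ (KS.:- b))) refl (at α n) (ιᴷ b))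
                      (fα≤ n (ℕₚ.m⊔n≤o⇒m≤o A B p))) ⟩
              η + ⟨ D ⟩ * ‖ u ‖ ≤⟨ +-monoʳ-≤ η (*-monoˡ₀ (0≤⟨⟩ D) u≤) ⟩
              η + ⟨ D ⟩ * (X + η)
                ≡⟨ solve 3 (λ h D X → h :+ D :* (X :+ h) := (con 1ℚ :+ D) :* h :+ D :* X) refl η (⟨ D ⟩) X ⟩
              (1ℚ + ⟨ D ⟩) * η + ⟨ D ⟩ * X ∎
            ... | inj₂ 1≤u = begin
              1ℚ ≤⟨ ≤-trans 1≤u u≤ ⟩
              X + η ≤⟨ p≤p+q (X + η) (0≤* (0≤⟨⟩ D) (<⇒≤ 0<η)) ⟩
              X + η + ⟨ D ⟩ * η
                ≡⟨ solve 3 (λ h D X → X :+ h :+ D :* h := (con 1ℚ :+ D) :* h :+ con 1ℚ :* X) refl η (⟨ D ⟩) X ⟩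
              (1ℚ + ⟨ D ⟩) * η + 1ℚ * X
                ≤⟨ +-monoʳ-≤ ((1ℚ + ⟨ D ⟩) * η) (*-monoʳ₀ (0≤‖‖ (difference α β n))
                    (subst (_≤ ⟨ D ⟩) ⟨1⟩ (⟨⟩-mono 1≤D))) ⟩
              (1ℚ + ⟨ D ⟩) * η + ⟨ D ⟩ * X ∎

-- Separation of two roots of one minimal polynomial.

module SameFactor where

  open IntPoly
  open Siegel
  open Rationals
  open Gaussian
  open Resultant
  open GaussianSolver
  open Cases
  open Analysis
  open MinimalPoly
  open Separation
  open import Data.Rational.Base hiding (truncate)
  open import Data.Rational.Properties
  open import Data.Rational.Solver using (module +-*-Solver)

  open ℤ[x]
  open MinPoly
  open +-*-Solver using (solve; _:=_; _:+_; _:*_; _:-_; :-_; con)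
  private
    module KS = K-Solver

  midpoint halfDifference : K → K → K
  midpoint a b = real ½ ⊗ (a ⊕ b)
  halfDifference a b = real ½ ⊗ (a ⊕ (⊖ b))

  ½⊕½ : real ½ ⊕ real ½ ≡ ιᴷ (+ 1)
  ½⊕½ = trans (sym (real-+ ½ ½)) (cong real (sym ⟨1⟩))

  halves : ∀ a → (real ½ ⊕ real ½) ⊗ a ≡ a
  halves a = trans (cong (_⊗ a) ½⊕½) (KS.solve 1 (λ a → KS.con (+ 1) KS.:* a KS.:= a) refl a)

  midpoint+ : ∀ a b → midpoint a b ⊕ halfDifference a b ≡ a
  midpoint+ a b = trans (KS.solve 3 (λ h a b → h KS.:* (a KS.:+ b) KS.:+ h KS.:* (a KS.:+ (KS.:- b))
      KS.:= (h KS.:+ h) KS.:* a) refl (real ½) a b) (halves a)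

  midpoint- : ∀ a b → midpoint a b ⊕ (⊖ halfDifference a b) ≡ b
  midpoint- a b = trans (KS.solve 3 (λ h a b → h KS.:* (a KS.:+ b) KS.:+
      (KS.:- (h KS.:* (a KS.:+ (KS.:- b)))) KS.:= (h KS.:+ h) KS.:* b) refl (real ½) a b) (halves b)

  ‖halfDifference‖ : ∀ a b → ‖ halfDifference a b ‖ + ‖ halfDifference a b ‖ ≡ ‖ a ⊕ (⊖ b) ‖
  ‖halfDifference‖ a b = trans (sym (‖x⊕x‖ (halfDifference a b))) (cong ‖_‖
    (trans (KS.solve 2 (λ h x → h KS.:* x KS.:+ h KS.:* x KS.:= (h KS.:+ h) KS.:* x) refl (real ½)
        (a ⊕ (⊖ b))) (halves (a ⊕ (⊖ b)))))

  -- Here x is at most d/2, so 1 ≤ 2 E d² ≤ (2 κ d)² and a root can be taken. The sum d + d is the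
  -- distance of the two roots, d being measured from the midpoint.
  quadratic-gap : ∀ {d x E κ} → 0ℚ < d → 0ℚ ≤ κ → 0ℚ ≤ E → E ≤ κ * κ →
    d ≤ x + E * (d * d * d) → x ≤ (d + d) * ½ * ½ → 1ℚ ≤ κ * (d + d)
  quadratic-gap {d} {x} {E} {κ} 0<d 0≤κ 0≤E E≤κ² d≤ x≤ =
    square-cancel (0≤* 0≤κ (0≤+ 0≤d 0≤d)) (begin
      1ℚ * 1ℚ ≡⟨ refl ⟩
      1ℚ ≤⟨ *-cancelʳ₀ 0<d bound ⟩
      two * E * (d * d)
        ≤⟨ *-monoʳ₀ (0≤* 0≤d 0≤d) (≤-trans (*-monoˡ₀ 0≤two E≤κ²)
            (p≤p+q (two * (κ * κ)) (0≤* 0≤two (0≤* 0≤κ 0≤κ)))) ⟩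
      (two * (κ * κ) + two * (κ * κ)) * (d * d)
        ≡⟨ solve 2 (λ κ d → (con two :* (κ :* κ) :+ con two :* (κ :* κ)) :* (d :* d) := (κ :* (d :+ d))
            :* (κ :* (d :+ d))) refl κ d ⟩
      (κ * (d + d)) * (κ * (d + d)) ∎)
    where
    open ≤-Reasoning
    0≤d : 0ℚ ≤ d
    0≤d = <⇒≤ 0<d
    bound : 1ℚ * d ≤ two * E * (d * d) * d
    bound = begin
      1ℚ * d ≡⟨ solve 1 (λ d → con 1ℚ :* d := con two :* (d :- (d :+ d) :* con ½ :* con ½)) refl d ⟩
      two * (d - (d + d) * ½ * ½)
        ≤⟨ *-monoˡ₀ 0≤two (+-monoˡ-≤ (- ((d + d) * ½ * ½)) (≤-trans d≤ (+-monoˡ-≤ (E * (d * d * d)) x≤))) ⟩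
      two * ((d + d) * ½ * ½ + E * (d * d * d) - (d + d) * ½ * ½)
        ≡⟨ solve 3 (λ y E d → con two :* (y :+ E :* (d :* d :* d) :- y) := con two :* E :* (d :* d) :*
            d) refl ((d + d) * ½ * ½) E d ⟩
      two * E * (d * d) * d ∎

  module _ {α β : ℂ} (m′ : ℕ) (M : MinPoly α (suc (suc m′))) where

    private
      m k H F e S : ℕ
      m = suc m′
      k = suc m
      H = height (poly M)
      F = 2 ℕ.* (k ℕ.* H)
      e = m′ ℕ.+ m
      S = sameConstant m′ ℕ.* (siegelScale m′ m′ F F ℕ.* (F ℕ.* F))
      q : Poly
      q = poly M

    same-separated : Vanishes q β → Apart (values (truncate k (deriv q)) α) → Apart (difference α β) →
      ∀ κ → 1 ℕ.≤ κ → 2 ℕ.^ e ℕ.* S ℕ.≤ κ ℕ.* κ → SeparatedBy κ α β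
    same-separated nullβ apart-deriv (δ , 0<δ , C , δ≤) κ 1≤κ E≤κ² =
      -- The whole inequality is proportional to d, so the error must be small relative to d: with δ
      -- ≤ 2d, an error of δ/4 is at most d/2.
      separate (scale-down L (δ * ½ * ½) 0≤L (half (half 0<δ)))
      where
      independent : Independent m m (truncate k (deriv q)) (truncate k (coderiv k q))
      independent = independent-derivative M apart-deriv
      L₀ L E : ℚ
      L₀ = sameLoss m′ q (deg M) independent
      L = L₀ * ⟨ k ℕ.+ 2 ⟩
      E = two ↑ e * ⟨ S ⟩
      0≤L : 0ℚ ≤ L
      0≤L = 0≤* (0≤sameLoss m′ q (deg M) independent) (0≤⟨⟩ (k ℕ.+ 2))
      E≤ : E ≤ ⟨ κ ⟩ * ⟨ κ ⟩
      E≤ = subst₂ _≤_ (trans (⟨⟩-* (2 ℕ.^ e) S) (cong (_* ⟨ S ⟩) (sym (two↑ e)))) (⟨⟩-* κ κ) (⟨⟩-mono E≤κ²)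

      separate : ∃[ η ] 0ℚ < η × L * η ≤ δ * ½ * ½ → SeparatedBy κ α β
      separate (η , 0<η , Lη≤) = combine (vanishes M η 0<η) (nullβ η 0<η)
        where
        combine : _ → _ → SeparatedBy κ α β
        combine (A , qα≤) (B , qβ≤) = (A ℕ.⊔ B) ℕ.⊔ C , bound
          where
          bound : ∀ n → (A ℕ.⊔ B) ℕ.⊔ C ℕ.≤ n → 1ℚ ≤ ⟨ κ ⟩ * ‖ difference α β n ‖
          bound n p with ≤-total ‖ difference α β n ‖ 1ℚ
          ... | inj₂ 1≤X = 1≤⟨⟩* 1≤κ 1≤X
          ... | inj₁ X≤1 = subst (λ X → 1ℚ ≤ ⟨ κ ⟩ * X) d+d≡X
            (quadratic-gap {d} {L * η} {E} {⟨ κ ⟩} 0<d (0≤⟨⟩ κ) (0≤* (0≤↑ 0≤two e) (0≤⟨⟩ S)) E≤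
              (subst (λ l → d ≤ l + E * (d * d * d)) (sym (*-assoc L₀ ⟨ k ℕ.+ 2 ⟩ η))
                (same-factor m′ q (deg M) independent (midpoint a b) u η
                  (≤-trans (p≤p+q d (0≤‖‖ u)) (≤-trans (≤-reflexive d+d≡X) X≤1)) (<⇒≤ 0<η)
                  (subst (λ z → ‖ ev q z ‖ ≤ η) (sym (midpoint+ a b)) (qα≤ n (ℕₚ.m⊔n≤o⇒m≤o A B pAB)))
                  (subst (λ z → ‖ ev q z ‖ ≤ η) (sym (midpoint- a b)) (qβ≤ n (ℕₚ.m⊔n≤o⇒n≤o A B pAB)))))
              (≤-trans Lη≤ (*-monoʳ₀ (<⇒≤ 0<½) (*-monoʳ₀ (<⇒≤ 0<½) δ≤d+d))))
            where
            pAB : A ℕ.⊔ B ℕ.≤ n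
            pAB = ℕₚ.m⊔n≤o⇒m≤o (A ℕ.⊔ B) C p
            a b u : K
            a = at α n
            b = at β n
            u = halfDifference a b
            d : ℚ
            d = ‖ u ‖
            d+d≡X : d + d ≡ ‖ difference α β n ‖
            d+d≡X = ‖halfDifference‖ a b
            δ≤d+d : δ ≤ d + d
            δ≤d+d = subst (δ ≤_) (sym d+d≡X) (δ≤ n (ℕₚ.m⊔n≤o⇒n≤o (A ℕ.⊔ B) C p))
            0<d : 0ℚ < d
            0<d = subst (0ℚ <_) (solve 1 (λ d → (d :+ d) :* con ½ := d) refl d)
              (half (<-≤-trans 0<δ δ≤d+d))

-- Uniform constants, and the separation of all roots of P.

module RootSeparation where

  open IntPoly
  open Siegel
  open Gelfond using (gelfondConstant; gelfond)
  open Rationals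
  open Gaussian
  open Resultant
  open GaussianSolver
  open Cases
  open Linear
  open Analysis
  open MinimalPoly
  open Separation
  open SameFactor
  open import Data.Nat.Base using (_^_; _*_; _+_; _≤_)
  open import Data.Nat.Properties
  open import Data.Nat.Solver using (module +-*-Solver)
  open import Data.Rational.Base using (1ℚ)

  open ℤ[x]
  open MinPoly
  open +-*-Solver using (solve; _:=_; _:+_; _:*_; con)
  private module KS = K-Solver

  ^-mono : ∀ {a b m n} → a ≤ b → 1 ≤ b → m ≤ n → a ^ m ≤ b ^ n
  ^-mono {a} {suc b} {m} {n} a≤b _ m≤n = ≤-trans (^-monoˡ-≤ m a≤b) (^-monoʳ-≤ (suc b) m≤n)

  m≤m*m : ∀ m → m ≤ m * m
  m≤m*m zero    = z≤n
  m≤m*m (suc m) = m≤m*n (suc m) (suc m)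

  sameFactorCoeff distinctCoeff′ : ℕ → ℕ
  sameFactorCoeff m′ = 2 ^ (m′ + suc m′) * (sameConstant m′ * siegelConstant (suc m′ + suc m′))
  distinctCoeff : ℕ → ℕ → ℕ
  distinctCoeff m′ n′ = 2 * (2 ^ (m′ + suc n′) * (distinctConstant m′ n′ * siegelConstant (suc m′ + suc n′)))
  distinctCoeff′ d′ = sup (λ m′ → sup (distinctCoeff m′) d′) d′

  -- For factors of a polynomial of degree d = d′ + 2 and height B, the products
  -- of their heights are at most heightFactor d′ * B.
  heightFactor : ℕ → ℕ
  heightFactor d′ = gelfondConstant (suc (suc d′)) * gelfondConstant (suc (suc d′))

  -- The `suc` keeps the base at least 1, so that its powers increase with the exponent.
  derivFactor : ℕ → ℕ
  derivFactor d′ = suc (2 * (suc (suc d′) * heightFactor d′))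

  -- A sum instead of a maximum over the cases. The last 2 belongs to two linear factors in degree
  -- 2, where B^d′ = 1.
  sameK distinctK linearK separationConstant : ℕ → ℕ
  sameK d′ = sup sameFactorCoeff d′ * derivFactor d′ ^ d′
  distinctK d′ = distinctCoeff′ d′ * heightFactor d′ ^ d′
  linearK d′ = 2 * (sup linearConstant d′ * heightFactor d′ ^ d′)
  separationConstant d′ = sameK d′ + (distinctK d′ + (linearK d′ + 2))

  siegelScale-* : ∀ m′ n′ F G → siegelScale m′ n′ F G * (F * G) ≡
    siegelConstant (suc m′ + suc n′) * (F ^ suc n′ * G ^ suc m′)
  siegelScale-* m′ n′ F G = trans (cong (_* (F * G)) (siegelScale≡ m′ n′ F G))
    (solve 5 (λ s f g F G → s :* (f :* g) :* (F :* G) := s :* ((F :* f) :* (G :* g))) refl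
      (siegelConstant (suc m′ + suc n′)) (F ^ n′) (G ^ m′) F G)

  -- The height enters as F^(2m) with m ≤ d - 2. Squaring the numerical coefficient as well makes
  -- the whole bound the square of a natural number.
  same-numeric : ∀ d′ B m′ H → 1 ≤ B → suc m′ ≤ d′ → H ≤ heightFactor d′ * B →
    let F = 2 * (suc (suc m′) * H) ; κ = sameK d′ * B ^ d′ in
    2 ^ (m′ + suc m′) * (sameConstant m′ * (siegelScale m′ m′ F F * (F * F))) ≤ κ * κ
  same-numeric d′ B m′ H 1≤B m≤d′ H≤ = begin
    2 ^ (m′ + m) * (sameConstant m′ * (siegelScale m′ m′ F F * (F * F)))
      ≡⟨ cong (λ z → 2 ^ (m′ + m) * (sameConstant m′ * z)) (siegelScale-* m′ m′ F F) ⟩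
    2 ^ (m′ + m) * (sameConstant m′ * (siegelConstant (m + m) * (F ^ m * F ^ m)))
      ≡⟨ solve 4 (λ a b c f → a :* (b :* (c :* (f :* f))) := a :* (b :* c) :* (f :* f)) refl
          (2 ^ (m′ + m)) (sameConstant m′) (siegelConstant (m + m)) (F ^ m) ⟩
    sameFactorCoeff m′ * (F ^ m * F ^ m)
      ≤⟨ *-mono-≤ (≤-trans (≤sup sameFactorCoeff (≤-trans (n≤1+n m′) m≤d′)) (m≤m*m Z)) (*-mono-≤ Fᵐ≤ Fᵐ≤) ⟩
    (Z * Z) * ((A ^ d′ * B ^ d′) * (A ^ d′ * B ^ d′))
      ≡⟨ solve 3 (λ z a b → (z :* z) :* ((a :* b) :* (a :* b)) := (z :* a :* b) :* (z :* a :* b)) refl Z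
          (A ^ d′) (B ^ d′) ⟩
    sameK d′ * B ^ d′ * (sameK d′ * B ^ d′) ∎
    where
    open ≤-Reasoning
    m F Z A : ℕ
    m = suc m′
    F = 2 * (suc m * H)
    Z = sup sameFactorCoeff d′
    A = derivFactor d′
    F≤ : F ≤ A * B
    F≤ = ≤-trans (*-monoʳ-≤ 2 (*-mono-≤ (s≤s (≤-trans m≤d′ (n≤1+n d′))) H≤))
      (≤-trans (≤-reflexive (solve 3 (λ d w b → con 2 :* (d :* (w :* b)) := con 2 :* (d :* w) :* b) refl
          (suc (suc d′)) (heightFactor d′) B))
        (*-monoˡ-≤ B (n≤1+n (2 * (suc (suc d′) * heightFactor d′)))))
    Fᵐ≤ : F ^ m ≤ A ^ d′ * B ^ d′
    Fᵐ≤ = ≤-trans (^-mono F≤ (*-mono-≤ {1} {A} (s≤s z≤n) 1≤B) m≤d′) (≤-reflexive (*-^ A B d′))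

  -- Both exponents are raised to d′ = d - 2, after which only the product F G occurs, and that is
  -- bounded by a multiple of B.
  distinct-numeric : ∀ d′ B m′ n′ F G → 1 ≤ F → 1 ≤ G → suc m′ ≤ d′ → suc n′ ≤ d′ →
    F * G ≤ heightFactor d′ * B →
    2 * (2 ^ (m′ + suc n′) * (distinctConstant m′ n′ * (siegelScale m′ n′ F G * (F * G)))) ≤
      distinctK d′ * B ^ d′
  distinct-numeric d′ B m′ n′ F G 1≤F 1≤G m≤d′ n≤d′ FG≤ = begin
    2 * (2 ^ (m′ + suc n′) * (distinctConstant m′ n′ * (siegelScale m′ n′ F G * (F * G))))
      ≡⟨ cong (λ z → 2 * (2 ^ (m′ + suc n′) * (distinctConstant m′ n′ * z))) (siegelScale-* m′ n′ F G) ⟩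
    2 * (2 ^ (m′ + suc n′) * (distinctConstant m′ n′ * (siegelConstant (suc m′ + suc n′) *
        (F ^ suc n′ * G ^ suc m′))))
      ≡⟨ solve 4 (λ a b c f → con 2 :* (a :* (b :* (c :* f))) := con 2 :* (a :* (b :* c)) :* f) refl
          (2 ^ (m′ + suc n′)) (distinctConstant m′ n′) (siegelConstant (suc m′ + suc n′))
          (F ^ suc n′ * G ^ suc m′) ⟩
    distinctCoeff m′ n′ * (F ^ suc n′ * G ^ suc m′)
      ≤⟨ *-mono-≤ (≤-trans (≤sup (distinctCoeff m′) (≤-trans (n≤1+n n′) n≤d′))
          (≤sup (λ m′ → sup (distinctCoeff m′) d′) (≤-trans (n≤1+n m′) m≤d′)))
           (*-mono-≤ (^-mono ≤-refl 1≤F n≤d′) (^-mono ≤-refl 1≤G m≤d′)) ⟩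
    distinctCoeff′ d′ * (F ^ d′ * G ^ d′) ≡⟨ cong (distinctCoeff′ d′ *_) (sym (*-^ F G d′)) ⟩
    distinctCoeff′ d′ * (F * G) ^ d′ ≤⟨ *-monoʳ-≤ (distinctCoeff′ d′) (^-monoˡ-≤ d′ FG≤) ⟩
    distinctCoeff′ d′ * (heightFactor d′ * B) ^ d′
      ≡⟨ cong (distinctCoeff′ d′ *_) (*-^ (heightFactor d′) B d′) ⟩
    distinctCoeff′ d′ * (heightFactor d′ ^ d′ * B ^ d′)
      ≡⟨ sym (*-assoc (distinctCoeff′ d′) (heightFactor d′ ^ d′) (B ^ d′)) ⟩
    distinctK d′ * B ^ d′ ∎
    where open ≤-Reasoning

  -- Completing F to F^d′ needs d′ ≥ 1, so d′ is given as a successor here.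
  linear-numeric : ∀ d″ B m′ F G → 1 ≤ F → 1 ≤ G → m′ ≤ suc d″ →
    F * G ≤ heightFactor (suc d″) * B →
    2 * (linearConstant m′ * F * G ^ m′) ≤ linearK (suc d″) * B ^ suc d″
  linear-numeric d″ B m′ F G 1≤F 1≤G m′≤ FG≤ = begin
    2 * (linearConstant m′ * F * G ^ m′)
      ≤⟨ *-monoʳ-≤ 2 (*-mono-≤ (*-mono-≤ (≤sup linearConstant m′≤) F≤) (^-mono ≤-refl 1≤G m′≤)) ⟩
    2 * (sup linearConstant d′ * F ^ d′ * G ^ d′)
      ≡⟨ cong (2 *_) (*-assoc (sup linearConstant d′) (F ^ d′) (G ^ d′)) ⟩
    2 * (sup linearConstant d′ * (F ^ d′ * G ^ d′))
      ≡⟨ cong (λ z → 2 * (sup linearConstant d′ * z)) (sym (*-^ F G d′)) ⟩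
    2 * (sup linearConstant d′ * (F * G) ^ d′)
      ≤⟨ *-monoʳ-≤ 2 (*-monoʳ-≤ (sup linearConstant d′) (^-monoˡ-≤ d′ FG≤)) ⟩
    2 * (sup linearConstant d′ * (heightFactor d′ * B) ^ d′)
      ≡⟨ cong (λ z → 2 * (sup linearConstant d′ * z)) (*-^ (heightFactor d′) B d′) ⟩
    2 * (sup linearConstant d′ * (heightFactor d′ ^ d′ * B ^ d′))
      ≡⟨ solve 3 (λ s w b → con 2 :* (s :* (w :* b)) := con 2 :* (s :* w) :* b) refl
          (sup linearConstant d′) (heightFactor d′ ^ d′) (B ^ d′) ⟩
    linearK d′ * B ^ d′ ∎
    where
    open ≤-Reasoning
    d′ : ℕ
    d′ = suc d″
    F≤ : F ≤ F ^ d′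
    F≤ = ≤-trans (≤-reflexive (sym (*-identityʳ F))) (*-monoʳ-≤ F (1≤^ d″ 1≤F))

  unit-factorˡ : ∀ a b c → a ℤ.* b ≡ c → ℤ.∣ c ∣ ≡ 1 → ℤ.∣ a ∣ ≡ 1
  unit-factorˡ a b c eq unit = m*n≡1⇒m≡1 ℤ.∣ a ∣ ℤ.∣ b ∣ (trans (sym (ℤₚ.abs-* a b))
      (trans (cong ℤ.∣_∣ eq) unit))

  unit-factorʳ : ∀ a b c → a ℤ.* b ≡ c → ℤ.∣ c ∣ ≡ 1 → ℤ.∣ b ∣ ≡ 1
  unit-factorʳ a b c eq unit = m*n≡1⇒n≡1 ℤ.∣ a ∣ ℤ.∣ b ∣ (trans (sym (ℤₚ.abs-* a b))
      (trans (cong ℤ.∣_∣ eq) unit))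

  apart-sym : ∀ α β → Apart (difference α β) → Apart (difference β α)
  apart-sym α β (δ , 0<δ , A , h) = δ , 0<δ , A , λ n p → subst (δ ℚ.≤_) (difference-flip α β n) (h n p)

  linear-injective : ∀ q α β → Degree 1 q → Vanishes q α → Vanishes q β → Null (difference α β)
  linear-injective (b₀ ∷ b₁ ∷ []) α β deg-q nullα nullβ = null-cancelˡ (apart-constant (top deg-q))
    (null-cong (λ n → trans (cong₂ (λ x y → x ⊕ (⊖ y)) (value (at α n)) (value (at β n)))
        (KS.solve 4 (λ b₀ b₁ x y → (b₀ KS.:+ x KS.:* b₁) KS.:+ (KS.:- (b₀ KS.:+ y KS.:* b₁)) KS.:= b₁
            KS.:* (x KS.:+ (KS.:- y)))
          refl (ιᴷ b₀) (ιᴷ b₁) (at α n) (at β n)))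
      (null-+ nullα (null-⊖ nullβ)))
    where
    value : ∀ x → ιᴷ b₀ ⊕ (x ⊗ (ιᴷ b₁ ⊕ (x ⊗ 0ᴷ))) ≡ ιᴷ b₀ ⊕ (x ⊗ ιᴷ b₁)
    value x = cong (λ z → ιᴷ b₀ ⊕ (x ⊗ z)) (trans (cong (ιᴷ b₁ ⊕_) (⊗-zeroʳ x)) (⊕-identityʳ (ιᴷ b₁)))

  module _ (d′ : ℕ) (P : Poly) (B : ℕ) (1≤B : 1 ≤ B) (P≤B : ∀ i → ℤ.∣ coeff P i ∣ ≤ B)
    (deg-P : Degree (suc (suc d′)) P) (unit-P : ℤ.∣ coeff P (suc (suc d′)) ∣ ≡ 1)
    (degree-bound : ∀ {z k} → Vanishes P z → MinPoly z k → ¬ ¬ (suc k ≤ suc (suc d′))) where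

    private
      d W G : ℕ
      d = suc (suc d′)
      G = gelfondConstant d
      W = heightFactor d′

    Separated : ℂ → ℂ → Set
    Separated α β = SeparatedBy (separationConstant d′ * B ^ d′) α β

    same≤ : sameK d′ * B ^ d′ ≤ separationConstant d′ * B ^ d′
    same≤ = *-monoˡ-≤ (B ^ d′) (m≤m+n (sameK d′) (distinctK d′ + (linearK d′ + 2)))

    distinct≤ : distinctK d′ * B ^ d′ ≤ separationConstant d′ * B ^ d′
    distinct≤ = *-monoˡ-≤ (B ^ d′) (≤-trans (m≤m+n (distinctK d′) (linearK d′ + 2))
        (m≤n+m (distinctK d′ + (linearK d′ + 2)) (sameK d′)))

    linear+2≤ : (linearK d′ + 2) * B ^ d′ ≤ separationConstant d′ * B ^ d′
    linear+2≤ = *-monoˡ-≤ (B ^ d′) (≤-trans (m≤n+m (linearK d′ + 2) (distinctK d′))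
        (m≤n+m (distinctK d′ + (linearK d′ + 2)) (sameK d′)))

    same-case : ∀ {α β k} (M : MinPoly α k) → height (poly M) ≤ W * B → Vanishes P α →
      Vanishes (poly M) β → Apart (difference α β) → ¬ ¬ Separated α β
    same-case {α} {β} {zero} M _ _ _ _ _ = constant-not-vanishing α (deg M) (vanishes M)
    same-case {α} {β} {suc zero} M _ _ nullβ apart _ =
      apart⇒not-null apart (linear-injective (poly M) α β (deg M) (vanishes M) nullβ)
    same-case {α} {β} {suc (suc m′)} M H≤ nullP nullβ apart none = degree-bound nullP M λ { (s≤s (s≤s m≤d′)) →
      deriv-not-vanishing M (not-apart⇒null (ev-cauchy (truncate (suc (suc m′)) (deriv (poly M))) α) λ
          deriv-apart →
        none (separated-≤ {sameK d′ * B ^ d′} α β same≤ (same-separated {α} {β} m′ M nullβ deriv-apart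
            apart (sameK d′ * B ^ d′)
          (1≤κ m≤d′) (same-numeric d′ B m′ (height (poly M)) 1≤B m≤d′ H≤)))) }
      where
      1≤κ : suc m′ ≤ d′ → 1 ≤ sameK d′ * B ^ d′
      1≤κ m≤d′ = *-mono-≤ (*-mono-≤ (≤-trans 1≤coeff (≤sup sameFactorCoeff (≤-trans (n≤1+n m′) m≤d′)))
          (1≤^ d′ (s≤s z≤n))) (1≤^ d′ 1≤B)
        where
        1≤coeff : 1 ≤ sameFactorCoeff m′
        1≤coeff = *-mono-≤ (1≤^ {2} (m′ + suc m′) (s≤s z≤n)) (*-mono-≤
          (*-mono-≤ {1} {suc m′ + suc m′} (s≤s z≤n) (*-mono-≤ {1} {2 * suc (suc (suc m′))} (s≤s z≤n)
            (*-mono-≤ (1≤^ {suc (suc (suc m′))} 4 (s≤s z≤n)) (1≤^ {2} (suc m′) (s≤s z≤n)))))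
          (subst (1 ≤_) (sym (siegelConstant≡ (suc m′ + suc m′))) (1≤^ (suc m′ + suc m′) (s≤s z≤n))))

    linear-case : ∀ {α β m} (M : MinPoly α m) (N : MinPoly β 1) → suc m ≤ d →
      ℤ.∣ coeff (poly M) m ∣ ≡ 1 → ℤ.∣ coeff (poly N) 1 ∣ ≡ 1 →
      height (poly M) * height (poly N) ≤ W * B → Apart (values (poly M) β) → Separated α β
    linear-case {α} {β} {zero} M N _ _ _ _ _ = ⊥-elim (constant-not-vanishing α (deg M) (vanishes M))
    linear-case {α} {β} {suc m′} M N (s≤s (s≤s m′≤d′)) unitM unitN FG≤ apart = bound d′ refl
      where
      open LinearCase {α} {β} (poly M) N unitN apart
      F H b : ℕ
      F = height (poly M)
      H = height (poly N)
      b = ℤ.∣ linear-root (poly N) ∣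
      1≤F : 1 ≤ F
      1≤F = 1≤height (poly M) (deg M)
      1≤H : 1 ≤ H
      1≤H = 1≤height (poly N) (deg N)
      -- d′ = 0 forces both factors to be linear and leaves no power of B to absorb
      -- `height (poly M)`.
      bound : ∀ e → e ≡ d′ → Separated α β
      bound zero 0≡d′ = separated-≤ α β (≤-trans {2} {2 * B ^ d′}
          (*-mono-≤ {2} {2} {1} ≤-refl (1≤^ d′ 1≤B)) (≤-trans
              (*-monoˡ-≤ (B ^ d′) (m≤n+m 2 (linearK d′))) linear+2≤))
        (separated-from-root (vanishes M) 1 ≤-refl λ u {η} 0≤η u≤1 value≤ →
          subst (λ o → 1ℚ ℚ.≤ η ℚ.+ o ℚ.* ‖ u ‖) (sym ⟨1⟩)
            (linear-linear (poly M) (subst (λ l → Degree (suc l) (poly M)) m′≡0 (deg M))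
              (subst (λ l → ℤ.∣ coeff (poly M) (suc l) ∣ ≡ 1) m′≡0 unitM) (linear-root (poly N)) u η
                  root-value≢0 value≤))
        where
        m′≡0 : m′ ≡ 0
        m′≡0 = n≤0⇒n≡0 (subst (m′ ≤_) (sym 0≡d′) m′≤d′)
      bound (suc e) refl = separated-≤ α β
        (≤-trans (linear-numeric e B m′ F H 1≤F 1≤H m′≤d′ FG≤)
          (≤-trans (*-monoˡ-≤ (B ^ d′) (m≤m+n (linearK d′) 2)) linear+2≤))
        (separated-from-root (vanishes M) (linearConstant m′ * F * H ^ m′)
          (*-mono-≤ (*-mono-≤ (*-mono-≤ (1≤^ {suc (suc m′)} 2 (s≤s z≤n)) (1≤^ {2} m′ (s≤s z≤n))) 1≤F)
              (1≤^ m′ 1≤H))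
          λ u {η} 0≤η u≤1 value≤ → linear-factor m′ (poly M) (deg M) (linear-root (poly N)) H u η
            root≤height 1≤H root-value≢0 u≤1 value≤)

    -- From m + n ≤ d, both degrees are at most d - 2 as soon as both are at least 2. A linear
    -- polynomial has to be treated apart, since its partner may have degree d - 1.
    distinct-case : ∀ {α β m n} (M : MinPoly α m) (N : MinPoly β n) → m + n ≤ d →
      ℤ.∣ coeff (poly M) m ∣ ≡ 1 → ℤ.∣ coeff (poly N) n ∣ ≡ 1 →
      height (poly M) * height (poly N) ≤ W * B →
      Apart (values (poly M) β) → Apart (values (poly N) α) → Separated α β
    distinct-case {α} {β} {zero} M N _ _ _ _ _ _ = ⊥-elim (constant-not-vanishing α (deg M) (vanishes M))
    distinct-case {α} {β} {suc m′} {zero} M N _ _ _ _ _ _ = ⊥-elim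
        (constant-not-vanishing β (deg N) (vanishes N))
    distinct-case {α} {β} {suc m′} {suc zero} M N m+n≤ unitM unitN FG≤ apartM _ =
      linear-case M N (subst (_≤ d) (+-comm (suc m′) 1) m+n≤) unitM unitN FG≤ apartM
    distinct-case {α} {β} {suc zero} {suc (suc n″)} M N m+n≤ unitM unitN FG≤ _ apartN =
      separated-sym {separationConstant d′ * B ^ d′} β α (linear-case N M m+n≤ unitN unitM
        (subst (_≤ W * B) (*-comm (height (poly M)) (height (poly N))) FG≤) apartN)
    distinct-case {α} {β} {suc (suc m″)} {suc (suc n″)} M N (s≤s (s≤s m″+n≤)) unitM unitN FG≤ apartM _ =
      separated-≤ α β (≤-trans (distinct-numeric d′ B (suc m″) (suc n″) (height (poly M)) (height (poly N))
        (1≤height (poly M) (deg M)) (1≤height (poly N) (deg N))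
        (≤-trans (≤-trans (≤-reflexive (+-comm 2 m″)) (+-monoʳ-≤ m″ (s≤s (s≤s z≤n)))) m″+n≤)
        (≤-trans (m≤n+m (suc (suc n″)) m″) m″+n≤) FG≤) distinct≤)
        (distinct-separated (suc m″) (suc n″) M N apartM)

    -- Equality of minimal polynomials is never tested; what counts is whether p, that of α,
    -- vanishes at β. If not, the cofactor h of p does, and the minimal polynomial q of β is split
    -- off from h. So p and q divide P jointly, which gives m + n ≤ d. If q vanishes at α, the roles
    -- are exchanged.
    root-separation : ∀ α β → Vanishes P α → Vanishes P β → Apart (difference α β) → ¬ ¬ Separated α β
    root-separation α β nullα nullβ apart none =
      ¬¬minPoly (P , deg-P , nullα) λ k₁ M₀ → ¬¬minPoly (P , deg-P , nullβ) λ k₂ N₀ → main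
          (factor deg-P nullα M₀) N₀
      where
      main : ∀ {k₁ k₂} → Factor {d} P α k₁ → MinPoly β k₂ → ⊥
      main {k₁} {k₂} FM N₀ = same-case {α} {β} M M-height nullα (not-apart⇒null (ev-cauchy p β) λ apartM →
          second apartM (factor codeg-h (h-vanishes apartM) N₀)) apart none
        where
        open Factor FM renaming (minPoly to M; cofactor to h; codegree to j; codeg to codeg-h)
        p : Poly
        p = poly M
        h*p≤ : height h * height p ≤ G * B
        h*p≤ = gelfond d j k₁ h p codeg-h (deg M) (≤-reflexive degree-+)
          (λ i → subst (λ a → ℤ.∣ a ∣ ≤ B) (product≈ i) (P≤B i))
        1≤h : 1 ≤ height h
        1≤h = 1≤height h codeg-h
        p≤ : height p ≤ G * B
        p≤ = ≤-trans (m≤n*m (height p) (height h) {{ℕ.>-nonZero 1≤h}}) h*p≤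
        1≤G : 1 ≤ G
        1≤G = 1≤a*b G B (≤-trans (1≤height p (deg M)) p≤)
          where
          1≤a*b : ∀ a b → 1 ≤ a * b → 1 ≤ a
          1≤a*b (suc a) b _ = s≤s z≤n
        M-height : height p ≤ W * B
        M-height = ≤-trans p≤ (*-monoˡ-≤ B (m≤n*m G G {{ℕ.>-nonZero 1≤G}}))
        h-vanishes : Apart (values p β) → Vanishes h β
        h-vanishes apartM = vanishes-cofactor h p β apartM (vanishes-≈ P (h *ₚ p) β product≈ nullβ)

        second : Apart (values p β) → Factor {j} h β k₂ → ⊥
        second apartM FN = same-case {β} {α} N N-height nullβ (not-apart⇒null (ev-cauchy q α) λ apartN →
            none (distinct-case M N m+n≤d (unit-factorʳ (coeff h j) (coeff p k₁) (coeff P d) tops unit-P)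
              (unit-factorʳ (coeff g i) (coeff q k₂) (coeff h j) (Factor.tops FN)
                (unit-factorˡ (coeff h j) (coeff p k₁) (coeff P d) tops unit-P)) p*q≤ apartM apartN))
            (apart-sym α β apart) (λ separated → none (separated-sym {separationConstant d′ * B ^ d′} β
                α separated))
          where
          open Factor FN using () renaming (minPoly to N; cofactor to g; codegree to i; codeg to
              codeg-g; degree-+ to i+k₂≡j; product≈ to h≈)
          q : Poly
          q = poly N
          j≤d : j ≤ d
          j≤d = ≤-trans (m≤m+n j k₁) (≤-reflexive degree-+)
          -- The second factorisation is one of h, so its bound is relative to `height h`; combined
          -- with `h*p≤` this produces the square in `heightFactor`.
          g*q≤ : height g * height q ≤ G * height h
          g*q≤ = gelfond d i k₂ g q codeg-g (deg N) (≤-trans (≤-reflexive i+k₂≡j) j≤d)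
            (λ n → subst (λ a → ℤ.∣ a ∣ ≤ height h) (h≈ n) (coeff≤height h n))
          q≤ : height q ≤ G * height h
          q≤ = ≤-trans (m≤n*m (height q) (height g) {{ℕ.>-nonZero (1≤height g codeg-g)}}) g*q≤
          p*q≤ : height p * height q ≤ W * B
          p*q≤ = begin
            height p * height q ≤⟨ *-monoʳ-≤ (height p) q≤ ⟩
            height p * (G * height h)
              ≡⟨ solve 3 (λ p g h → p :* (g :* h) := g :* (h :* p)) refl (height p) G (height h) ⟩
            G * (height h * height p) ≤⟨ *-monoʳ-≤ G h*p≤ ⟩
            G * (G * B) ≡⟨ sym (*-assoc G G B) ⟩
            W * B ∎
            where open ≤-Reasoning
          N-height : height q ≤ W * B
          N-height = ≤-trans (m≤n*m (height q) (height p) {{ℕ.>-nonZero (1≤height p (deg M))}}) p*q≤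
          m+n≤d : k₁ + k₂ ≤ d
          m+n≤d = ≤-trans (≤-reflexive (+-comm k₁ k₂)) (≤-trans
              (+-monoˡ-≤ k₁ (≤-trans (m≤n+m k₂ i) (≤-reflexive i+k₂≡j)))
            (≤-reflexive degree-+))

-- From the separation of roots to the bound on e(P).

module Exponent where

  open IntPoly using (Degree; degree; truncate; length-truncate; coeff-truncate; truncate-≈; coeff≤height)
  open Siegel using (*-^; 1≤^)
  open Rationals
  open Gaussian
  open Resultant using (two; 0≤two; 1≤two)
  open Cases using (double-cancel)
  open Analysis
  open MinimalPoly
  open Reducibility
  open Separation
  open RootSeparation
  open import Data.Nat.Coprimality using (Coprime)
  open import Data.Rational.Base hiding (truncate)
  open import Data.Rational.Properties
  open import Data.Rational.Solver using (module +-*-Solver)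
  import Data.Rational.Unnormalised.Base as ℚᵘ
  import Data.Rational.Unnormalised.Properties as ℚᵘₚ
  open import Relation.Unary using (_∈_)

  open +-*-Solver using (solve; _:=_; _:+_; _:*_; _:-_; :-_; con)

  module _ {d′ : ℕ} {p : ℤ[x].Poly} (admissible : Admissible (suc (suc d′)) p) where
    open Admissible admissible

    private
      d : ℕ
      d = suc (suc d′)
      P : ℤ[x].Poly
      P = truncate (suc d) p
      P≈p : P ℤ[x].≈ₚ p
      P≈p = truncate-≈ (suc d) p (λ i d<i → proj₂ (proj₁ monic) i d<i)
      top≡1 : ℤ[x].coeff P d ≡ + 1
      top≡1 = trans (P≈p d) (proj₂ monic)
      deg-P : Degree d P
      deg-P = degree (length-truncate (suc d) p) (λ e → contradiction (trans (sym top≡1) e) (λ ()))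

    1≤height-admissible : 1 ℕ.≤ height p
    1≤height-admissible = subst (ℕ._≤ height p) (cong ℤ.∣_∣ (proj₂ monic)) (coeff≤height p d)

    admissible-separated : ∀ α β → DistinctRoots p α β →
      ¬ ¬ SeparatedBy (separationConstant d′ ℕ.* height p ℕ.^ d′) α β
    admissible-separated α β (rootα , rootβ , α≄β) none =
      α≄β (null⇒≃ α β (not-apart⇒null (cauchy-cong (at-- α β) (at-cauchy (α -ᶜ β))) λ apart →
        root-separation d′ P (height p) 1≤height-admissible
          (λ i → subst (λ a → ℤ.∣ a ∣ ℕ.≤ height p) (sym (P≈p i)) (coeff≤height p i))
          deg-P (cong ℤ.∣_∣ top≡1)
          (λ {z} null → reducible-degree {p} (proj₁ monic) reducible (vanishes-≈ P p z P≈p null))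
          α β (to-P α rootα) (to-P β rootβ) apart none))
      where
      to-P : ∀ z → IsRoot p z → Vanishes P z
      to-P z root = vanishes-≈ p P z (λ i → sym (P≈p i)) (root⇒null p z root)

  seq-^ : ∀ x k n → seq (x ^ᴿ k) n ≡ seq x n ↑ k
  seq-^ x zero    n = refl
  seq-^ x (suc k) n = cong (seq x n *_) (seq-^ x k n)

  -- Approximations of a modulus are non-negative only up to an error. Being at least -½ is enough
  -- to exclude the negative square roots.
  root-of-one : ∀ y → - ½ ≤ y → 1ℚ ≤ y * y → 1ℚ ≤ y
  root-of-one y -½≤y 1≤y² with ≤-total 0ℚ y
  ... | inj₁ 0≤y = square-cancel 0≤y 1≤y²
  ... | inj₂ y≤0 = contradiction (≤-trans 1≤y² (begin
      y * y ≡⟨ solve 1 (λ y → y :* y := (:- y) :* (:- y)) refl y ⟩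
      (- y) * (- y) ≤⟨ *-mono₀ 0≤-y -y≤½ 0≤-y -y≤½ ⟩
      ½ * ½ ∎)) (λ { (*≤* (ℤ.+≤+ (s≤s ()))) })
    where
    open ≤-Reasoning
    0≤-y : 0ℚ ≤ - y
    0≤-y = neg-antimono-≤ y≤0
    -y≤½ : - y ≤ ½
    -y≤½ = neg-antimono-≤ -½≤y

  module _ {α β : ℂ} {s : ℝ} (modulus : IsModulus (α -ᶜ β) s) (C : ℕ) where

    private
      κ : ℚ
      κ = ⟨ C ⟩
      0≤κ : 0ℚ ≤ κ
      0≤κ = 0≤⟨⟩ C
      0<¼ : 0ℚ < ½ * ½
      0<¼ = half 0<½

    -- With X the sum norm, X² is at most twice the squared modulus, so 4 ≤ 4 κ² X² ≤ 8 κ² (s² + η).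
    -- The errors are chosen with 8 κ² η ≤ 2, which leaves 1 ≤ (2 κ s)²; the choice of θ makes 2 κ s
    -- at least -½.
    modulus-lower : SeparatedBy C α β → ∃[ N ] ∀ n → N ℕ.≤ n → 1ℚ ≤ (two * κ) * seq s n
    modulus-lower (A , far) = lower (scale-down (κ * κ) (½ * ½) (0≤* 0≤κ 0≤κ) 0<¼)
        (scale-down κ (½ * ½) 0≤κ 0<¼)
      where
      open ≤-Reasoning
      lower : ∃[ η ] 0ℚ < η × κ * κ * η ≤ ½ * ½ → ∃[ η ] 0ℚ < η × κ * η ≤ ½ * ½ →
        ∃[ N ] ∀ n → N ℕ.≤ n → 1ℚ ≤ (two * κ) * seq s n
      lower (η , 0<η , κ²η≤) (θ , 0<θ , κθ≤) = combine (proj₂ (proj₂ modulus) η 0<η) (proj₁ modulus θ 0<θ)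
        where
        combine : _ → _ → ∃[ N ] ∀ n → N ℕ.≤ n → 1ℚ ≤ (two * κ) * seq s n
        combine (M , square≤) (L , 0≤s) = (A ℕ.⊔ M) ℕ.⊔ L , λ n p →
          let pAM = ℕₚ.m⊔n≤o⇒m≤o (A ℕ.⊔ M) L p in
          bound n (far n (ℕₚ.m⊔n≤o⇒m≤o A M pAM)) (square≤ n (ℕₚ.m⊔n≤o⇒n≤o A M pAM))
              (0≤s n (ℕₚ.m⊔n≤o⇒n≤o (A ℕ.⊔ M) L p))
          where
          bound : ∀ n → 1ℚ ≤ κ * ‖ difference α β n ‖ →
            seq (re (α -ᶜ β) ^ᴿ 2 +ᴿ im (α -ᶜ β) ^ᴿ 2) n ≤ seq (s ^ᴿ 2) n + η →
            0ℚ ≤ seq s n + θ → 1ℚ ≤ (two * κ) * seq s n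
          bound n 1≤κX square≤ 0≤s+θ = root-of-one ((two * κ) * y)
            (begin
              - ½ ≡⟨ refl ⟩
              two * (- (½ * ½)) ≤⟨ *-monoˡ₀ 0≤two (neg-antimono-≤ κθ≤) ⟩
              two * (- (κ * θ))             ≤⟨ *-monoˡ₀ 0≤two
                  (≤-by { - (κ * θ)} {κ * y} (κ * (y + θ)) (0≤* 0≤κ 0≤s+θ)
                   (solve 3 (λ κ y θ → κ :* y := :- (κ :* θ) :+ κ :* (y :+ θ)) refl κ y θ)) ⟩
              two * (κ * y) ≡⟨ sym (*-assoc two κ y) ⟩
              (two * κ) * y ∎)
            (double-cancel (begin
              1ℚ + 1ℚ ≡⟨ refl ⟩
              two * two * (1ℚ * 1ℚ) - two
                ≤⟨ +-monoˡ-≤ (- two) (*-monoˡ₀ (0≤* 0≤two 0≤two) (*-mono₀ 0≤1 1≤κX 0≤1 1≤κX)) ⟩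
              two * two * ((κ * X) * (κ * X)) - two
                ≤⟨ +-monoˡ-≤ (- two) (*-monoˡ₀ (0≤* 0≤two 0≤two) (≤-trans
                     (≤-reflexive (solve 2 (λ κ X → (κ :* X) :* (κ :* X) := (κ :* κ) :* (X :* X)) refl κ X))
                     (*-monoˡ₀ (0≤* 0≤κ 0≤κ) (≤-trans (‖‖²≤2∣∣² (difference α β n))
                         (+-mono-≤ modulus≤ modulus≤))))) ⟩
              two * two * (κ * κ * ((y * y + η) + (y * y + η))) - two
                ≡⟨ solve 3 (λ κ y η → con two :* con two :* (κ :* κ :* ((y :* y :+ η) :+ (y :* y :+ η)))
                    :- con two
                     := ((con two :* κ :* y) :* (con two :* κ :* y) :+ (con two :* κ :* y) :*
                         (con two :* κ :* y))
                        :+ (con (two * two * two) :* (κ :* κ :* η) :- con two)) refl κ y η ⟩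
              (Y + Y) + (two * two * two * (κ * κ * η) - two)
                ≤⟨ +-monoʳ-≤ (Y + Y) (+-monoˡ-≤ (- two) (*-monoˡ₀ (0≤* (0≤* 0≤two 0≤two) 0≤two) κ²η≤)) ⟩
              (Y + Y) + (two * two * two * (½ * ½) - two) ≡⟨ +-identityʳ (Y + Y) ⟩
              Y + Y ∎))
            where
            y X Y : ℚ
            y = seq s n
            X = ‖ difference α β n ‖
            Y = ((two * κ) * y) * ((two * κ) * y)
            a b : ℚ
            a = seq (re α) n - seq (re β) n
            b = seq (im α) n - seq (im β) n
            modulus≤ : ∣ difference α β n ∣² ≤ y * y + η
            modulus≤ = subst₂ _≤_
              (trans (solve 2 (λ a b → a :* (a :* con 1ℚ) :+ b :* (b :* con 1ℚ) := a :* a :+ b :* b) refl a b)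
                (sym (trans (cong ∣_∣² (⊖≡ (seq (re α) n) (seq (im α) n) (seq (re β) n) (seq (im β) n)))
                    (∣∣²≡ a b))))
              (cong (λ z → y * z + η) (*-identityʳ y)) square≤

  inverse-cancel : ∀ N .{{_ : ℕ.NonZero N}} → ⟨ N ⟩ * (+ 1 / N) ≡ 1ℚ
  inverse-cancel (suc n) = toℚᵘ-injective (ℚᵘₚ.≃-trans (toℚᵘ-homo-* ⟨ suc n ⟩ (+ 1 / suc n))
    (ℚᵘₚ.≃-trans (ℚᵘₚ.*-cong (toℚᵘ-cast (+ suc n)) (toℚᵘ-fromℚᵘ (ℚᵘ.mkℚᵘ (+ 1) n)))
      (ℚᵘ.*≡* (trans (ℤₚ.*-identityʳ _) (trans (ℤₚ.*-identityʳ (+ suc n))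
        (sym (trans (ℤₚ.*-identityˡ _) (cong +_ (ℕₚ.*-identityˡ (suc n))))))))))

  -- Integrality gives c^q + 1 ≤ N. But N ≤ N (c s)^q ≤ c^q + c^q N ε, and ε is chosen such that the
  -- last term is at most ½.
  power-contradiction : ∀ (s : ℝ) c q N .{{_ : ℕ.NonZero N}} → c ℕ.^ q ℕ.< N →
    (∃[ M ] ∀ n → M ℕ.≤ n → 1ℚ ≤ ⟨ c ⟩ * seq s n) → ¬ (s ^ᴿ q ≤ᴿ fromℚ (+ 1 / N))
  power-contradiction s c q N A<N (M , far) upper = refute (scale-down ⟨ A ℕ.* N ⟩ ½ (0≤⟨⟩ (A ℕ.* N)) 0<½)
    where
    open ≤-Reasoning
    A : ℕ
    A = c ℕ.^ q
    i : ℚ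
    i = + 1 / N
    refute : ∃[ ε ] 0ℚ < ε × ⟨ A ℕ.* N ⟩ * ε ≤ ½ → ⊥
    refute (ε , 0<ε , small) = combine (upper ε 0<ε)
      where
      combine : _ → ⊥
      combine (L , power≤) = <-irrefl refl (<-≤-trans ½<1 (+-cancel (begin
        ⟨ A ⟩ + 1ℚ ≡⟨ trans (cong (_+_ ⟨ A ⟩) (sym ⟨1⟩)) (sym (⟨⟩-+ A 1)) ⟩
        ⟨ A ℕ.+ 1 ⟩ ≤⟨ ⟨⟩-mono (subst (ℕ._≤ N) (ℕₚ.+-comm 1 A) A<N) ⟩
        ⟨ N ⟩ ≡⟨ sym (*-identityʳ ⟨ N ⟩) ⟩
        ⟨ N ⟩ * 1ℚ
          ≤⟨ *-monoˡ₀ (0≤⟨⟩ N) (≤-trans (1≤↑ (far n (ℕₚ.m≤m⊔n M L)) q) (≤-reflexive (↑-* ⟨ c ⟩ y q))) ⟩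
        ⟨ N ⟩ * (⟨ c ⟩ ↑ q * y ↑ q)
          ≤⟨ *-monoˡ₀ (0≤⟨⟩ N) (*-monoˡ₀ (0≤↑ (0≤⟨⟩ c) q) (subst (_≤ i + ε) (seq-^ s q n)
              (power≤ n (ℕₚ.m≤n⊔m M L)))) ⟩
        ⟨ N ⟩ * (⟨ c ⟩ ↑ q * (i + ε)) ≡⟨ cong (λ z → ⟨ N ⟩ * (z * (i + ε))) (sym (⟨⟩-^ c q)) ⟩
        ⟨ N ⟩ * (⟨ A ⟩ * (i + ε))
          ≡⟨ solve 4 (λ N A i ε → N :* (A :* (i :+ ε)) := A :* (N :* i) :+ A :* N :* ε) refl (⟨ N ⟩)
              (⟨ A ⟩) i ε ⟩
        ⟨ A ⟩ * (⟨ N ⟩ * i) + ⟨ A ⟩ * ⟨ N ⟩ * ε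
          ≡⟨ cong₂ _+_ (trans (cong (⟨ A ⟩ *_) (inverse-cancel N)) (*-identityʳ ⟨ A ⟩))
              (cong (_* ε) (sym (⟨⟩-* A N))) ⟩
        ⟨ A ⟩ + ⟨ A ℕ.* N ⟩ * ε ≤⟨ +-monoʳ-≤ ⟨ A ⟩ small ⟩
        ⟨ A ⟩ + ½ ∎)))
        where
        n : ℕ
        n = M ℕ.⊔ L
        y : ℚ
        y = seq s n
        ½<1 : ½ < 1ℚ
        ½<1 = *<* (ℤ.+<+ (s≤s (s≤s z≤n)))
        +-cancel : ∀ {a b} → ⟨ A ⟩ + a ≤ ⟨ A ⟩ + b → a ≤ b
        +-cancel {a} {b} le = subst₂ _≤_ (shift a) (shift b) (+-monoʳ-≤ (- ⟨ A ⟩) le)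
          where
          shift : ∀ x → - ⟨ A ⟩ + (⟨ A ⟩ + x) ≡ x
          shift x = solve 2 (λ A x → :- A :+ (A :+ x) := x) refl (⟨ A ⟩) x

  -- A single late approximation of e is compared with r + ε/2, which is decidable. If it is larger,
  -- all late ones are at least r, contrary to the hypothesis.
  ≤ᴿ-stable : ∀ e r → ¬ (-ᴿ e ≤ᴿ fromℚ (- r)) → e ≤ᴿ fromℚ r
  ≤ᴿ-stable e r ¬≥ ε 0<ε with cauchy e (ε * ½) (half 0<ε)
  ... | N , close with seq e N ≤? r + ε * ½
  ...   | yes small = N , λ n p → ≤-trans (difference-bound (<⇒≤ (close n N p ℕₚ.≤-refl)))
            (≤-trans (+-monoˡ-≤ (ε * ½) small) (≤-reflexive
              (solve 2 (λ r ε → r :+ ε :* con ½ :+ ε :* con ½ := r :+ ε) refl r ε)))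
  ...   | no large = contradiction (λ ε′ 0<ε′ → N , λ n p → ≤-trans (neg-antimono-≤ (lower n p))
            (p≤p+q (- r) (<⇒≤ 0<ε′))) ¬≥
    where
    lower : ∀ n → N ℕ.≤ n → r ≤ seq e n
    lower n p = subst₂ _≤_
      (solve 2 (λ r ε → r :+ ε :- ε := r) refl r (ε * ½))
      (solve 2 (λ x ε → x :+ ε :- ε := x) refl (seq e n) (ε * ½))
      (+-monoˡ-≤ (- (ε * ½)) (≤-trans (<⇒≤ (≰⇒> large)) (difference-bound (<⇒≤ (close N n ℕₚ.≤-refl p)))))

  -- For r = (n + 1)/q, strictness and integrality give a whole unit between d′ q and n + 1. It
  -- becomes the spare factor H in `threshold-bound`.
  numerator-bound : ∀ d′ n b .(c : Coprime (suc n) (suc b)) → (+ d′) / 1 < mkℚ (+ suc n) b c → d′ ℕ.*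
      suc b ℕ.≤ n
  numerator-bound d′ n b c d′<r = ℕₚ.≤-pred (ℕₚ.≰⇒> λ n<db → <-irrefl refl (<-≤-trans
    (subst₂ _<_ (trans (cong (⟨ suc b ⟩ *_) (sym (cast≡ (+ d′)))) (sym (⟨⟩-* (suc b) d′)))
        (cast-↧ (mkℚ (+ suc n) b c))
      (*-monoʳ-<-pos ⟨ suc b ⟩ {{positive (<-≤-trans 0<1 (subst (_≤ ⟨ suc b ⟩) ⟨1⟩
          (⟨⟩-mono (s≤s z≤n))))}} d′<r))
    (⟨⟩-mono (subst (suc n ℕ.≤_) (ℕₚ.*-comm d′ (suc b)) n<db))))

  -- From here on the spare factor H exceeds the q-th power of the constant 2κ.
  threshold : ℕ → ℕ → ℕ
  threshold d′ q = suc ((2 ℕ.* separationConstant d′) ℕ.^ q)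

  threshold-bound : ∀ d′ q n H → d′ ℕ.* q ℕ.≤ n → threshold d′ q ℕ.≤ H →
    (2 ℕ.* (separationConstant d′ ℕ.* H ℕ.^ d′)) ℕ.^ q ℕ.< H ℕ.^ suc n
  threshold-bound d′ q n (suc H′) dq≤n κ<H = begin-strict
    (2 ℕ.* (κ ℕ.* H ℕ.^ d′)) ℕ.^ q ≡⟨ cong (ℕ._^ q) (sym (ℕₚ.*-assoc 2 κ (H ℕ.^ d′))) ⟩
    (2 ℕ.* κ ℕ.* H ℕ.^ d′) ℕ.^ q ≡⟨ *-^ (2 ℕ.* κ) (H ℕ.^ d′) q ⟩
    (2 ℕ.* κ) ℕ.^ q ℕ.* (H ℕ.^ d′) ℕ.^ q ≡⟨ cong ((2 ℕ.* κ) ℕ.^ q ℕ.*_) (ℕₚ.^-*-assoc H d′ q) ⟩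
    (2 ℕ.* κ) ℕ.^ q ℕ.* H ℕ.^ (d′ ℕ.* q) ≤⟨ ℕₚ.*-monoʳ-≤ ((2 ℕ.* κ) ℕ.^ q) (ℕₚ.^-monoʳ-≤ H dq≤n) ⟩
    (2 ℕ.* κ) ℕ.^ q ℕ.* H ℕ.^ n <⟨ ℕₚ.*-monoˡ-< (H ℕ.^ n) {{ℕₚ.m^n≢0 H n}} κ<H ⟩
    H ℕ.* H ℕ.^ n ∎
    where
    open ℕₚ.≤-Reasoning
    H κ : ℕ
    H = suc H′
    κ = separationConstant d′

  0≤/1 : ∀ n → 0ℚ ≤ (+ n) / 1
  0≤/1 n = subst (0ℚ ≤_) (cast≡ (+ n)) (0≤⟨⟩ n)

  -- If -e ≤ -r with r = (n + 1)/q, then `upper` at -r gives sep^q ≤ H^(-n - 1). The minimum is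
  -- attained at a pair of roots, whose distance is at least of order H^(2 - d), and for H beyond
  -- the threshold the two bounds collide.
  exponent-bound : ∀ d′ r → (+ d′) / 1 < r → ∀ {p e} → Admissible (suc (suc d′)) p →
    threshold d′ (↧ₙ r) ℕ.≤ height p → IsExponent p e → e ≤ᴿ fromℚ r
  exponent-bound d′ (mkℚ (+ zero) b c) d′<r with ≤-<-trans (0≤/1 d′) d′<r
  ... | *<* (ℤ.+<+ ())
  exponent-bound d′ (mkℚ -[1+ n ] b c) d′<r with ≤-<-trans (0≤/1 d′) d′<r
  ... | *<* ()
  exponent-bound d′ r@(mkℚ (+ suc n) b c) d′<r {p} {e} admissible large isExponent =
    ≤ᴿ-stable e r λ -e≤-r → conclude (proj₁ isSep) (upper (- r) -e≤-r)
    where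
    open IsExponent isExponent
    open IsPower {{1<height}} isPower
    H q : ℕ
    H = height p
    q = suc b
    instance
      H≢0 : ℕ.NonZero H
      H≢0 = ℕ.nonTrivial⇒nonZero H {{1<height}}
    C : ℕ
    C = separationConstant d′ ℕ.* H ℕ.^ d′
    conclude : sep ∈ RootDistance p → sep ^ᴿ q ≤ᴿ fromℚ ((+ 1 / (H ℕ.^ suc n)) {{ℕₚ.m^n≢0 H (suc n)}}) → ⊥
    conclude (α , β , distinct , modulus) power≤ = admissible-separated admissible α β distinct λ separated →
      power-contradiction sep (2 ℕ.* C) q (H ℕ.^ suc n) {{ℕₚ.m^n≢0 H (suc n)}}
        (threshold-bound d′ q n H (numerator-bound d′ n b c d′<r) large)
        (far (modulus-lower {α} {β} {sep} modulus C separated)) power≤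
      where
      far : ∃[ M ] (∀ n → M ℕ.≤ n → 1ℚ ≤ (two * ⟨ C ⟩) * seq sep n) →
        ∃[ M ] ∀ n → M ℕ.≤ n → 1ℚ ≤ ⟨ 2 ℕ.* C ⟩ * seq sep n
      far (M , h) = M , λ n p → subst (λ c → 1ℚ ≤ c * seq sep n)
        (trans (cong (_* ⟨ C ⟩) two≡) (sym (⟨⟩-* 2 C))) (h n p)

open import Data.Nat.Base using (ℕ; _≤_)
open import Data.Integer.Base using (+_; _-_)
open import Data.Rational.Base using (_/_)

theorem1 : (d : ℕ) → 2 ≤ d → e*ᵣ d ≤ᵁ (+ d - + 2) / 1
-- The infimum asks for one height beyond which all exponents are at most r; for given d it depends
-- on the denominator of r only.
theorem1 (suc (suc d′)) (s≤s (s≤s z≤n)) r d′<r = Exponent.threshold d′ (ℚ.↧ₙ r) ,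
  λ { e (p , admissible , large , isExponent) → Exponent.exponent-bound d′ r d′<r admissible large isExponent }
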